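{- Let $p<q<r$ be odd primes, $n=pqr$ and $m=\phi(n)$. Then $$\mathrm{Cond}(V_{\Phi_n})\le 2m^4.$$
   Context: $\phi$ is Euler's totient, $\Phi_n$ is the $n$-th cyclotomic polynomial, of degree $m=\phi(n)$, and $\zeta_1,\dots,\zeta_m\in\mathbb{C}$ are the primitive $n$-th roots of unity (in any fixed order). $V_{\Phi_n}$ is the $m\times m$ Vandermonde matrix whose $(i,j)$ entry is $\zeta_i^{\,j-1}$, $1\le i,j\le m$. For a complex matrix $A=(a_{ij})$, $\|A\|=\sqrt{\sum_{i,j}|a_{ij}|^2}$ is the Frobenius norm, and for invertible $A$, $\mathrm{Cond}(A)=\|A\|\,\|A^{ -1}\|$. -}

module Defs where

open import Algebra.Bundles.Raw using (RawRing)
import Algebra.Definitions.RawSemiring as RawSemiringDefs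
open import Data.Bool.Base using (if_then_else_)
open import Data.Fin.Base using (Fin; toℕ)
import Data.Fin.Properties as Fin
open import Data.Integer.Base as ℤ using (+_; +[1+_]; -[1+_])
import Data.Integer.DivMod as ℤ
import Data.Integer.Properties as ℤ
open import Data.List.Base using (length; filter; map; upTo)
open import Data.Nat.Base as ℕ using (ℕ; zero; suc)
open import Data.Nat.Coprimality using (Coprime; coprime?)
import Data.Nat.DivMod as ℕ
import Data.Nat.Properties as ℕ
open import Data.Product.Base using (_×_; _,_; ∃-syntax)
open import Data.Rational.Base as ℚ using (ℚ; mkℚ; 0ℚ; 1ℚ; ½; ∣_∣; floor; positive; nonNegative; *≤*; *<*)
open import Data.Rational.Literals using (fromℤ)
import Data.Rational.Properties as ℚ
open import Data.Rational.Solver using (module +-*-Solver)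
import Data.Rational.Unnormalised.Base as ℚᵘ
import Data.Rational.Unnormalised.Properties as ℚᵘ
open import Data.Sum.Base using (inj₁; inj₂)
open import Function.Definitions using (Injective)
open import Level using (0ℓ)
open import Relation.Binary.PropositionalEquality
  using (_≡_; refl; sym; trans; cong; cong₂; subst; subst₂)
open import Relation.Nullary using (¬_; yes; no; does; contradiction)

open +-*-Solver using (solve; _:+_; _:*_; _:-_; :-_; con; _:=_)

<⇒≱ : ∀ {p q} → p ℚ.< q → ¬ q ℚ.≤ p
<⇒≱ p<q q≤p = ℚ.<-irrefl refl (ℚ.<-≤-trans p<q q≤p)

⊓-pos : ∀ {p q} → 0ℚ ℚ.< p → 0ℚ ℚ.< q → 0ℚ ℚ.< p ℚ.⊓ q
⊓-pos {p} {q} p>0 q>0 with ℚ.⊓-sel p q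
... | inj₁ eq = subst (0ℚ ℚ.<_) (sym eq) p>0
... | inj₂ eq = subst (0ℚ ℚ.<_) (sym eq) q>0

half-pos : ∀ {ε} → 0ℚ ℚ.< ε → 0ℚ ℚ.< ε ℚ.* ½
half-pos {ε} ε>0 = subst (ℚ._< ε ℚ.* ½) (ℚ.*-zeroˡ ½) (ℚ.*-monoˡ-<-pos ½ ε>0)

half+half : ∀ ε → ε ℚ.* ½ ℚ.+ ε ℚ.* ½ ≡ ε
half+half ε = trans (sym (ℚ.*-distribˡ-+ ε ½ ½)) (ℚ.*-identityʳ ε)

*-pos : ∀ {p q} → 0ℚ ℚ.< p → 0ℚ ℚ.< q → 0ℚ ℚ.< p ℚ.* q
*-pos {p} {q} p>0 q>0 =
  subst (ℚ._< p ℚ.* q) (ℚ.*-zeroˡ q) (ℚ.*-monoˡ-<-pos q {{positive q>0}} p>0)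

*-nonNeg : ∀ {p q} → 0ℚ ℚ.≤ p → 0ℚ ℚ.≤ q → 0ℚ ℚ.≤ p ℚ.* q
*-nonNeg {p} {q} p≥0 q≥0 =
  subst (ℚ._≤ p ℚ.* q) (ℚ.*-zeroˡ q) (ℚ.*-monoʳ-≤-nonNeg q {{nonNegative q≥0}} p≥0)

*-mono-≤ : ∀ {a b c d} → 0ℚ ℚ.≤ b → 0ℚ ℚ.≤ c → a ℚ.≤ b → c ℚ.≤ d → a ℚ.* c ℚ.≤ b ℚ.* d
*-mono-≤ {a} {b} {c} {d} b≥0 c≥0 a≤b c≤d = ℚ.≤-trans
  (ℚ.*-monoʳ-≤-nonNeg c {{nonNegative c≥0}} a≤b)
  (ℚ.*-monoˡ-≤-nonNeg b {{nonNegative b≥0}} c≤d)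

square-cancel-≤ : ∀ {a b} → 0ℚ ℚ.≤ b → a ℚ.* a ℚ.≤ b ℚ.* b → a ℚ.≤ b
square-cancel-≤ {a} {b} b≥0 aa≤bb with a ℚ.≤? b
... | yes a≤b = a≤b
... | no  a≰b = contradiction aa≤bb (<⇒≱ (ℚ.≤-<-trans
        (ℚ.*-monoˡ-≤-nonNeg b {{nonNegative b≥0}} (ℚ.<⇒≤ b<a))
        (ℚ.*-monoˡ-<-pos a {{positive (ℚ.≤-<-trans b≥0 b<a)}} b<a)))
  where b<a = ℚ.≰⇒> a≰b

shrink : ∀ {B ε} → 0ℚ ℚ.< B → 0ℚ ℚ.< ε → ∃[ δ ] 0ℚ ℚ.< δ × B ℚ.* δ ≡ ε
shrink {B} {ε} B>0 ε>0 = ε ℚ.* 1/B , *-pos ε>0 1/B>0 , eq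
  where
  instance
    B-pos = positive B>0
    B-nz  = ℚ.pos⇒nonZero B
  1/B = ℚ.1/ B
  1/B>0 : 0ℚ ℚ.< 1/B
  1/B>0 = ℚ.positive⁻¹ 1/B {{ℚ.1/pos⇒pos B}}
  eq : B ℚ.* (ε ℚ.* 1/B) ≡ ε
  eq = trans (solve 3 (λ b e i → b :* (e :* i) := e :* (b :* i)) refl B ε 1/B)
      (trans (cong (ε ℚ.*_) (ℚ.*-inverseʳ B)) (ℚ.*-identityʳ ε))

∣-∣<-intro : ∀ {a b ε} → a ℚ.< b ℚ.+ ε → b ℚ.< a ℚ.+ ε → ∣ a ℚ.- b ∣ ℚ.< ε
∣-∣<-intro {a} {b} {ε} a< b< with ℚ.∣p∣≡p∨∣p∣≡-p (a ℚ.- b)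
... | inj₁ eq = subst₂ ℚ._<_ (sym eq)
        (solve 2 (λ b e → (b :+ e) :- b := e) refl b ε) (ℚ.+-monoˡ-< (ℚ.- b) a<)
... | inj₂ eq = subst₂ ℚ._<_
        (trans (solve 2 (λ a b → b :- a := :- (a :- b)) refl a b) (sym eq))
        (solve 2 (λ a e → (a :+ e) :- a := e) refl a ε) (ℚ.+-monoˡ-< (ℚ.- a) b<)

p≤∣p∣ : ∀ p → p ℚ.≤ ∣ p ∣
p≤∣p∣ (mkℚ (+ _)    _ _) = ℚ.≤-refl
p≤∣p∣ p@(mkℚ -[1+ _ ] _ _) = ℚ.≤-trans (ℚ.<⇒≤ (ℚ.negative⁻¹ p)) (ℚ.0≤∣p∣ p)

∣-∣<-elim : ∀ {a b ε} → ∣ a ℚ.- b ∣ ℚ.< ε → a ℚ.< b ℚ.+ ε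
∣-∣<-elim {a} {b} {ε} h = subst (ℚ._< b ℚ.+ ε)
  (solve 2 (λ a b → b :+ (a :- b) := a) refl a b)
  (ℚ.+-monoʳ-< b (ℚ.≤-<-trans (p≤∣p∣ (a ℚ.- b)) h))

-- Reals are Cauchy sequences of rationals; ≈ and ≤ compare limits, so ≈ is the
-- equality of real numbers and _≡_ on ℝ is not meaningful.

record Cauchy (x : ℕ → ℚ) : Set where
  constructor mkCauchy
  field
    converge : ∀ ε → 0ℚ ℚ.< ε →
      ∃[ N ] (∀ m n → N ℕ.≤ m → N ℕ.≤ n → ∣ x m ℚ.- x n ∣ ℚ.< ε)

open Cauchy public

record ℝ : Set where
  constructor mkℝ
  field
    seq    : ℕ → ℚ
    cauchy : Cauchy seq

open ℝ public

infix 4 _≈_ _≤_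

record _≈_ (x y : ℝ) : Set where
  constructor mk≈
  field
    close : ∀ ε → 0ℚ ℚ.< ε →
      ∃[ N ] (∀ n → N ℕ.≤ n → ∣ seq x n ℚ.- seq y n ∣ ℚ.< ε)

record _≤_ (x y : ℝ) : Set where
  constructor mk≤
  field
    below : ∀ ε → 0ℚ ℚ.< ε →
      ∃[ N ] (∀ n → N ℕ.≤ n → seq x n ℚ.≤ seq y n ℚ.+ ε)

open _≈_ public
open _≤_ public

fromℚ : ℚ → ℝ
fromℚ q = mkℝ (λ _ → q) (mkCauchy λ ε ε>0 →
  0 , λ _ _ _ _ → subst (ℚ._< ε) (sym (cong ∣_∣ (ℚ.+-inverseʳ q))) ε>0)

fromℕ : ℕ → ℝ
fromℕ k = fromℚ (fromℤ (+ k))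

0ℝ 1ℝ : ℝ
0ℝ = fromℚ 0ℚ
1ℝ = fromℚ 1ℚ

bounded : ∀ {x} → Cauchy x → ∃[ B ] 0ℚ ℚ.< B × ∃[ N ] (∀ n → N ℕ.≤ n → ∣ x n ∣ ℚ.≤ B)
bounded {x} c with converge c 1ℚ (ℚ.positive⁻¹ 1ℚ)
... | N , h = ∣ x N ∣ ℚ.+ 1ℚ ,
    ℚ.+-mono-≤-< (ℚ.0≤∣p∣ (x N)) (ℚ.positive⁻¹ 1ℚ) , N , λ n N≤n →
    subst (ℚ._≤ ∣ x N ∣ ℚ.+ 1ℚ)
      (cong ∣_∣ (solve 2 (λ a b → b :+ (a :- b) := a) refl (x n) (x N)))
      (ℚ.≤-trans (ℚ.∣p+q∣≤∣p∣+∣q∣ (x N) (x n ℚ.- x N))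
                 (ℚ.+-monoʳ-≤ ∣ x N ∣ (ℚ.<⇒≤ (h n N N≤n ℕ.≤-refl))))

+-cauchy : ∀ {x y} → Cauchy x → Cauchy y → Cauchy (λ n → x n ℚ.+ y n)
+-cauchy {x} {y} cx cy .converge ε ε>0
  with converge cx (ε ℚ.* ½) (half-pos ε>0) | converge cy (ε ℚ.* ½) (half-pos ε>0)
... | M , hx | N , hy = M ℕ.⊔ N , λ m n le₁ le₂ → ℚ.≤-<-trans
  (subst (ℚ._≤ ∣ x m ℚ.- x n ∣ ℚ.+ ∣ y m ℚ.- y n ∣)
    (cong ∣_∣ (solve 4 (λ a b c d → (a :- b) :+ (c :- d) := (a :+ c) :- (b :+ d))
               refl (x m) (x n) (y m) (y n)))
    (ℚ.∣p+q∣≤∣p∣+∣q∣ (x m ℚ.- x n) (y m ℚ.- y n)))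
  (subst (∣ x m ℚ.- x n ∣ ℚ.+ ∣ y m ℚ.- y n ∣ ℚ.<_) (half+half ε)
    (ℚ.+-mono-< (hx m n (ℕ.m⊔n≤o⇒m≤o M N le₁) (ℕ.m⊔n≤o⇒m≤o M N le₂))
                (hy m n (ℕ.m⊔n≤o⇒n≤o M N le₁) (ℕ.m⊔n≤o⇒n≤o M N le₂))))

neg-cauchy : ∀ {x} → Cauchy x → Cauchy (λ n → ℚ.- x n)
neg-cauchy {x} cx .converge ε ε>0 with converge cx ε ε>0
... | N , h = N , λ m n le₁ le₂ → subst (ℚ._< ε)
  (cong ∣_∣ (solve 2 (λ a b → b :- a := (:- a) :- (:- b)) refl (x m) (x n)))
  (h n m le₂ le₁)

*-close : ∀ a a′ b b′ {B C δ γ ε} → 0ℚ ℚ.< B → 0ℚ ℚ.< C →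
          ∣ a ∣ ℚ.≤ B → ∣ b′ ∣ ℚ.≤ C → ∣ b ℚ.- b′ ∣ ℚ.< δ → ∣ a ℚ.- a′ ∣ ℚ.< γ →
          B ℚ.* δ ≡ ε ℚ.* ½ → C ℚ.* γ ≡ ε ℚ.* ½ → ∣ a ℚ.* b ℚ.- a′ ℚ.* b′ ∣ ℚ.< ε
*-close a a′ b b′ {B} {C} {δ} {γ} {ε} B>0 C>0 a≤B b′≤C db da Bδ Cγ = ℚ.≤-<-trans
  (subst (ℚ._≤ ∣ a ℚ.* (b ℚ.- b′) ∣ ℚ.+ ∣ b′ ℚ.* (a ℚ.- a′) ∣)
    (cong ∣_∣ (solve 4 (λ a a′ b b′ → a :* (b :- b′) :+ b′ :* (a :- a′) := a :* b :- a′ :* b′)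
               refl a a′ b b′))
    (ℚ.∣p+q∣≤∣p∣+∣q∣ (a ℚ.* (b ℚ.- b′)) (b′ ℚ.* (a ℚ.- a′))))
  (subst (∣ a ℚ.* (b ℚ.- b′) ∣ ℚ.+ ∣ b′ ℚ.* (a ℚ.- a′) ∣ ℚ.<_) (half+half ε)
    (ℚ.+-mono-< (bound a (b ℚ.- b′) B>0 a≤B db Bδ) (bound b′ (a ℚ.- a′) C>0 b′≤C da Cγ)))
  where
  bound : ∀ c d {B δ} → 0ℚ ℚ.< B → ∣ c ∣ ℚ.≤ B → ∣ d ∣ ℚ.< δ → B ℚ.* δ ≡ ε ℚ.* ½ →
          ∣ c ℚ.* d ∣ ℚ.< ε ℚ.* ½
  bound c d {B} {δ} B>0 c≤B d<δ eq = subst₂ ℚ._<_ (sym (ℚ.∣p*q∣≡∣p∣*∣q∣ c d)) eq (ℚ.≤-<-trans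
    (ℚ.*-monoʳ-≤-nonNeg ∣ d ∣ {{ℚ.∣-∣-nonNeg d}} c≤B)
    (ℚ.*-monoʳ-<-pos B {{positive B>0}} d<δ))

*-cauchy : ∀ {x y} → Cauchy x → Cauchy y → Cauchy (λ n → x n ℚ.* y n)
*-cauchy {x} {y} cx cy .converge ε ε>0 =
  let B , B>0 , M , bx = bounded cx
      C , C>0 , N , by = bounded cy
      δ , δ>0 , Bδ     = shrink B>0 (half-pos ε>0)
      γ , γ>0 , Cγ     = shrink C>0 (half-pos ε>0)
      K , hy           = converge cy δ δ>0
      L , hx           = converge cx γ γ>0
      split            = λ n (le : (M ℕ.⊔ N) ℕ.⊔ (K ℕ.⊔ L) ℕ.≤ n) →
        ℕ.m⊔n≤o⇒m≤o M N (ℕ.m⊔n≤o⇒m≤o (M ℕ.⊔ N) (K ℕ.⊔ L) le) ,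
        ℕ.m⊔n≤o⇒n≤o M N (ℕ.m⊔n≤o⇒m≤o (M ℕ.⊔ N) (K ℕ.⊔ L) le) ,
        ℕ.m⊔n≤o⇒m≤o K L (ℕ.m⊔n≤o⇒n≤o (M ℕ.⊔ N) (K ℕ.⊔ L) le) ,
        ℕ.m⊔n≤o⇒n≤o K L (ℕ.m⊔n≤o⇒n≤o (M ℕ.⊔ N) (K ℕ.⊔ L) le)
  in (M ℕ.⊔ N) ℕ.⊔ (K ℕ.⊔ L) , λ m n le₁ le₂ →
     let M≤m , _ , K≤m , L≤m = split m le₁
         _ , N≤n , K≤n , L≤n = split n le₂
     in *-close (x m) (x n) (y m) (y n) B>0 C>0 (bx m M≤m) (by n N≤n)
                (hy m n K≤m K≤n) (hx m n L≤m L≤n) Bδ Cγ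

infix  8 -_
infixl 7 _*_
infixl 6 _+_

_+_ _*_ : ℝ → ℝ → ℝ
mkℝ x cx + mkℝ y cy = mkℝ (λ n → x n ℚ.+ y n) (+-cauchy cx cy)
mkℝ x cx * mkℝ y cy = mkℝ (λ n → x n ℚ.* y n) (*-cauchy cx cy)

-_ : ℝ → ℝ
- mkℝ x cx = mkℝ (λ n → ℚ.- x n) (neg-cauchy cx)

ℝ-rawRing : RawRing 0ℓ 0ℓ
ℝ-rawRing = record
  { Carrier = ℝ ; _≈_ = _≈_ ; _+_ = _+_ ; _*_ = _*_ ; -_ = -_ ; 0# = 0ℝ ; 1# = 1ℝ }

isqrt : ℕ → ℕ
isqrt zero    = zero
isqrt (suc n) with suc (isqrt n) ℕ.* suc (isqrt n) ℕ.≤? suc n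
... | yes _ = suc (isqrt n)
... | no  _ = isqrt n

-- ⌊ (n+1) √q⁺ ⌋ / (n+1), where q⁺ = max q 0.
√-approx : ℚ → ℕ → ℚ
√-approx q n = (+ isqrt ℤ.∣ floor ((q ℚ.⊔ 0ℚ) ℚ.* (t ℚ.* t)) ∣) ℚ./ suc n
  where t = fromℤ (+ suc n)

isqrt-lower : ∀ n → isqrt n ℕ.* isqrt n ℕ.≤ n
isqrt-lower zero = ℕ.z≤n
isqrt-lower (suc n) with suc (isqrt n) ℕ.* suc (isqrt n) ℕ.≤? suc n
... | yes p = p
... | no  _ = ℕ.m≤n⇒m≤1+n (isqrt-lower n)

isqrt-upper : ∀ n → n ℕ.< suc (isqrt n) ℕ.* suc (isqrt n)
isqrt-upper zero = ℕ.s≤s ℕ.z≤n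
isqrt-upper (suc n) with suc (isqrt n) ℕ.* suc (isqrt n) ℕ.≤? suc n
... | yes _ = ℕ.≤-<-trans (isqrt-upper n)
        (ℕ.*-mono-< (ℕ.n<1+n (suc (isqrt n))) (ℕ.n<1+n (suc (isqrt n))))
... | no ¬p = ℕ.≰⇒> ¬p

ι : ℕ → ℚ
ι k = fromℤ (+ k)

ι-* : ∀ j k → ι (j ℕ.* k) ≡ ι j ℚ.* ι k
ι-* j k = trans (sym (ℚ.↥p/↧p≡p (ι (j ℕ.* k)))) (cong (ℚ._/ 1) (ℤ.pos-* j k))

ι-suc : ∀ k → ι (suc k) ≡ ι k ℚ.+ 1ℚ
ι-suc k = trans (sym (ℚ.↥p/↧p≡p (ι (suc k)))) (cong (ℚ._/ 1)
  (trans (cong +_ (ℕ.+-comm 1 k)) (cong (ℤ._+ + 1) (sym (ℤ.*-identityʳ (+ k))))))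

ι-mono : ∀ {j k} → j ℕ.≤ k → ι j ℚ.≤ ι k
ι-mono j≤k = *≤* (ℤ.*-monoʳ-≤-nonNeg (+ 1) (ℤ.+≤+ j≤k))

frac : ∀ k n → (+ k ℚ./ suc n) ℚ.* ι (suc n) ≡ ι k
frac k n = ℚ.toℚᵘ-injective (ℚᵘ.≃-trans (ℚ.toℚᵘ-homo-* (+ k ℚ./ suc n) (ι (suc n)))
  (ℚᵘ.≃-trans (ℚᵘ.*-congʳ {ℚ.toℚᵘ (ι (suc n))} (ℚ.toℚᵘ-fromℚᵘ (ℚᵘ.mkℚᵘ (+ k) n)))
    (ℚᵘ.*≡* (trans (ℤ.*-identityʳ _) (cong (λ l → + k ℤ.* + l) (sym (ℕ.*-identityʳ (suc n))))))))

floor-nat : ∀ a d .(c : Coprime a (suc d)) → ℤ.∣ floor (mkℚ (+ a) d c) ∣ ≡ a ℕ./ suc d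
floor-nat a d c = cong ℤ.∣_∣ (ℤ.div-pos-is-/ℕ (+ a) (suc d))

floor-lower : ∀ q → 0ℚ ℚ.≤ q → ι ℤ.∣ floor q ∣ ℚ.≤ q
floor-lower (mkℚ (+ a) d c) _ = subst (λ k → ι k ℚ.≤ mkℚ (+ a) d c) (sym (floor-nat a d c))
  (*≤* (subst₂ ℤ._≤_ (ℤ.pos-* (a ℕ./ suc d) (suc d)) (sym (ℤ.*-identityʳ (+ a)))
    (ℤ.+≤+ (ℕ.m/n*n≤m a (suc d)))))
floor-lower q@(mkℚ -[1+ _ ] _ _) 0≤q = contradiction 0≤q (<⇒≱ (ℚ.negative⁻¹ q))

floor-upper : ∀ q → 0ℚ ℚ.≤ q → q ℚ.< ι (suc ℤ.∣ floor q ∣)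
floor-upper (mkℚ (+ a) d c) _ = subst (λ k → mkℚ (+ a) d c ℚ.< ι (suc k)) (sym (floor-nat a d c))
  (*<* (subst₂ ℤ._<_ (sym (ℤ.*-identityʳ (+ a))) (ℤ.pos-* (suc (a ℕ./ suc d)) (suc d))
    (ℤ.+<+ (subst (ℕ._< suc (a ℕ./ suc d) ℕ.* suc d) (sym (ℕ.m≡m%n+[m/n]*n a (suc d)))
      (ℕ.+-monoˡ-< (a ℕ./ suc d ℕ.* suc d) (ℕ.m%n<n a (suc d)))))))
floor-upper q@(mkℚ -[1+ _ ] _ _) 0≤q = contradiction 0≤q (<⇒≱ (ℚ.negative⁻¹ q))

η : ℕ → ℚ
η n = + 1 ℚ./ suc n

frac-nonNeg : ∀ k n → 0ℚ ℚ.≤ + k ℚ./ suc n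
frac-nonNeg k n = ℚ.nonNegative⁻¹ (+ k ℚ./ suc n) {{ℚ.normalize-nonNeg k (suc n)}}

η-small : ∀ {ε} → 0ℚ ℚ.< ε → ∃[ N ] (∀ n → N ℕ.≤ n → η n ℚ.< ε)
η-small {mkℚ (+ 0) _ _} ε>0 with positive ε>0
... | ()
η-small {mkℚ -[1+ _ ] _ _} ε>0 with positive ε>0
... | ()
η-small {mkℚ +[1+ a ] d c} ε>0 = suc d , λ n d<n → ℚ.toℚᵘ-cancel-<
  (ℚᵘ.<-respˡ-≃ (ℚᵘ.≃-sym (ℚ.toℚᵘ-fromℚᵘ (ℚᵘ.mkℚᵘ (+ 1) n)))
    (ℚᵘ.*<* (subst₂ ℤ._<_ (ℤ.pos-* 1 (suc d)) (ℤ.pos-* (suc a) (suc n))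
      (ℤ.+<+ (ℕ.*-mono-≤ {1} {suc a} {suc (suc d)} {suc n} (ℕ.s≤s ℕ.z≤n) (ℕ.s≤s d<n)
        )))))

√-approx-nonNeg : ∀ q n → 0ℚ ℚ.≤ √-approx q n
√-approx-nonNeg q n = frac-nonNeg (isqrt ℤ.∣ floor ((q ℚ.⊔ 0ℚ) ℚ.* (t ℚ.* t)) ∣) n
  where t = ι (suc n)

grid-lower : ∀ Q n → 0ℚ ℚ.≤ Q → let t = ι (suc n) ; s = + isqrt ℤ.∣ floor (Q ℚ.* (t ℚ.* t)) ∣ ℚ./ suc n in
             s ℚ.* s ℚ.≤ Q
grid-lower Q n Q≥0 = ℚ.*-cancelʳ-≤-pos (t ℚ.* t) {{positive tt>0}} (begin
    s ℚ.* s ℚ.* (t ℚ.* t)     ≡⟨ solve 2 (λ s t → s :* s :* (t :* t) := (s :* t) :* (s :* t)) refl s t ⟩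
    (s ℚ.* t) ℚ.* (s ℚ.* t)   ≡⟨ cong₂ ℚ._*_ (frac k n) (frac k n) ⟩
    ι k ℚ.* ι k               ≡⟨ ι-* k k ⟨
    ι (k ℕ.* k)               ≤⟨ ι-mono (isqrt-lower ℤ.∣ floor (Q ℚ.* (t ℚ.* t)) ∣) ⟩
    ι ℤ.∣ floor (Q ℚ.* (t ℚ.* t)) ∣ ≤⟨ floor-lower (Q ℚ.* (t ℚ.* t)) (*-nonNeg Q≥0 (ℚ.<⇒≤ tt>0)) ⟩
    Q ℚ.* (t ℚ.* t)           ∎)
  where
  open ℚ.≤-Reasoning
  t = ι (suc n)
  k = isqrt ℤ.∣ floor (Q ℚ.* (t ℚ.* t)) ∣
  s = + k ℚ./ suc n
  tt>0 : 0ℚ ℚ.< t ℚ.* t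
  tt>0 = *-pos {t} {t} (ℚ.positive⁻¹ t) (ℚ.positive⁻¹ t)

grid-upper : ∀ Q n → 0ℚ ℚ.≤ Q → let t = ι (suc n) ; s = + isqrt ℤ.∣ floor (Q ℚ.* (t ℚ.* t)) ∣ ℚ./ suc n in
             Q ℚ.< (s ℚ.+ η n) ℚ.* (s ℚ.+ η n)
grid-upper Q n Q≥0 = ℚ.*-cancelʳ-<-nonNeg (t ℚ.* t) {{nonNegative tt≥0}} (begin-strict
    Q ℚ.* (t ℚ.* t)                                 <⟨ floor-upper (Q ℚ.* (t ℚ.* t)) (*-nonNeg Q≥0 tt≥0) ⟩
    ι (suc ℤ.∣ floor (Q ℚ.* (t ℚ.* t)) ∣)           ≤⟨ ι-mono (isqrt-upper ℤ.∣ floor (Q ℚ.* (t ℚ.* t)) ∣) ⟩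
    ι (suc k ℕ.* suc k)                             ≡⟨ ι-* (suc k) (suc k) ⟩
    ι (suc k) ℚ.* ι (suc k)                         ≡⟨ cong₂ ℚ._*_ next next ⟩
    ((s ℚ.+ e) ℚ.* t) ℚ.* ((s ℚ.+ e) ℚ.* t)
      ≡⟨ solve 2 (λ u t → (u :* t) :* (u :* t) := u :* u :* (t :* t)) refl (s ℚ.+ e) t ⟩
    (s ℚ.+ e) ℚ.* (s ℚ.+ e) ℚ.* (t ℚ.* t)           ∎)
  where
  open ℚ.≤-Reasoning
  t = ι (suc n)
  e = η n
  k = isqrt ℤ.∣ floor (Q ℚ.* (t ℚ.* t)) ∣
  s = + k ℚ./ suc n
  tt≥0 : 0ℚ ℚ.≤ t ℚ.* t
  tt≥0 = *-nonNeg {t} {t} (ℚ.nonNegative⁻¹ t) (ℚ.nonNegative⁻¹ t)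
  next : ι (suc k) ≡ (s ℚ.+ e) ℚ.* t
  next = trans (ι-suc k) (sym (trans (ℚ.*-distribʳ-+ t s e) (cong₂ ℚ._+_ (frac k n) (frac 1 n))))

√-approx-lower : ∀ q n → √-approx q n ℚ.* √-approx q n ℚ.≤ q ℚ.⊔ 0ℚ
√-approx-lower q n = grid-lower (q ℚ.⊔ 0ℚ) n (ℚ.p≤q⊔p q 0ℚ)

√-approx-upper : ∀ q n → q ℚ.⊔ 0ℚ ℚ.< (√-approx q n ℚ.+ η n) ℚ.* (√-approx q n ℚ.+ η n)
√-approx-upper q n = grid-upper (q ℚ.⊔ 0ℚ) n (ℚ.p≤q⊔p q 0ℚ)

√-approx-close : ∀ {a b h} m n → 0ℚ ℚ.< h → η n ℚ.< h → a ℚ.≤ b ℚ.+ h ℚ.* h →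
                 √-approx a m ℚ.< √-approx b n ℚ.+ (h ℚ.+ h)
√-approx-close {a} {b} {h} m n h>0 e<h a≤ = ℚ.≤-<-trans
    (square-cancel-≤ (ℚ.+-mono-≤ u≥0 (ℚ.<⇒≤ h>0)) (begin
      s ℚ.* s                   ≤⟨ √-approx-lower a m ⟩
      a ℚ.⊔ 0ℚ                  ≤⟨ ℚ.⊔-lub (ℚ.≤-trans a≤ (ℚ.+-monoˡ-≤ (h ℚ.* h) (ℚ.p≤p⊔q b 0ℚ)))
                                          (ℚ.+-mono-≤ (ℚ.p≤q⊔p b 0ℚ) (*-nonNeg (ℚ.<⇒≤ h>0) (ℚ.<⇒≤ h>0))) ⟩
      b ℚ.⊔ 0ℚ ℚ.+ h ℚ.* h      ≤⟨ ℚ.+-monoˡ-≤ (h ℚ.* h) (ℚ.<⇒≤ (√-approx-upper b n)) ⟩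
      u ℚ.* u ℚ.+ h ℚ.* h       ≡⟨ ℚ.+-identityʳ _ ⟨
      u ℚ.* u ℚ.+ h ℚ.* h ℚ.+ 0ℚ
        ≤⟨ ℚ.+-monoʳ-≤ (u ℚ.* u ℚ.+ h ℚ.* h) (ℚ.+-mono-≤ uh≥0 uh≥0) ⟩
      u ℚ.* u ℚ.+ h ℚ.* h ℚ.+ (u ℚ.* h ℚ.+ u ℚ.* h)
        ≡⟨ solve 2 (λ u h → u :* u :+ h :* h :+ (u :* h :+ u :* h) := (u :+ h) :* (u :+ h)) refl u h ⟩
      (u ℚ.+ h) ℚ.* (u ℚ.+ h)   ∎))
    (subst (u ℚ.+ h ℚ.<_) (ℚ.+-assoc (√-approx b n) h h)
      (ℚ.+-monoˡ-< h (ℚ.+-monoʳ-< (√-approx b n) e<h)))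
  where
  open ℚ.≤-Reasoning
  s = √-approx a m
  u = √-approx b n ℚ.+ η n
  u≥0 : 0ℚ ℚ.≤ u
  u≥0 = ℚ.+-mono-≤ (√-approx-nonNeg b n) (frac-nonNeg 1 n)
  uh≥0 : 0ℚ ℚ.≤ u ℚ.* h
  uh≥0 = *-nonNeg u≥0 (ℚ.<⇒≤ h>0)

√-cauchy : ∀ {x} → Cauchy x → Cauchy (λ n → √-approx (x n) n)
√-cauchy {x} cx .converge ε ε>0 =
  let h       = ε ℚ.* ½
      h>0     = half-pos ε>0
      M , hx  = converge cx (h ℚ.* h) (*-pos h>0 h>0)
      N , hη  = η-small h>0
      close   = λ m n (M≤m : M ℕ.≤ m) (M≤n : M ℕ.≤ n) (N≤n : N ℕ.≤ n) →
        subst (λ d → √-approx (x m) m ℚ.< √-approx (x n) n ℚ.+ d) (half+half ε)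
          (√-approx-close {x m} {x n} m n h>0 (hη n N≤n) (ℚ.<⇒≤ (∣-∣<-elim {x m} {x n} (hx m n M≤m M≤n))))
  in M ℕ.⊔ N , λ m n le₁ le₂ →
     let M≤m = ℕ.m⊔n≤o⇒m≤o M N le₁ ; N≤m = ℕ.m⊔n≤o⇒n≤o M N le₁
         M≤n = ℕ.m⊔n≤o⇒m≤o M N le₂ ; N≤n = ℕ.m⊔n≤o⇒n≤o M N le₂
     in ∣-∣<-intro (close m n M≤m M≤n N≤n) (close n m M≤n M≤m N≤m)

infix 9 √_

-- The nonnegative square root (√-nonNeg, √-square below); it is 0 on negative numbers.

√_ : ℝ → ℝ
√ mkℝ x cx = mkℝ (λ n → √-approx (x n) n) (√-cauchy cx)

√-nonNeg : ∀ x → 0ℝ ≤ √ x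
√-nonNeg x .below ε ε>0 = 0 , λ n _ → ℚ.+-mono-≤ (√-approx-nonNeg (seq x n) n) (ℚ.<⇒≤ ε>0)

√-approx-square : ∀ {a B δ ε} n → 0ℚ ℚ.< δ → 0ℚ ℚ.≤ a ℚ.+ δ → √-approx a n ℚ.≤ B → η n ℚ.< δ → δ ℚ.≤ 1ℚ →
                  (B ℚ.+ B ℚ.+ (1ℚ ℚ.+ 1ℚ)) ℚ.* δ ≡ ε →
                  ∣ √-approx a n ℚ.* √-approx a n ℚ.- a ∣ ℚ.< ε
√-approx-square {a} {B} {δ} {ε} n δ>0 a≥ s≤B e<δ δ≤1 eq = ∣-∣<-intro
    (begin-strict
      s ℚ.* s                  ≤⟨ √-approx-lower a n ⟩
      a ℚ.⊔ 0ℚ                 ≤⟨ ℚ.⊔-lub (subst (ℚ._≤ a ℚ.+ δ) (ℚ.+-identityʳ a) (ℚ.+-monoʳ-≤ a (ℚ.<⇒≤ δ>0))) a≥ ⟩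
      a ℚ.+ δ                  <⟨ ℚ.+-monoʳ-< a δ<ε ⟩
      a ℚ.+ ε                  ∎)
    (begin-strict
      a                        ≤⟨ ℚ.p≤p⊔q a 0ℚ ⟩
      a ℚ.⊔ 0ℚ                 <⟨ √-approx-upper a n ⟩
      (s ℚ.+ e) ℚ.* (s ℚ.+ e)
        ≡⟨ solve 2 (λ s e → (s :+ e) :* (s :+ e) := s :* s :+ (s :+ s :+ e) :* e) refl s e ⟩
      s ℚ.* s ℚ.+ (s ℚ.+ s ℚ.+ e) ℚ.* e
        ≤⟨ ℚ.+-monoʳ-≤ (s ℚ.* s) (*-mono-≤ w≥0 (frac-nonNeg 1 n) w≤ (ℚ.<⇒≤ e<δ)) ⟩
      s ℚ.* s ℚ.+ (B ℚ.+ B ℚ.+ (1ℚ ℚ.+ 1ℚ)) ℚ.* δ ≡⟨ cong (s ℚ.* s ℚ.+_) eq ⟩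
      s ℚ.* s ℚ.+ ε            ∎)
  where
  open ℚ.≤-Reasoning
  s = √-approx a n
  e = η n
  B≥0 = ℚ.≤-trans (√-approx-nonNeg a n) s≤B
  1≥0 = ℚ.nonNegative⁻¹ 1ℚ
  2≥0 = ℚ.nonNegative⁻¹ (1ℚ ℚ.+ 1ℚ)
  w≥0 : 0ℚ ℚ.≤ B ℚ.+ B ℚ.+ (1ℚ ℚ.+ 1ℚ)
  w≥0 = ℚ.+-mono-≤ (ℚ.+-mono-≤ B≥0 B≥0) 2≥0
  w≤ : s ℚ.+ s ℚ.+ e ℚ.≤ B ℚ.+ B ℚ.+ (1ℚ ℚ.+ 1ℚ)
  w≤ = ℚ.+-mono-≤ (ℚ.+-mono-≤ s≤B s≤B)
         (ℚ.≤-trans (ℚ.<⇒≤ e<δ) (ℚ.≤-trans δ≤1 (ℚ.+-mono-≤ 1≥0 (ℚ.≤-refl {1ℚ}))))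
  δ<ε : δ ℚ.< ε
  δ<ε = subst (δ ℚ.<_) eq (subst (ℚ._< (B ℚ.+ B ℚ.+ (1ℚ ℚ.+ 1ℚ)) ℚ.* δ) (ℚ.*-identityˡ δ)
          (ℚ.*-monoˡ-<-pos δ {{positive δ>0}}
            (ℚ.+-mono-≤-< (ℚ.+-mono-≤ B≥0 B≥0) (ℚ.+-mono-≤-< (ℚ.≤-refl {1ℚ}) (ℚ.positive⁻¹ 1ℚ)))))

√-square : ∀ {x} → 0ℝ ≤ x → √ x * √ x ≈ x
√-square {x} x≥0 .close ε ε>0 =
  let r               = √ x
      B , B>0 , K , b = bounded (cauchy r)
      W>0             = ℚ.+-mono-< (ℚ.+-mono-< B>0 B>0) (ℚ.positive⁻¹ (1ℚ ℚ.+ 1ℚ))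
      W               = B ℚ.+ B ℚ.+ (1ℚ ℚ.+ 1ℚ)
      ε′>0            = ⊓-pos {ε} {W} ε>0 W>0
      δ , δ>0 , Wδ    = shrink {W} {ε ℚ.⊓ W} W>0 ε′>0
      δ≤1             = ℚ.*-cancelˡ-≤-pos W {{positive W>0}}
                          (subst₂ ℚ._≤_ (sym Wδ) (sym (ℚ.*-identityʳ W)) (ℚ.p⊓q≤q ε W))
      M , hx          = below x≥0 δ δ>0
      N , hη          = η-small δ>0
  in K ℕ.⊔ (M ℕ.⊔ N) , λ n le →
     let K≤n = ℕ.m⊔n≤o⇒m≤o K (M ℕ.⊔ N) le
         M≤n = ℕ.m⊔n≤o⇒m≤o M N (ℕ.m⊔n≤o⇒n≤o K (M ℕ.⊔ N) le)
         N≤n = ℕ.m⊔n≤o⇒n≤o M N (ℕ.m⊔n≤o⇒n≤o K (M ℕ.⊔ N) le)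
     in ℚ.<-≤-trans
          (√-approx-square {seq x n} n δ>0 (hx n M≤n)
            (ℚ.≤-trans (p≤∣p∣ (seq r n)) (b n K≤n)) (hη n N≤n) δ≤1 Wδ)
          (ℚ.p⊓q≤p ε W)

record ℂ : Set where
  constructor _+i_
  field
    re im : ℝ

open ℂ public

infix 4 _≈ᶜ_

record _≈ᶜ_ (z w : ℂ) : Set where
  constructor _,ᶜ_
  field
    re≈ : re z ≈ re w
    im≈ : im z ≈ im w

open _≈ᶜ_ public

infix  8 -ᶜ_
infixl 7 _*ᶜ_
infixl 6 _+ᶜ_

_+ᶜ_ _*ᶜ_ : ℂ → ℂ → ℂ
z +ᶜ w = (re z + re w) +i (im z + im w)
z *ᶜ w = (re z * re w + - (im z * im w)) +i (re z * im w + im z * re w)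

-ᶜ_ : ℂ → ℂ
-ᶜ z = (- re z) +i (- im z)

0ᶜ 1ᶜ : ℂ
0ᶜ = 0ℝ +i 0ℝ
1ᶜ = 1ℝ +i 0ℝ

∣_∣ᶜ : ℂ → ℝ
∣ z ∣ᶜ = √ (re z * re z + im z * im z)

ℂ-rawRing : RawRing 0ℓ 0ℓ
ℂ-rawRing = record
  { Carrier = ℂ ; _≈_ = _≈ᶜ_ ; _+_ = _+ᶜ_ ; _*_ = _*ᶜ_ ; -_ = -ᶜ_ ; 0# = 0ᶜ ; 1# = 1ᶜ }

open RawSemiringDefs (RawRing.rawSemiring ℝ-rawRing) public
  using () renaming (sum to sumℝ)
open RawSemiringDefs (RawRing.rawSemiring ℂ-rawRing) public
  using () renaming (sum to sumᶜ; _^_ to _^ᶜ_)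

Matrix : ℕ → Set
Matrix m = Fin m → Fin m → ℂ

1ᴹ : ∀ {m} → Matrix m
1ᴹ i j = if does (i Fin.≟ j) then 1ᶜ else 0ᶜ

infixl 7 _*ᴹ_

_*ᴹ_ : ∀ {m} → Matrix m → Matrix m → Matrix m
(A *ᴹ B) i k = sumᶜ λ j → A i j *ᶜ B j k

infix 4 _≈ᴹ_

_≈ᴹ_ : ∀ {m} → Matrix m → Matrix m → Set
A ≈ᴹ B = ∀ i j → A i j ≈ᶜ B i j

record Invertible {m} (A : Matrix m) : Set where
  field
    inverse  : Matrix m
    inverseˡ : inverse *ᴹ A ≈ᴹ 1ᴹ
    inverseʳ : A *ᴹ inverse ≈ᴹ 1ᴹ

open Invertible public

‖_‖ : ∀ {m} → Matrix m → ℝ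
‖ A ‖ = √ sumℝ λ i → sumℝ λ j → ∣ A i j ∣ᶜ * ∣ A i j ∣ᶜ

-- A two-sided inverse is unique up to ≈ᴹ, so the value depends only on A (up to ≈).
Cond : ∀ {m} (A : Matrix m) → Invertible A → ℝ
Cond A A⁻¹ = ‖ A ‖ * ‖ inverse A⁻¹ ‖

φ : ℕ → ℕ
φ n = length (filter (λ k → coprime? k n) (map suc (upTo n)))

record PrimitiveRoot (n : ℕ) (z : ℂ) : Set where
  field
    isRoot    : z ^ᶜ n ≈ᶜ 1ᶜ
    minimal   : ∀ k → 0 ℕ.< k → k ℕ.< n → ¬ z ^ᶜ k ≈ᶜ 1ᶜ

record EnumeratesPrimitiveRoots (n : ℕ) (ζ : Fin (φ n) → ℂ) : Set where
  field
    isPrimitive : ∀ i → PrimitiveRoot n (ζ i)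
    injective   : Injective _≡_ _≈ᶜ_ ζ
    complete    : ∀ z → PrimitiveRoot n z → ∃[ i ] ζ i ≈ᶜ z

-- With columns indexed from 0, the (i,j) entry is ζᵢ ^ j.
vandermonde : ∀ {m} → (Fin m → ℂ) → Matrix m
vandermonde ζ i j = ζ i ^ᶜ toℕ j

-- Column j of V⁻¹ holds the coefficients of the Lagrange polynomial Φ(x) / ((x - ζⱼ) Φ′(ζⱼ)) with Φ = Φ_pqr.
-- Differentiating Φ Ψ = 1 - xⁿ at ζⱼ gives 1 / Φ′(ζⱼ) = - ζⱼ Ψ(ζⱼ) / n, so its entries are at most
-- ‖Φ‖₁ ‖Ψ‖₁ / n in absolute value. Bézout relations between p, q and r express Φ and Ψ as short
-- combinations of products of geometric sums, whence ‖Φ‖₁ ≤ 2n(p + q), ‖Ψ‖₁ ≤ 4p²q, and the entries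
-- are at most 8p²q(p + q) ≤ 2m². Since |ζⱼ| = 1, ‖V‖ = m, and ‖V⁻¹‖ ≤ m · 2m².

module Submission where

open import Algebra.Bundles using (CommutativeRing)

-- Complex numbers are pairs of Cauchy sequences here, so equality is undecidable and knowing that a
-- number is not zero does not hand over its inverse. What is available is cancellation (if
-- `x * y ≈ 0` and not `x ≈ 0`, then `y ≈ 0`) and division by positive integers. So 1 / Φ′(ζⱼ) is
-- not obtained by dividing: the formula - ζⱼ Ψ(ζⱼ) / n exhibits it, which yields invertibility and
-- the bound together. The facts about Φ come from identities between expressions that hold in every
-- commutative ring, and the choice of ring decides what they say: at a root of unity they give Φ(ζ)
-- = 0, over the dual numbers the derivative, over power series the degree. The degree takes this
-- detour because the Bézout expression for Φ may formally exceed degree `m`, while an m by m matrix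
-- has room only for the coefficients below x^m of each quotient Φ / (x - ζⱼ). Oddness enters in
-- 4p²q(p + q) ≤ m²: distinct odd primes differ by at least 2, which is what makes m large enough
-- against p²q(p + q).

-- A ring solver with integer coefficients over any commutative ring.

module IntegerSolver {c ℓ} (R : CommutativeRing c ℓ) where
  open CommutativeRing R
  open import Algebra.Properties.Ring ring
    using (-‿+-comm; -0#≈0#; -‿involutive; -‿distribˡ-*)
  open import Algebra.Properties.Semiring.Mult.TCOptimised semiring using (_×_; 1+×; ×-homo-+)
  open import Algebra.Solver.Ring.AlmostCommutativeRing
    using (fromCommutativeRing; _-Raw-AlmostCommutative⟶_)
  open import Data.Integer.Base as ℤ using (ℤ; +_; -[1+_])
  import Data.Integer.Properties as ℤ
  open import Data.Maybe.Base using (Maybe; just; nothing)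
  open import Data.Nat.Base as ℕ using (zero; suc)
  open import Relation.Binary.Reasoning.Setoid setoid
  open import Relation.Binary.PropositionalEquality using (_≡_; cong) renaming (sym to ≡-sym; refl to ≡-refl)
  open import Relation.Nullary using (yes; no)

  -- With the optimised multiple, `1 × 1#` reduces to `1#`; the solver constants `:0` and `:1`
  -- therefore stand for `0#` and `1#` definitionally, and `refl` closes the solved goals.
  ⟦_⟧ℤ : ℤ → Carrier
  ⟦ + n ⟧ℤ      = n × 1#
  ⟦ -[1+ n ] ⟧ℤ = - (suc n × 1#)

  ≡⇒≈ : ∀ {i j} → i ≡ j → ⟦ i ⟧ℤ ≈ ⟦ j ⟧ℤ
  ≡⇒≈ ≡-refl = refl

  neg-homo : ∀ i → ⟦ ℤ.- i ⟧ℤ ≈ - ⟦ i ⟧ℤ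
  neg-homo (+ zero)   = sym -0#≈0#
  neg-homo (+ suc n)  = refl
  neg-homo -[1+ n ]   = sym (-‿involutive _)

  cancel-1 : ∀ x y → (1# + x) + - (1# + y) ≈ x + - y
  cancel-1 x y = begin
    (1# + x) + - (1# + y)      ≈⟨ +-cong (+-comm 1# x) (sym (-‿+-comm 1# y)) ⟩
    (x + 1#) + (- 1# + - y)    ≈⟨ +-assoc x 1# _ ⟩
    x + (1# + (- 1# + - y))    ≈⟨ +-congˡ (+-assoc 1# (- 1#) (- y)) ⟨
    x + ((1# + - 1#) + - y)    ≈⟨ +-congˡ (trans (+-congʳ (-‿inverseʳ 1#)) (+-identityˡ (- y))) ⟩
    x + - y                    ∎

  ⊖-homo : ∀ m n → ⟦ m ℤ.⊖ n ⟧ℤ ≈ m × 1# + - (n × 1#)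
  ⊖-homo m zero = sym (trans (+-congˡ -0#≈0#) (+-identityʳ _))
  ⊖-homo zero (suc n) = sym (+-identityˡ _)
  ⊖-homo (suc m) (suc n) = begin
    ⟦ suc m ℤ.⊖ suc n ⟧ℤ                  ≈⟨ ≡⇒≈ (ℤ.[1+m]⊖[1+n]≡m⊖n m n) ⟩
    ⟦ m ℤ.⊖ n ⟧ℤ                          ≈⟨ ⊖-homo m n ⟩
    m × 1# + - (n × 1#)                   ≈⟨ cancel-1 _ _ ⟨
    (1# + m × 1#) + - (1# + n × 1#)       ≈⟨ +-cong (1+× m 1#) (-‿cong (1+× n 1#)) ⟨
    suc m × 1# + - (suc n × 1#)           ∎

  +-homo : ∀ i j → ⟦ i ℤ.+ j ⟧ℤ ≈ ⟦ i ⟧ℤ + ⟦ j ⟧ℤ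
  +-homo (+ m)    (+ n)    = ×-homo-+ 1# m n
  +-homo (+ m)    -[1+ n ] = ⊖-homo m (suc n)
  +-homo -[1+ m ] (+ n)    = trans (⊖-homo n (suc m)) (+-comm _ _)
  +-homo -[1+ m ] -[1+ n ] = begin
    - (suc (suc (m ℕ.+ n)) × 1#)            ≈⟨ -‿cong (reflexive′ (cong suc (≡-sym (ℕ.+-suc m n)))) ⟩
    - ((suc m ℕ.+ suc n) × 1#)              ≈⟨ -‿cong (×-homo-+ 1# (suc m) (suc n)) ⟩
    - (suc m × 1# + suc n × 1#)             ≈⟨ -‿+-comm _ _ ⟨
    - (suc m × 1#) + - (suc n × 1#)         ∎
    where
    import Data.Nat.Properties as ℕ
    reflexive′ : ∀ {j k} → j ≡ k → j × 1# ≈ k × 1#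
    reflexive′ ≡-refl = refl

  pos-*-homo : ∀ m j → ⟦ + m ℤ.* j ⟧ℤ ≈ m × 1# * ⟦ j ⟧ℤ
  pos-*-homo zero    j = trans (≡⇒≈ (ℤ.*-zeroˡ j)) (sym (zeroˡ _))
  pos-*-homo (suc m) j = begin
    ⟦ + suc m ℤ.* j ⟧ℤ                  ≈⟨ ≡⇒≈ (ℤ.suc-* (+ m) j) ⟩
    ⟦ j ℤ.+ + m ℤ.* j ⟧ℤ                ≈⟨ +-homo j (+ m ℤ.* j) ⟩
    ⟦ j ⟧ℤ + ⟦ + m ℤ.* j ⟧ℤ             ≈⟨ +-cong (sym (*-identityˡ _)) (pos-*-homo m j) ⟩
    1# * ⟦ j ⟧ℤ + m × 1# * ⟦ j ⟧ℤ       ≈⟨ distribʳ _ _ _ ⟨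
    (1# + m × 1#) * ⟦ j ⟧ℤ              ≈⟨ *-congʳ (1+× m 1#) ⟨
    suc m × 1# * ⟦ j ⟧ℤ                 ∎

  *-homo : ∀ i j → ⟦ i ℤ.* j ⟧ℤ ≈ ⟦ i ⟧ℤ * ⟦ j ⟧ℤ
  *-homo (+ m)    j = pos-*-homo m j
  *-homo -[1+ m ] j = begin
    ⟦ -[1+ m ] ℤ.* j ⟧ℤ           ≈⟨ ≡⇒≈ (≡-sym (ℤ.neg-distribˡ-* (+ suc m) j)) ⟩
    ⟦ ℤ.- (+ suc m ℤ.* j) ⟧ℤ      ≈⟨ neg-homo (+ suc m ℤ.* j) ⟩
    - ⟦ + suc m ℤ.* j ⟧ℤ          ≈⟨ -‿cong (pos-*-homo (suc m) j) ⟩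
    - (suc m × 1# * ⟦ j ⟧ℤ)       ≈⟨ -‿distribˡ-* _ _ ⟩
    - (suc m × 1#) * ⟦ j ⟧ℤ       ∎

  ℤ⟶R : ℤ.+-*-rawRing -Raw-AlmostCommutative⟶ fromCommutativeRing R
  ℤ⟶R = record
    { ⟦_⟧ = ⟦_⟧ℤ ; +-homo = +-homo ; *-homo = *-homo ; -‿homo = neg-homo
    ; 0-homo = refl ; 1-homo = refl }

  coeff≟ : ∀ i j → Maybe (⟦ i ⟧ℤ ≈ ⟦ j ⟧ℤ)
  coeff≟ i j with i ℤ.≟ j
  ... | yes i≡j = just (≡⇒≈ i≡j)
  ... | no  _   = nothing

  open import Algebra.Solver.Ring ℤ.+-*-rawRing (fromCommutativeRing R) ℤ⟶R coeff≟ public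
    using (Polynomial; solve; _:+_; _:*_; _:-_; :-_; con; _:=_)

  :0 :1 : ∀ {n} → Polynomial n
  :0 = con (+ 0)
  :1 = con (+ 1)

-- Cyclotomic polynomials as explicit expressions.

module CyclotomicPolynomials where
  open import Data.Nat.Base as ℕ using (ℕ; zero; suc)
  import Data.Nat.Properties as ℕ
  open import Relation.Binary.PropositionalEquality as ≡ using (_≡_)

  infixl 6 _⊕_
  infixl 7 _⊗_
  infix  8 ⊖_
  infixr 9 _↑_

  -- Polynomials are kept as syntax because one expression is read in many ways: its value in an
  -- arbitrary commutative ring, its list of coefficients, and a bound on their size.
  data Poly : Set where
    𝟘 𝟙 𝕏   : Poly
    _⊕_ _⊗_ : Poly → Poly → Poly
    ⊖_      : Poly → Poly

  _↑_ : Poly → ℕ → Poly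
  e ↑ zero  = 𝟙
  e ↑ suc k = e ⊗ e ↑ k

  geom : ℕ → Poly → Poly
  geom zero    e = 𝟘
  geom (suc k) e = 𝟙 ⊕ e ⊗ geom k e

  -- An upper bound for the sum of the absolute values of the coefficients; cancellation between
  -- terms is ignored.
  norm : Poly → ℕ
  norm 𝟘       = 0
  norm 𝟙       = 1
  norm 𝕏       = 1
  norm (e ⊕ f) = norm e ℕ.+ norm f
  norm (e ⊗ f) = norm e ℕ.* norm f
  norm (⊖ e)   = norm e

  -- The bounds on `a` and `b` limit the number of terms in the geometric sums built from them,
  -- hence the norms. With the positive coefficient on `p`, the relation stays within the natural
  -- numbers.
  record Bézout (p q : ℕ) : Set where
    field
      a b   : ℕ
      a*p≡  : a ℕ.* p ≡ suc (b ℕ.* q)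
      a≤q   : a ℕ.≤ q
      b≤p   : b ℕ.≤ p

  -- With y for the variable, Φ_pq(y) = [pq]_y / ([p]_y [q]_y) for [k]_y = 1 + y + ⋯ + y^(k-1);
  -- the Bézout relation [a]_{y^p} [p]_y - y [b]_{y^q} [q]_y = 1 makes the quotient explicit.
  Φ₂ : ∀ {p q} → Bézout p q → Poly → Poly
  Φ₂ {p} {q} z e = geom a (e ↑ p) ⊗ geom p (e ↑ q) ⊕ ⊖ (e ⊗ (geom b (e ↑ q) ⊗ geom q (e ↑ p)))
    where open Bézout z

  module Cyclotomic {p q r : ℕ} (pq : Bézout p q) (pr : Bézout p r) (qr : Bézout q r) where
    open Bézout pq

    -- Φ_pq(x^r) / Φ_pq(x), where the two factors [p]_{x^rq} and [q]_{x^rp} of the two terms of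
    -- Φ_pq(x^r) are divided separately by those of [p]_{x^q} = Φ_pq(x) [p]_x and [q]_{x^p} = Φ_pq(x) [q]_x.
    Φ₃ : Poly
    Φ₃ = geom a ((𝕏 ↑ r) ↑ p) ⊗ (Φ₂ pr (𝕏 ↑ q) ⊗ geom p 𝕏)
       ⊕ ⊖ (𝕏 ↑ r ⊗ (geom b ((𝕏 ↑ r) ↑ q) ⊗ (Φ₂ qr (𝕏 ↑ p) ⊗ geom q 𝕏)))

    -- With y = x^r, the factorization 1 - y^(pq) = Φ_pq(y) (1 - y^q) [p]_y, divided by Φ_pqr(x) =
    -- Φ_pq(y) / Φ_pq(x), leaves this cofactor.
    Ψ₃ : Poly
    Ψ₃ = Φ₂ pq 𝕏 ⊗ ((𝟙 ⊕ ⊖ (𝕏 ↑ r) ↑ q) ⊗ geom p (𝕏 ↑ r))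

  -- Identities for the expressions in an arbitrary commutative ring.

  module Evaluation {c ℓ} (R : CommutativeRing c ℓ) (x : CommutativeRing.Carrier R) where
    open CommutativeRing R
    open IntegerSolver R
    open import Algebra.Properties.Semiring.Exp semiring using (_^_; ^-assocʳ)
    open import Relation.Binary.Reasoning.Setoid setoid

    ⟦_⟧ : Poly → Carrier
    ⟦ 𝟘 ⟧     = 0#
    ⟦ 𝟙 ⟧     = 1#
    ⟦ 𝕏 ⟧     = x
    ⟦ e ⊕ f ⟧ = ⟦ e ⟧ + ⟦ f ⟧
    ⟦ e ⊗ f ⟧ = ⟦ e ⟧ * ⟦ f ⟧
    ⟦ ⊖ e ⟧   = - ⟦ e ⟧

    infix 9 1-x^_
    1-x^_ : ℕ → Carrier
    1-x^ k = 1# + - ⟦ 𝕏 ↑ k ⟧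

    ⟦↑⟧ : ∀ e k → ⟦ e ↑ k ⟧ ≡ ⟦ e ⟧ ^ k
    ⟦↑⟧ e zero    = ≡.refl
    ⟦↑⟧ e (suc k) = ≡.cong (⟦ e ⟧ *_) (⟦↑⟧ e k)

    ↑-* : ∀ e j k → ⟦ (e ↑ j) ↑ k ⟧ ≈ ⟦ e ↑ (j ℕ.* k) ⟧
    ↑-* e j k = begin
      ⟦ (e ↑ j) ↑ k ⟧     ≡⟨ ⟦↑⟧ (e ↑ j) k ⟩
      ⟦ e ↑ j ⟧ ^ k       ≡⟨ ≡.cong (_^ k) (⟦↑⟧ e j) ⟩
      (⟦ e ⟧ ^ j) ^ k     ≈⟨ ^-assocʳ ⟦ e ⟧ j k ⟩
      ⟦ e ⟧ ^ (j ℕ.* k)   ≡⟨ ⟦↑⟧ e (j ℕ.* k) ⟨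
      ⟦ e ↑ (j ℕ.* k) ⟧   ∎

    ↑-comm : ∀ e j k → ⟦ (e ↑ j) ↑ k ⟧ ≈ ⟦ (e ↑ k) ↑ j ⟧
    ↑-comm e j k = begin
      ⟦ (e ↑ j) ↑ k ⟧     ≈⟨ ↑-* e j k ⟩
      ⟦ e ↑ (j ℕ.* k) ⟧   ≡⟨ ≡.cong (λ i → ⟦ e ↑ i ⟧) (ℕ.*-comm j k) ⟩
      ⟦ e ↑ (k ℕ.* j) ⟧   ≈⟨ ↑-* e k j ⟨
      ⟦ (e ↑ k) ↑ j ⟧     ∎

    geom-cong : ∀ k {e f} → ⟦ e ⟧ ≈ ⟦ f ⟧ → ⟦ geom k e ⟧ ≈ ⟦ geom k f ⟧
    geom-cong zero    e≈f = refl
    geom-cong (suc k) e≈f = +-congˡ (*-cong e≈f (geom-cong k e≈f))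

    geom-+ : ∀ j k e → ⟦ geom (j ℕ.+ k) e ⟧ ≈ ⟦ geom j e ⟧ + ⟦ e ↑ j ⟧ * ⟦ geom k e ⟧
    geom-+ zero    k e = solve 1 (λ g → g := :0 :+ :1 :* g) refl _
    geom-+ (suc j) k e = trans (+-congˡ (*-congˡ (geom-+ j k e)))
      (solve 4 (λ e g u h → :1 :+ e :* (g :+ u :* h) := (:1 :+ e :* g) :+ e :* u :* h) refl _ _ _ _)

    geom-* : ∀ j k e → ⟦ geom (j ℕ.* k) e ⟧ ≈ ⟦ geom j (e ↑ k) ⟧ * ⟦ geom k e ⟧
    geom-* zero    k e = sym (zeroˡ _)
    geom-* (suc j) k e = begin
      ⟦ geom (k ℕ.+ j ℕ.* k) e ⟧                                      ≈⟨ geom-+ k (j ℕ.* k) e ⟩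
      ⟦ geom k e ⟧ + ⟦ e ↑ k ⟧ * ⟦ geom (j ℕ.* k) e ⟧                 ≈⟨ +-congˡ (*-congˡ (geom-* j k e)) ⟩
      ⟦ geom k e ⟧ + ⟦ e ↑ k ⟧ * (⟦ geom j (e ↑ k) ⟧ * ⟦ geom k e ⟧)
        ≈⟨ solve 3 (λ g u h → g :+ u :* (h :* g) := (:1 :+ u :* h) :* g) refl _ _ _ ⟩
      ⟦ geom (suc j) (e ↑ k) ⟧ * ⟦ geom k e ⟧                         ∎

    -- Both sides factor [jk]_e. This exchange produces the common factor of the two terms of `Φ₂`.
    geom-swap : ∀ j k e → ⟦ geom k (e ↑ j) ⟧ * ⟦ geom j e ⟧ ≈ ⟦ geom j (e ↑ k) ⟧ * ⟦ geom k e ⟧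
    geom-swap j k e = begin
      ⟦ geom k (e ↑ j) ⟧ * ⟦ geom j e ⟧   ≈⟨ geom-* k j e ⟨
      ⟦ geom (k ℕ.* j) e ⟧                ≡⟨ ≡.cong (λ i → ⟦ geom i e ⟧) (ℕ.*-comm k j) ⟩
      ⟦ geom (j ℕ.* k) e ⟧                ≈⟨ geom-* j k e ⟩
      ⟦ geom j (e ↑ k) ⟧ * ⟦ geom k e ⟧   ∎

    telescope : ∀ k e → (1# + - ⟦ e ⟧) * ⟦ geom k e ⟧ ≈ 1# + - ⟦ e ↑ k ⟧
    telescope zero    e = solve 1 (λ e → (:1 :- e) :* :0 := :1 :- :1) refl _
    telescope (suc k) e = begin
      (1# + - ⟦ e ⟧) * (1# + ⟦ e ⟧ * ⟦ geom k e ⟧)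
        ≈⟨ solve 2 (λ e g → (:1 :- e) :* (:1 :+ e :* g) := (:1 :- e) :+ e :* ((:1 :- e) :* g)) refl _ _ ⟩
      (1# + - ⟦ e ⟧) + ⟦ e ⟧ * ((1# + - ⟦ e ⟧) * ⟦ geom k e ⟧)   ≈⟨ +-congˡ (*-congˡ (telescope k e)) ⟩
      (1# + - ⟦ e ⟧) + ⟦ e ⟧ * (1# + - ⟦ e ↑ k ⟧)
        ≈⟨ solve 2 (λ e u → (:1 :- e) :+ e :* (:1 :- u) := :1 :- e :* u) refl _ _ ⟩
      1# + - (⟦ e ⟧ * ⟦ e ↑ k ⟧)                                 ∎

    module _ {p q} (z : Bézout p q) (e : Poly) where
      open Bézout z

      -- By `geom-*` the two terms are [ap]_e and e [bq]_e. Since ap = 1 + bq, the first is 1 + e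
      -- [bq]_e.
      bézout : ⟦ geom a (e ↑ p) ⟧ * ⟦ geom p e ⟧ + - (⟦ e ⟧ * (⟦ geom b (e ↑ q) ⟧ * ⟦ geom q e ⟧)) ≈ 1#
      bézout = begin
        ⟦ geom a (e ↑ p) ⟧ * ⟦ geom p e ⟧ + - (⟦ e ⟧ * (⟦ geom b (e ↑ q) ⟧ * ⟦ geom q e ⟧))
          ≈⟨ +-cong (sym (geom-* a p e)) (-‿cong (*-congˡ (sym (geom-* b q e)))) ⟩
        ⟦ geom (a ℕ.* p) e ⟧ + - (⟦ e ⟧ * ⟦ geom (b ℕ.* q) e ⟧)
          ≡⟨ ≡.cong (λ i → ⟦ geom i e ⟧ + - (⟦ e ⟧ * ⟦ geom (b ℕ.* q) e ⟧)) a*p≡ ⟩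
        1# + ⟦ e ⟧ * ⟦ geom (b ℕ.* q) e ⟧ + - (⟦ e ⟧ * ⟦ geom (b ℕ.* q) e ⟧)
          ≈⟨ solve 1 (λ h → :1 :+ h :- h := :1) refl _ ⟩
        1# ∎

      -- By `geom-swap`, [q]_{e^p} [p]_e = [p]_{e^q} [q]_e, so [p]_{e^q} comes out of both terms,
      -- and the Bézout combination left in the bracket is 1.
      Φ₂-p : ⟦ Φ₂ z e ⟧ * ⟦ geom p e ⟧ ≈ ⟦ geom p (e ↑ q) ⟧
      Φ₂-p = begin
        (A * G + - (y * (B * H))) * u
          ≈⟨ solve 6 (λ A G y B H u → (A :* G :- y :* (B :* H)) :* u := G :* (A :* u) :- y :* (B :* (H :* u)))
               refl A G y B H u ⟩
        G * (A * u) + - (y * (B * (H * u)))   ≈⟨ +-congˡ (-‿cong (*-congˡ (*-congˡ (geom-swap p q e)))) ⟩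
        G * (A * u) + - (y * (B * (G * v)))
          ≈⟨ solve 6 (λ A G y B u v → G :* (A :* u) :- y :* (B :* (G :* v)) := G :* (A :* u :- y :* (B :* v)))
               refl A G y B u v ⟩
        G * (A * u + - (y * (B * v)))         ≈⟨ trans (*-congˡ bézout) (*-identityʳ G) ⟩
        G                                     ∎
        where
        y = ⟦ e ⟧
        A = ⟦ geom a (e ↑ p) ⟧ ; G = ⟦ geom p (e ↑ q) ⟧ ; B = ⟦ geom b (e ↑ q) ⟧ ; H = ⟦ geom q (e ↑ p) ⟧
        u = ⟦ geom p e ⟧ ; v = ⟦ geom q e ⟧

      Φ₂-q : ⟦ Φ₂ z e ⟧ * ⟦ geom q e ⟧ ≈ ⟦ geom q (e ↑ p) ⟧
      Φ₂-q = begin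
        (A * G + - (y * (B * H))) * v
          ≈⟨ solve 6 (λ A G y B H v → (A :* G :- y :* (B :* H)) :* v := A :* (G :* v) :- y :* (B :* (H :* v)))
               refl A G y B H v ⟩
        A * (G * v) + - (y * (B * (H * v)))   ≈⟨ +-congʳ (*-congˡ (geom-swap p q e)) ⟨
        A * (H * u) + - (y * (B * (H * v)))
          ≈⟨ solve 6 (λ A H y B u v → A :* (H :* u) :- y :* (B :* (H :* v)) := H :* (A :* u :- y :* (B :* v)))
               refl A H y B u v ⟩
        H * (A * u + - (y * (B * v)))         ≈⟨ trans (*-congˡ bézout) (*-identityʳ H) ⟩
        H                                     ∎
        where
        y = ⟦ e ⟧
        A = ⟦ geom a (e ↑ p) ⟧ ; G = ⟦ geom p (e ↑ q) ⟧ ; B = ⟦ geom b (e ↑ q) ⟧ ; H = ⟦ geom q (e ↑ p) ⟧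
        u = ⟦ geom p e ⟧ ; v = ⟦ geom q e ⟧

    module _ {p q r} (pq : Bézout p q) (pr : Bézout p r) (qr : Bézout q r) where
      open Bézout pq
      open Cyclotomic pq pr qr

      Φ₃*Φ₂ : ⟦ Φ₃ ⟧ * ⟦ Φ₂ pq 𝕏 ⟧ ≈ ⟦ Φ₂ pq (𝕏 ↑ r) ⟧
      Φ₃*Φ₂ = begin
        (A * (D * u) + - (y * (B * (E * v)))) * Φ
          ≈⟨ solve 8 (λ A D u y B E v Φ → (A :* (D :* u) :- y :* (B :* (E :* v))) :* Φ
                                       := A :* (D :* (Φ :* u)) :- y :* (B :* (E :* (Φ :* v))))
               refl A D u y B E v Φ ⟩
        A * (D * (Φ * u)) + - (y * (B * (E * (Φ * v))))
          ≈⟨ +-cong (*-congˡ left) (-‿cong (*-congˡ (*-congˡ right))) ⟩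
        ⟦ Φ₂ pq (𝕏 ↑ r) ⟧ ∎
        where
        y = ⟦ 𝕏 ↑ r ⟧ ; Φ = ⟦ Φ₂ pq 𝕏 ⟧
        A = ⟦ geom a ((𝕏 ↑ r) ↑ p) ⟧ ; B = ⟦ geom b ((𝕏 ↑ r) ↑ q) ⟧
        D = ⟦ Φ₂ pr (𝕏 ↑ q) ⟧ ; E = ⟦ Φ₂ qr (𝕏 ↑ p) ⟧
        u = ⟦ geom p 𝕏 ⟧ ; v = ⟦ geom q 𝕏 ⟧
        left : D * (Φ * u) ≈ ⟦ geom p ((𝕏 ↑ r) ↑ q) ⟧
        left = begin
          D * (Φ * u)                   ≈⟨ *-congˡ (Φ₂-p pq 𝕏) ⟩
          D * ⟦ geom p (𝕏 ↑ q) ⟧        ≈⟨ Φ₂-p pr (𝕏 ↑ q) ⟩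
          ⟦ geom p ((𝕏 ↑ q) ↑ r) ⟧      ≈⟨ geom-cong p (↑-comm 𝕏 q r) ⟩
          ⟦ geom p ((𝕏 ↑ r) ↑ q) ⟧      ∎
        right : E * (Φ * v) ≈ ⟦ geom q ((𝕏 ↑ r) ↑ p) ⟧
        right = begin
          E * (Φ * v)                   ≈⟨ *-congˡ (Φ₂-q pq 𝕏) ⟩
          E * ⟦ geom q (𝕏 ↑ p) ⟧        ≈⟨ Φ₂-p qr (𝕏 ↑ p) ⟩
          ⟦ geom q ((𝕏 ↑ p) ↑ r) ⟧      ≈⟨ geom-cong q (↑-comm 𝕏 p r) ⟩
          ⟦ geom q ((𝕏 ↑ r) ↑ p) ⟧      ∎

      Φ₃*Ψ₃ : ⟦ Φ₃ ⟧ * ⟦ Ψ₃ ⟧ ≈ 1-x^ (p ℕ.* q ℕ.* r)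
      Φ₃*Ψ₃ = begin
        ⟦ Φ₃ ⟧ * (⟦ Φ₂ pq 𝕏 ⟧ * (w * g))      ≈⟨ *-assoc ⟦ Φ₃ ⟧ _ _ ⟨
        ⟦ Φ₃ ⟧ * ⟦ Φ₂ pq 𝕏 ⟧ * (w * g)        ≈⟨ *-congʳ Φ₃*Φ₂ ⟩
        ⟦ Φ₂ pq (𝕏 ↑ r) ⟧ * (w * g)
          ≈⟨ solve 3 (λ c w g → c :* (w :* g) := w :* (c :* g)) refl _ w g ⟩
        w * (⟦ Φ₂ pq (𝕏 ↑ r) ⟧ * g)           ≈⟨ *-congˡ (Φ₂-p pq (𝕏 ↑ r)) ⟩
        w * ⟦ geom p ((𝕏 ↑ r) ↑ q) ⟧          ≈⟨ telescope p ((𝕏 ↑ r) ↑ q) ⟩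
        1# + - ⟦ ((𝕏 ↑ r) ↑ q) ↑ p ⟧
          ≈⟨ +-congˡ (-‿cong (trans (↑-* (𝕏 ↑ r) q p) (↑-* 𝕏 r (q ℕ.* p)))) ⟩
        1-x^ (r ℕ.* (q ℕ.* p))
          ≡⟨ ≡.cong 1-x^_ (≡.trans (ℕ.*-comm r (q ℕ.* p)) (≡.cong (ℕ._* r) (ℕ.*-comm q p))) ⟩
        1-x^ (p ℕ.* q ℕ.* r)                  ∎
        where
        w = 1# + - ⟦ (𝕏 ↑ r) ↑ q ⟧
        g = ⟦ geom p (𝕏 ↑ r) ⟧

      -- The Möbius product for (1 - xⁿ) / Φ_pqr with denominators cleared. At a primitive root all
      -- factors on the right are nonzero, which will show that Ψ is nonzero there.
      Ψ₃-möbius : ⟦ Ψ₃ ⟧ * 1-x^ p * 1-x^ q * 1-x^ r ≈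
                  (1# + - x) * 1-x^ (q ℕ.* p) * 1-x^ (r ℕ.* p) * 1-x^ (r ℕ.* q)
      Ψ₃-möbius = begin
        Φ * (w * g) * 1-x^ p * 1-x^ q * 1-x^ r
          ≈⟨ *-congʳ (*-congʳ (*-congˡ (sym (telescope p 𝕏)))) ⟩
        Φ * (w * g) * ((1# + - x) * u) * 1-x^ q * 1-x^ r
          ≈⟨ solve 7 (λ Φ w g t u s y → Φ :* (w :* g) :* (t :* u) :* s :* y := t :* (s :* (Φ :* u)) :* (y :* g) :* w)
               refl Φ w g (1# + - x) u (1-x^ q) (1-x^ r) ⟩
        (1# + - x) * (1-x^ q * (Φ * u)) * (1-x^ r * g) * w
          ≈⟨ *-cong (*-cong (*-congˡ left) right) (+-congˡ (-‿cong (↑-* 𝕏 r q))) ⟩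
        (1# + - x) * 1-x^ (q ℕ.* p) * 1-x^ (r ℕ.* p) * 1-x^ (r ℕ.* q) ∎
        where
        Φ = ⟦ Φ₂ pq 𝕏 ⟧ ; u = ⟦ geom p 𝕏 ⟧
        w = 1# + - ⟦ (𝕏 ↑ r) ↑ q ⟧
        g = ⟦ geom p (𝕏 ↑ r) ⟧
        left : 1-x^ q * (Φ * u) ≈ 1-x^ (q ℕ.* p)
        left = begin
          1-x^ q * (Φ * u)                 ≈⟨ *-congˡ (Φ₂-p pq 𝕏) ⟩
          1-x^ q * ⟦ geom p (𝕏 ↑ q) ⟧      ≈⟨ telescope p (𝕏 ↑ q) ⟩
          1# + - ⟦ (𝕏 ↑ q) ↑ p ⟧           ≈⟨ +-congˡ (-‿cong (↑-* 𝕏 q p)) ⟩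
          1-x^ (q ℕ.* p)                   ∎
        right : 1-x^ r * g ≈ 1-x^ (r ℕ.* p)
        right = trans (telescope p (𝕏 ↑ r)) (+-congˡ (-‿cong (↑-* 𝕏 r p)))

      -- The product of (1 - x^d)^μ(n/d) over the divisors d of n = pqr, with denominators cleared.
      -- The degree of `Φ₃` is read off from it.
      Φ₃-möbius : ⟦ Φ₃ ⟧ * (1# + - x) * 1-x^ (q ℕ.* p) * 1-x^ (r ℕ.* p) * 1-x^ (r ℕ.* q) ≈
                  1-x^ (p ℕ.* q ℕ.* r) * 1-x^ p * 1-x^ q * 1-x^ r
      Φ₃-möbius = begin
        ⟦ Φ₃ ⟧ * t * k * l * m
          ≈⟨ solve 5 (λ Φ t k l m → Φ :* t :* k :* l :* m := Φ :* (t :* k :* l :* m)) refl _ t k l m ⟩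
        ⟦ Φ₃ ⟧ * (t * k * l * m)                        ≈⟨ *-congˡ Ψ₃-möbius ⟨
        ⟦ Φ₃ ⟧ * (⟦ Ψ₃ ⟧ * 1-x^ p * 1-x^ q * 1-x^ r)
          ≈⟨ solve 5 (λ Φ Ψ k l m → Φ :* (Ψ :* k :* l :* m) := Φ :* Ψ :* k :* l :* m) refl _ _ _ _ _ ⟩
        ⟦ Φ₃ ⟧ * ⟦ Ψ₃ ⟧ * 1-x^ p * 1-x^ q * 1-x^ r      ≈⟨ *-congʳ (*-congʳ (*-congʳ Φ₃*Ψ₃)) ⟩
        1-x^ (p ℕ.* q ℕ.* r) * 1-x^ p * 1-x^ q * 1-x^ r ∎
        where
        t = 1# + - x ; k = 1-x^ (q ℕ.* p) ; l = 1-x^ (r ℕ.* p) ; m = 1-x^ (r ℕ.* q)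

-- Dual numbers, for derivatives.

module FormalPolynomials where
  open CyclotomicPolynomials
  open import Data.Nat.Base as ℕ using (ℕ; zero; suc)
  import Data.Nat.Properties as ℕ
  open import Data.Product.Base using (_×_; _,_; proj₁; proj₂)
  open import Data.List.Base using (List; []; _∷_; map; length)
  open import Data.Vec.Base using (Vec; []; _∷_; lookup)
  open import Data.Fin.Base using (Fin; zero; suc)
  open import Relation.Binary.PropositionalEquality as ≡ using (_≡_)
  open import Relation.Nullary using (¬_)

  -- R[ε] with ε² = 0. Evaluating at z + ε gives f(z) + f′(z) ε, so an identity that holds in all
  -- commutative rings is differentiated by reading it here.
  dualNumbers : ∀ {c ℓ} → CommutativeRing c ℓ → CommutativeRing c ℓ
  dualNumbers R = record
    { Carrier = Carrier × Carrier
    ; _≈_ = λ (a , a′) (b , b′) → a ≈ b × a′ ≈ b′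
    ; _+_ = λ (a , a′) (b , b′) → a + b , a′ + b′
    ; _*_ = λ (a , a′) (b , b′) → a * b , a * b′ + a′ * b
    ; -_ = λ (a , a′) → - a , - a′
    ; 0# = 0# , 0#
    ; 1# = 1# , 0#
    ; isCommutativeRing = record
      { isRing = record
        { +-isAbelianGroup = record
          { isGroup = record
            { isMonoid = record
              { isSemigroup = record
                { isMagma = record
                  { isEquivalence = record
                    { refl = refl , refl
                    ; sym = λ (e , f) → sym e , sym f
                    ; trans = λ (e , f) (g , h) → trans e g , trans f h }
                  ; ∙-cong = λ (e , f) (g , h) → +-cong e g , +-cong f h }
                ; assoc = λ (a , a′) (b , b′) (c , c′) → +-assoc a b c , +-assoc a′ b′ c′ }
              ; identity = (λ (a , a′) → +-identityˡ a , +-identityˡ a′)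
                         , (λ (a , a′) → +-identityʳ a , +-identityʳ a′) }
            ; inverse = (λ (a , a′) → -‿inverseˡ a , -‿inverseˡ a′)
                      , (λ (a , a′) → -‿inverseʳ a , -‿inverseʳ a′)
            ; ⁻¹-cong = λ (e , f) → -‿cong e , -‿cong f }
          ; comm = λ (a , a′) (b , b′) → +-comm a b , +-comm a′ b′ }
        ; *-cong = λ (e , f) (g , h) → *-cong e g , +-cong (*-cong e h) (*-cong f g)
        ; *-assoc = λ (a , a′) (b , b′) (c , c′) → *-assoc a b c ,
            solve 6 (λ a a′ b b′ c c′ → a :* b :* c′ :+ (a :* b′ :+ a′ :* b) :* c :=
                                        a :* (b :* c′ :+ b′ :* c) :+ a′ :* (b :* c)) refl a a′ b b′ c c′
        ; *-identity =
            (λ (a , a′) → *-identityˡ a , solve 2 (λ a a′ → :1 :* a′ :+ :0 :* a := a′) refl a a′)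
          , (λ (a , a′) → *-identityʳ a , solve 2 (λ a a′ → a :* :0 :+ a′ :* :1 := a′) refl a a′)
        ; distrib =
            (λ (a , a′) (b , b′) (c , c′) → distribˡ a b c ,
              solve 6 (λ a a′ b b′ c c′ → a :* (b′ :+ c′) :+ a′ :* (b :+ c) :=
                                          (a :* b′ :+ a′ :* b) :+ (a :* c′ :+ a′ :* c)) refl a a′ b b′ c c′)
          , (λ (a , a′) (b , b′) (c , c′) → distribʳ a b c ,
              solve 6 (λ a a′ b b′ c c′ → (b :+ c) :* a′ :+ (b′ :+ c′) :* a :=
                                          (b :* a′ :+ b′ :* a) :+ (c :* a′ :+ c′ :* a)) refl a a′ b b′ c c′) }
      ; *-comm = λ (a , a′) (b , b′) → *-comm a b ,
          solve 4 (λ a a′ b b′ → a :* b′ :+ a′ :* b := b :* a′ :+ b′ :* a) refl a a′ b b′ } }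
    where
    open CommutativeRing R
    open IntegerSolver R

  -- Formal power series and the degree of Φ_pqr.

  module PowerSeries {c ℓ} (R : CommutativeRing c ℓ) where
    open CommutativeRing R
    open IntegerSolver R
    open import Relation.Binary.Reasoning.Setoid setoid
    open import Function.Base using (_∘_)

    Series : Set c
    Series = ℕ → Carrier

    infix  4 _≋_
    infixl 7 _✶_

    _≋_ : Series → Series → Set ℓ
    f ≋ g = ∀ n → f n ≈ g n

    -- The Cauchy product, defined by peeling off the constant coefficient of the left factor, so
    -- that the ring laws follow by induction on the index without finite sums.
    _✶_ : Series → Series → Series
    (f ✶ g) zero    = f 0 * g 0
    (f ✶ g) (suc n) = f 0 * g (suc n) + ((f ∘ suc) ✶ g) n

    const : Carrier → Series
    const a zero    = a
    const a (suc n) = 0#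

    ✶-cong : ∀ {f f′ g g′} → f ≋ f′ → g ≋ g′ → f ✶ g ≋ f′ ✶ g′
    ✶-cong f≋ g≋ zero    = *-cong (f≋ 0) (g≋ 0)
    ✶-cong f≋ g≋ (suc n) = +-cong (*-cong (f≋ 0) (g≋ (suc n))) (✶-cong (f≋ ∘ suc) g≋ n)

    ✶-distribʳ : ∀ h f g → (λ n → f n + g n) ✶ h ≋ λ n → (f ✶ h) n + (g ✶ h) n
    ✶-distribʳ h f g zero    = distribʳ _ _ _
    ✶-distribʳ h f g (suc n) = trans (+-congˡ (✶-distribʳ h (f ∘ suc) (g ∘ suc) n))
      (solve 5 (λ a b c d e → (a :+ b) :* c :+ (d :+ e) := (a :* c :+ d) :+ (b :* c :+ e)) refl _ _ _ _ _)

    scale-✶ : ∀ a f g → (λ n → a * f n) ✶ g ≋ λ n → a * (f ✶ g) n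
    scale-✶ a f g zero    = *-assoc _ _ _
    scale-✶ a f g (suc n) = trans (+-congˡ (scale-✶ a (f ∘ suc) g n))
      (solve 4 (λ a b c d → a :* b :* c :+ a :* d := a :* (b :* c :+ d)) refl _ _ _ _)

    zero-✶ : ∀ g → (λ _ → 0#) ✶ g ≋ λ _ → 0#
    zero-✶ g zero    = zeroˡ _
    zero-✶ g (suc n) = trans (+-cong (zeroˡ _) (zero-✶ g n)) (+-identityˡ 0#)

    const-✶ : ∀ a g → const a ✶ g ≋ λ n → a * g n
    const-✶ a g zero    = refl
    const-✶ a g (suc n) = trans (+-congˡ (zero-✶ g n)) (+-identityʳ _)

    ✶-assoc : ∀ f g h → (f ✶ g) ✶ h ≋ f ✶ (g ✶ h)
    ✶-assoc f g h zero    = *-assoc _ _ _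
    ✶-assoc f g h (suc n) = begin
      f 0 * g 0 * h (suc n) + ((λ k → f 0 * g (suc k) + ((f ∘ suc) ✶ g) k) ✶ h) n
        ≈⟨ +-congˡ (✶-distribʳ h (λ k → f 0 * g (suc k)) ((f ∘ suc) ✶ g) n) ⟩
      f 0 * g 0 * h (suc n) + (((λ k → f 0 * g (suc k)) ✶ h) n + (((f ∘ suc) ✶ g) ✶ h) n)
        ≈⟨ +-congˡ (+-cong (scale-✶ (f 0) (g ∘ suc) h n) (✶-assoc (f ∘ suc) g h n)) ⟩
      f 0 * g 0 * h (suc n) + (f 0 * ((g ∘ suc) ✶ h) n + ((f ∘ suc) ✶ (g ✶ h)) n)
        ≈⟨ solve 5 (λ a b c d e → a :* b :* c :+ (a :* d :+ e) := a :* (b :* c :+ d) :+ e) refl _ _ _ _ _ ⟩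
      f 0 * (g ✶ h) (suc n) + ((f ∘ suc) ✶ (g ✶ h)) n ∎

    -- Peels the right factor, as commutativity requires of a product defined by peeling the left
    -- one.
    ✶-suc : ∀ f g n → (f ✶ g) (suc n) ≈ (f ✶ (g ∘ suc)) n + f (suc n) * g 0
    ✶-suc f g zero    = refl
    ✶-suc f g (suc n) = trans (+-congˡ (✶-suc (f ∘ suc) g n)) (sym (+-assoc _ _ _))

    ✶-comm : ∀ f g → f ✶ g ≋ g ✶ f
    ✶-comm f g zero    = *-comm _ _
    ✶-comm f g (suc n) = begin
      f 0 * g (suc n) + ((f ∘ suc) ✶ g) n   ≈⟨ +-cong (*-comm _ _) (✶-comm (f ∘ suc) g n) ⟩
      g (suc n) * f 0 + (g ✶ (f ∘ suc)) n   ≈⟨ +-comm _ _ ⟩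
      (g ✶ (f ∘ suc)) n + g (suc n) * f 0   ≈⟨ ✶-suc g f n ⟨
      (g ✶ f) (suc n)                       ∎

    ✶-identityˡ : ∀ f → const 1# ✶ f ≋ f
    ✶-identityˡ f n = trans (const-✶ 1# f n) (*-identityˡ _)

    powerSeries : CommutativeRing c ℓ
    powerSeries = record
      { Carrier = Series
      ; _≈_ = _≋_
      ; _+_ = λ f g n → f n + g n
      ; _*_ = _✶_
      ; -_ = λ f n → - f n
      ; 0# = λ _ → 0#
      ; 1# = const 1#
      ; isCommutativeRing = record
        { isRing = record
          { +-isAbelianGroup = record
            { isGroup = record
              { isMonoid = record
                { isSemigroup = record
                  { isMagma = record
                    { isEquivalence = record
                      { refl = λ n → refl
                      ; sym = λ e n → sym (e n)
                      ; trans = λ e f n → trans (e n) (f n) }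
                    ; ∙-cong = λ e f n → +-cong (e n) (f n) }
                  ; assoc = λ f g h n → +-assoc _ _ _ }
                ; identity = (λ f n → +-identityˡ _) , (λ f n → +-identityʳ _) }
              ; inverse = (λ f n → -‿inverseˡ _) , (λ f n → -‿inverseʳ _)
              ; ⁻¹-cong = λ e n → -‿cong (e n) }
            ; comm = λ f g n → +-comm _ _ }
          ; *-cong = ✶-cong
          ; *-assoc = ✶-assoc
          ; *-identity = ✶-identityˡ , λ f n → trans (✶-comm f (const 1#) n) (✶-identityˡ f n)
          ; distrib = (λ h f g n → trans (✶-comm h _ n)
                        (trans (✶-distribʳ h f g n) (+-cong (✶-comm f h n) (✶-comm g h n))))
                    , ✶-distribʳ }
        ; *-comm = ✶-comm } }

    var : Series
    var zero    = 0#
    var (suc n) = const 1# n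

    open Evaluation powerSeries var using (⟦_⟧; 1-x^_; Φ₃-möbius)

    var-✶-suc : ∀ g n → (var ✶ g) (suc n) ≈ g n
    var-✶-suc g n = trans (+-cong (zeroˡ _) (✶-identityˡ g n)) (+-identityˡ _)

    Degree≤ : Series → ℕ → Set ℓ
    Degree≤ f N = ∀ t → N ℕ.< t → f t ≈ 0#

    Degree≤-resp : ∀ {f g N} → f ≋ g → Degree≤ f N → Degree≤ g N
    Degree≤-resp f≋g d t N<t = trans (sym (f≋g t)) (d t N<t)

    ↑-✶-shift : ∀ k f t → (⟦ 𝕏 ↑ k ⟧ ✶ f) (k ℕ.+ t) ≈ f t
    ↑-✶-shift zero    f t = ✶-identityˡ f t
    ↑-✶-shift (suc k) f t = trans (✶-assoc var ⟦ 𝕏 ↑ k ⟧ f (suc (k ℕ.+ t)))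
      (trans (var-✶-suc (⟦ 𝕏 ↑ k ⟧ ✶ f) (k ℕ.+ t)) (↑-✶-shift k f t))

    *-1-x^ : ∀ k f t → (f ✶ 1-x^ k) t ≈ f t + - (⟦ 𝕏 ↑ k ⟧ ✶ f) t
    *-1-x^ k f = SS.solve 2 (λ f u → f SS.:* (SS.:1 SS.:- u) SS.:= f SS.:- u SS.:* f) (λ n → refl) f ⟦ 𝕏 ↑ k ⟧
      where module SS = IntegerSolver powerSeries

    ↑-✶-degree : ∀ k f {N} → Degree≤ f N → Degree≤ (⟦ 𝕏 ↑ k ⟧ ✶ f) (N ℕ.+ k)
    ↑-✶-degree k f {N} d t N+k<t = begin
      (⟦ 𝕏 ↑ k ⟧ ✶ f) t                   ≡⟨ ≡.cong (⟦ 𝕏 ↑ k ⟧ ✶ f) (ℕ.m+[n∸m]≡n k≤t) ⟨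
      (⟦ 𝕏 ↑ k ⟧ ✶ f) (k ℕ.+ (t ℕ.∸ k))   ≈⟨ ↑-✶-shift k f (t ℕ.∸ k) ⟩
      f (t ℕ.∸ k)                         ≈⟨ d (t ℕ.∸ k) (ℕ.m+n≤o⇒m≤o∸n (suc N) N+k<t) ⟩
      0#                                  ∎
      where
      k≤t : k ℕ.≤ t
      k≤t = ℕ.≤-trans (ℕ.m≤n+m k (suc N)) N+k<t

    degree-*-1-x^ : ∀ k f {N} → Degree≤ f N → Degree≤ (f ✶ 1-x^ k) (N ℕ.+ k)
    degree-*-1-x^ k f {N} d t N+k<t = begin
      (f ✶ 1-x^ k) t                  ≈⟨ *-1-x^ k f t ⟩
      f t + - (⟦ 𝕏 ↑ k ⟧ ✶ f) t
        ≈⟨ +-cong (d t (ℕ.≤-<-trans (ℕ.m≤m+n N k) N+k<t)) (-‿cong (↑-✶-degree k f d t N+k<t)) ⟩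
      0# + - 0#                       ≈⟨ -‿inverseʳ 0# ⟩
      0#                              ∎

    -- Above N the coefficients of f are k-periodic, hence zero because f is a polynomial.
    degree-/-1-x^ : ∀ k f {N M} → 0 ℕ.< k → Degree≤ f M → Degree≤ (f ✶ 1-x^ k) (N ℕ.+ k) → Degree≤ f N
    degree-/-1-x^ k@(suc _) f {N} {M} _ f≤M d t N<t =
      trans (periodic M) (f≤M (M ℕ.* k ℕ.+ t) (ℕ.≤-trans (ℕ.s≤s (ℕ.m≤m*n M k)) (ℕ.m<m+n (M ℕ.* k) (ℕ.≤-<-trans ℕ.z≤n N<t))))
      where
      step : ∀ u → N ℕ.< u → f u ≈ f (k ℕ.+ u)
      step u N<u = begin
        f u                                                   ≈⟨ ↑-✶-shift k f u ⟨
        (⟦ 𝕏 ↑ k ⟧ ✶ f) (k ℕ.+ u)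
          ≈⟨ solve 2 (λ a b → b := a :- (a :- b)) refl _ _ ⟩
        f (k ℕ.+ u) + - (f (k ℕ.+ u) + - (⟦ 𝕏 ↑ k ⟧ ✶ f) (k ℕ.+ u))
          ≈⟨ +-congˡ (-‿cong (trans (sym (*-1-x^ k f (k ℕ.+ u)))
               (d (k ℕ.+ u) (≡.subst (ℕ._< k ℕ.+ u) (ℕ.+-comm k N) (ℕ.+-monoʳ-< k N<u))))) ⟩
        f (k ℕ.+ u) + - 0#                                    ≈⟨ solve 1 (λ a → a :- :0 := a) refl _ ⟩
        f (k ℕ.+ u)                                           ∎
      periodic : ∀ j → f t ≈ f (j ℕ.* k ℕ.+ t)
      periodic zero    = refl
      periodic (suc j) = begin
        f t                            ≈⟨ periodic j ⟩
        f (j ℕ.* k ℕ.+ t)              ≈⟨ step (j ℕ.* k ℕ.+ t) (ℕ.<-≤-trans N<t (ℕ.m≤n+m t (j ℕ.* k))) ⟩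
        f (k ℕ.+ (j ℕ.* k ℕ.+ t))      ≡⟨ ≡.cong f (ℕ.+-assoc k (j ℕ.* k) t) ⟨
        f (suc j ℕ.* k ℕ.+ t)          ∎

    -- By `Φ₃-möbius`, `Φ₃` times four factors 1 - x^k has degree at most pqr + p + q + r; dividing
    -- the factors out one by one lowers the bound to `N`. The a priori bound `M` may be arbitrarily
    -- crude, since `degree-/-1-x^` uses it, and the `d₁`, `d₂`, `d₃` grown from it, only to know
    -- that a polynomial is being divided.
    degree-Φ₃ : ∀ {p q r M N} (pq : Bézout p q) (pr : Bézout p r) (qr : Bézout q r) →
      0 ℕ.< p → 0 ℕ.< q → 0 ℕ.< r →
      N ℕ.+ 1 ℕ.+ q ℕ.* p ℕ.+ r ℕ.* p ℕ.+ r ℕ.* q ≡ p ℕ.* q ℕ.* r ℕ.+ p ℕ.+ q ℕ.+ r →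
      let open Cyclotomic pq pr qr in
      Degree≤ ⟦ Φ₃ ⟧ M → Degree≤ ⟦ Φ₃ ⟧ N
    degree-Φ₃ {p} {q} {r} {M} {N} pq pr qr p>0 q>0 r>0 eq d =
      degree-/-1-x^ 1 ⟦ Φ₃ ⟧ (ℕ.s≤s ℕ.z≤n) d
        (degree-/-1-x^ (q ℕ.* p) f₁ (ℕ.*-mono-< q>0 p>0) d₁
          (degree-/-1-x^ (r ℕ.* p) f₂ (ℕ.*-mono-< r>0 p>0) d₂
            (degree-/-1-x^ (r ℕ.* q) f₃ (ℕ.*-mono-< r>0 q>0) d₃
              (≡.subst (Degree≤ (f₃ ✶ 1-x^ (r ℕ.* q))) (≡.sym eq)
                (Degree≤-resp (S.sym möbius) product)))))
      where
      module S = CommutativeRing powerSeries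
      open Cyclotomic pq pr qr
      f₁ = ⟦ Φ₃ ⟧ ✶ 1-x^ 1
      f₂ = f₁ ✶ 1-x^ (q ℕ.* p)
      f₃ = f₂ ✶ 1-x^ (r ℕ.* p)
      d₁ = degree-*-1-x^ 1 ⟦ Φ₃ ⟧ d
      d₂ = degree-*-1-x^ (q ℕ.* p) f₁ d₁
      d₃ = degree-*-1-x^ (r ℕ.* p) f₂ d₂
      one : Degree≤ (const 1#) 0
      one (suc t) _ = refl
      product = degree-*-1-x^ r _ (degree-*-1-x^ q _ (degree-*-1-x^ p _
        (Degree≤-resp (✶-identityˡ (1-x^ (p ℕ.* q ℕ.* r))) (degree-*-1-x^ (p ℕ.* q ℕ.* r) (const 1#) one))))
      -- `1-x^ 1` unfolds to 1 - x * 1, whereas `Φ₃-möbius` is stated with 1 - x.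
      möbius : f₃ ✶ 1-x^ (r ℕ.* q) ≋ 1-x^ (p ℕ.* q ℕ.* r) ✶ 1-x^ p ✶ 1-x^ q ✶ 1-x^ r
      möbius = S.trans
        (S.*-congʳ {1-x^ (r ℕ.* q)} (S.*-congʳ {1-x^ (r ℕ.* p)} (S.*-congʳ {1-x^ (q ℕ.* p)}
          (S.*-congˡ {⟦ Φ₃ ⟧} (S.+-congˡ {const 1#} (S.-‿cong (S.*-identityʳ var)))))))
        (Φ₃-möbius pq pr qr)

  -- Coefficient lists, their derivatives, and division by a linear factor.

  module DensePolynomials {c ℓ} (R : CommutativeRing c ℓ) where
    open CommutativeRing R hiding (zero)
    open IntegerSolver R
    open PowerSeries R using (powerSeries; var; _✶_; _≋_; Degree≤)
    open import Algebra.Properties.Semiring.Exp semiring using (_^_)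
    open import Algebra.Properties.Semiring.Mult semiring using (×-comm-*) renaming (_×_ to _∙_)
    open import Relation.Binary.Reasoning.Setoid setoid

    add : List Carrier → List Carrier → List Carrier
    add []      g       = g
    add (a ∷ f) []      = a ∷ f
    add (a ∷ f) (b ∷ g) = a + b ∷ add f g

    mul : List Carrier → List Carrier → List Carrier
    mul []      g = []
    mul (a ∷ f) g = add (map (a *_) g) (0# ∷ mul f g)

    -- Trailing zeros remain, zero being undecidable in the ring; the length of the list is thus
    -- only a crude bound for the degree.
    coefficients : Poly → List Carrier
    coefficients 𝟘       = []
    coefficients 𝟙       = 1# ∷ []
    coefficients 𝕏       = 0# ∷ 1# ∷ []
    coefficients (e ⊕ f) = add (coefficients e) (coefficients f)
    coefficients (e ⊗ f) = mul (coefficients e) (coefficients f)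
    coefficients (⊖ e)   = map -_ (coefficients e)

    coeff : List Carrier → ℕ → Carrier
    coeff []      n       = 0#
    coeff (a ∷ f) zero    = a
    coeff (a ∷ f) (suc n) = coeff f n

    coeff-add : ∀ f g n → coeff (add f g) n ≈ coeff f n + coeff g n
    coeff-add []      g       n       = sym (+-identityˡ _)
    coeff-add (a ∷ f) []      n       = sym (+-identityʳ _)
    coeff-add (a ∷ f) (b ∷ g) zero    = refl
    coeff-add (a ∷ f) (b ∷ g) (suc n) = coeff-add f g n

    coeff-map : ∀ (h : Carrier → Carrier) → h 0# ≈ 0# → ∀ f n → coeff (map h f) n ≈ h (coeff f n)
    coeff-map h h0 []      n       = sym h0
    coeff-map h h0 (a ∷ f) zero    = refl
    coeff-map h h0 (a ∷ f) (suc n) = coeff-map h h0 f n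

    coeff-mul : ∀ f g n → coeff (mul f g) n ≈ (coeff f ✶ coeff g) n
    coeff-mul []      g n = sym (PowerSeries.zero-✶ R (coeff g) n)
    coeff-mul (a ∷ f) g n = trans (coeff-add (map (a *_) g) (0# ∷ mul f g) n)
      (trans (+-congʳ (coeff-map (a *_) (zeroʳ a) g n)) (rest n))
      where
      rest : ∀ n → a * coeff g n + coeff (0# ∷ mul f g) n ≈ (coeff (a ∷ f) ✶ coeff g) n
      rest zero    = +-identityʳ _
      rest (suc n) = +-congˡ (coeff-mul f g n)

    open Evaluation powerSeries var using () renaming (⟦_⟧ to ⟦_⟧ₛ)

    coeff-coefficients : ∀ e → coeff (coefficients e) ≋ ⟦ e ⟧ₛ
    coeff-coefficients 𝟘       n = refl
    coeff-coefficients 𝟙       zero = refl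
    coeff-coefficients 𝟙       (suc n) = refl
    coeff-coefficients 𝕏       zero = refl
    coeff-coefficients 𝕏       (suc zero) = refl
    coeff-coefficients 𝕏       (suc (suc n)) = refl
    coeff-coefficients (e ⊕ f) n = trans (coeff-add (coefficients e) (coefficients f) n)
      (+-cong (coeff-coefficients e n) (coeff-coefficients f n))
    coeff-coefficients (e ⊗ f) n = trans (coeff-mul (coefficients e) (coefficients f) n)
      (PowerSeries.✶-cong R (coeff-coefficients e) (coeff-coefficients f) n)
    coeff-coefficients (⊖ e)   n = trans (coeff-map -_ (solve 0 (:- :0 := :0) refl) (coefficients e) n)
      (-‿cong (coeff-coefficients e n))

    coeff-degree : ∀ f → Degree≤ (coeff f) (length f)
    coeff-degree []      t       _           = refl
    coeff-degree (a ∷ f) (suc t) (ℕ.s≤s l<t) = coeff-degree f t l<t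

    eval deriv : List Carrier → Carrier → Carrier
    eval []      z = 0#
    eval (a ∷ f) z = a + z * eval f z
    deriv []      z = 0#
    deriv (a ∷ f) z = eval f z + z * deriv f z

    module _ (z : Carrier) where
      open Evaluation (dualNumbers R) (z , 1#) using (⟦_⟧)

      eval-add : ∀ f g → eval (add f g) z ≈ eval f z + eval g z
      eval-add []      g       = sym (+-identityˡ _)
      eval-add (a ∷ f) []      = sym (+-identityʳ _)
      eval-add (a ∷ f) (b ∷ g) = trans (+-congˡ (*-congˡ (eval-add f g)))
        (solve 5 (λ a b z f g → a :+ b :+ z :* (f :+ g) := a :+ z :* f :+ (b :+ z :* g)) refl a b z _ _)

      eval-map : ∀ a f → eval (map (a *_) f) z ≈ a * eval f z
      eval-map a []      = sym (zeroʳ a)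
      eval-map a (b ∷ f) = trans (+-congˡ (*-congˡ (eval-map a f)))
        (solve 4 (λ a b z f → a :* b :+ z :* (a :* f) := a :* (b :+ z :* f)) refl a b z _)

      eval-mul : ∀ f g → eval (mul f g) z ≈ eval f z * eval g z
      eval-mul []      g = sym (zeroˡ _)
      eval-mul (a ∷ f) g = begin
        eval (mul (a ∷ f) g) z                                  ≈⟨ eval-add (map (a *_) g) (0# ∷ mul f g) ⟩
        eval (map (a *_) g) z + (0# + z * eval (mul f g) z)
          ≈⟨ +-cong (eval-map a g) (+-congˡ (*-congˡ (eval-mul f g))) ⟩
        a * eval g z + (0# + z * (eval f z * eval g z))
          ≈⟨ solve 4 (λ a z f g → a :* g :+ (:0 :+ z :* (f :* g)) := (a :+ z :* f) :* g) refl a z _ _ ⟩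
        eval (a ∷ f) z * eval g z                               ∎

      eval-neg : ∀ f → eval (map -_ f) z ≈ - eval f z
      eval-neg []      = solve 0 (:0 := :- :0) refl
      eval-neg (a ∷ f) = trans (+-congˡ (*-congˡ (eval-neg f)))
        (solve 3 (λ a z f → :- a :+ z :* (:- f) := :- (a :+ z :* f)) refl a z _)

      deriv-add : ∀ f g → deriv (add f g) z ≈ deriv f z + deriv g z
      deriv-add []      g       = sym (+-identityˡ _)
      deriv-add (a ∷ f) []      = sym (+-identityʳ _)
      deriv-add (a ∷ f) (b ∷ g) = trans (+-cong (eval-add f g) (*-congˡ (deriv-add f g)))
        (solve 5 (λ f g z f′ g′ → f :+ g :+ z :* (f′ :+ g′) := f :+ z :* f′ :+ (g :+ z :* g′)) refl _ _ z _ _)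

      deriv-map : ∀ a f → deriv (map (a *_) f) z ≈ a * deriv f z
      deriv-map a []      = sym (zeroʳ a)
      deriv-map a (b ∷ f) = trans (+-cong (eval-map a f) (*-congˡ (deriv-map a f)))
        (solve 4 (λ a z f f′ → a :* f :+ z :* (a :* f′) := a :* (f :+ z :* f′)) refl a z _ _)

      deriv-mul : ∀ f g → deriv (mul f g) z ≈ eval f z * deriv g z + deriv f z * eval g z
      deriv-mul []      g = solve 2 (λ g g′ → :0 := :0 :* g′ :+ :0 :* g) refl (eval g z) _
      deriv-mul (a ∷ f) g = begin
        deriv (mul (a ∷ f) g) z
          ≈⟨ deriv-add (map (a *_) g) (0# ∷ mul f g) ⟩
        deriv (map (a *_) g) z + (eval (mul f g) z + z * deriv (mul f g) z)
          ≈⟨ +-cong (deriv-map a g) (+-cong (eval-mul f g) (*-congˡ (deriv-mul f g))) ⟩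
        a * deriv g z + (eval f z * eval g z + z * (eval f z * deriv g z + deriv f z * eval g z))
          ≈⟨ solve 6 (λ a z f g f′ g′ → a :* g′ :+ (f :* g :+ z :* (f :* g′ :+ f′ :* g)) :=
                                        (a :+ z :* f) :* g′ :+ (f :+ z :* f′) :* g) refl a z _ _ _ _ ⟩
        eval (a ∷ f) z * deriv g z + deriv (a ∷ f) z * eval g z             ∎

      deriv-neg : ∀ f → deriv (map -_ f) z ≈ - deriv f z
      deriv-neg []      = solve 0 (:0 := :- :0) refl
      deriv-neg (a ∷ f) = trans (+-cong (eval-neg f) (*-congˡ (deriv-neg f)))
        (solve 3 (λ f z f′ → :- f :+ z :* (:- f′) := :- (f :+ z :* f′)) refl _ z _)

      eval-coefficients : ∀ e → eval (coefficients e) z ≈ proj₁ ⟦ e ⟧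
      eval-coefficients 𝟘       = refl
      eval-coefficients 𝟙       = solve 1 (λ z → :1 :+ z :* :0 := :1) refl z
      eval-coefficients 𝕏       = solve 1 (λ z → :0 :+ z :* (:1 :+ z :* :0) := z) refl z
      eval-coefficients (e ⊕ f) = trans (eval-add (coefficients e) _) (+-cong (eval-coefficients e) (eval-coefficients f))
      eval-coefficients (e ⊗ f) = trans (eval-mul (coefficients e) _) (*-cong (eval-coefficients e) (eval-coefficients f))
      eval-coefficients (⊖ e)   = trans (eval-neg (coefficients e)) (-‿cong (eval-coefficients e))

      -- Leibniz' rule for lists, `deriv-mul`, is exactly the ε-component of the product of dual
      -- numbers.
      deriv-coefficients : ∀ e → deriv (coefficients e) z ≈ proj₂ ⟦ e ⟧
      deriv-coefficients 𝟘       = refl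
      deriv-coefficients 𝟙       = solve 1 (λ z → :0 :+ z :* :0 := :0) refl z
      deriv-coefficients 𝕏       = solve 1 (λ z → :1 :+ z :* :0 :+ z :* (:0 :+ z :* :0) := :1) refl z
      deriv-coefficients (e ⊕ f) = trans (deriv-add (coefficients e) _) (+-cong (deriv-coefficients e) (deriv-coefficients f))
      deriv-coefficients (e ⊗ f) = trans (deriv-mul (coefficients e) _)
        (+-cong (*-cong (eval-coefficients e) (deriv-coefficients f)) (*-cong (deriv-coefficients e) (eval-coefficients f)))
      deriv-coefficients (⊖ e)   = trans (deriv-neg (coefficients e)) (-‿cong (deriv-coefficients e))

      power₁ : ∀ k → proj₁ ⟦ 𝕏 ↑ k ⟧ ≈ z ^ k
      power₁ zero    = refl
      power₁ (suc k) = *-congˡ (power₁ k)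

      -- The extra factor z turns k z^(k-1) into k z^k, which avoids a predecessor in the exponent
      -- and meets the hypothesis zⁿ = 1 directly.
      power₂ : ∀ k → z * proj₂ ⟦ 𝕏 ↑ k ⟧ ≈ k ∙ z ^ k
      power₂ zero    = zeroʳ z
      power₂ (suc k) = begin
        z * (z * d + 1# * u)
          ≈⟨ solve 3 (λ z d u → z :* (z :* d :+ :1 :* u) := z :* u :+ z :* (z :* d)) refl z d u ⟩
        z * u + z * (z * d)           ≈⟨ +-cong (*-congˡ (power₁ k)) (*-congˡ (power₂ k)) ⟩
        z ^ suc k + z * (k ∙ z ^ k)   ≈⟨ +-congˡ (×-comm-* k z (z ^ k)) ⟩
        suc k ∙ z ^ suc k             ∎
        where
        u = proj₁ ⟦ 𝕏 ↑ k ⟧ ; d = proj₂ ⟦ 𝕏 ↑ k ⟧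

    evalᵛ : ∀ {m} → Vec Carrier m → Carrier → Carrier
    evalᵛ []      z = 0#
    evalᵛ (a ∷ f) z = a + z * evalᵛ f z

    -- Fixes the number of coefficients, padding with zeros if need be. No information is lost once
    -- the coefficients from `m` on are known to vanish.
    truncate : ∀ m → List Carrier → Vec Carrier m
    truncate zero    f       = []
    truncate (suc m) []      = 0# ∷ truncate m []
    truncate (suc m) (a ∷ f) = a ∷ truncate m f

    -- (f(x) - f(z)) / (x - z)
    quotient : ∀ {m} → Carrier → Vec Carrier (suc m) → Vec Carrier m
    quotient z (a ∷ [])    = []
    quotient z (a ∷ b ∷ f) = evalᵛ (b ∷ f) z ∷ quotient z (b ∷ f)

    quotient-eval : ∀ {m} (f : Vec Carrier (suc m)) z w → evalᵛ f w ≈ evalᵛ f z + (w + - z) * evalᵛ (quotient z f) w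
    quotient-eval (a ∷ [])    z w = solve 3 (λ a z w → a :+ w :* :0 := a :+ z :* :0 :+ (w :- z) :* :0) refl a z w
    quotient-eval (a ∷ b ∷ f) z w = trans (+-congˡ (*-congˡ (quotient-eval (b ∷ f) z w)))
      (solve 5 (λ a z w f g → a :+ w :* (f :+ (w :- z) :* g) := a :+ z :* f :+ (w :- z) :* (f :+ w :* g))
        refl a z w _ _)

    module _ (z : Carrier) where
      0+z*0 : ∀ {a b} → a ≈ 0# → b ≈ 0# → a + z * b ≈ 0#
      0+z*0 a≈0 b≈0 = trans (+-cong a≈0 (trans (*-congˡ b≈0) (zeroʳ z))) (+-identityʳ 0#)

      eval-zero : ∀ f → (∀ t → coeff f t ≈ 0#) → eval f z ≈ 0#
      eval-zero []      d = refl
      eval-zero (a ∷ f) d = 0+z*0 (d 0) (eval-zero f λ t → d (suc t))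

      deriv-zero : ∀ f → (∀ t → coeff f t ≈ 0#) → deriv f z ≈ 0#
      deriv-zero []      d = refl
      deriv-zero (a ∷ f) d = 0+z*0 (eval-zero f λ t → d (suc t)) (deriv-zero f λ t → d (suc t))

      evalᵛ-truncate : ∀ {m} f → (∀ t → m ℕ.≤ t → coeff f t ≈ 0#) → evalᵛ (truncate m f) z ≈ eval f z
      evalᵛ-truncate {zero}  f       d = sym (eval-zero f λ t → d t ℕ.z≤n)
      evalᵛ-truncate {suc m} []      d = 0+z*0 refl (evalᵛ-truncate {m} [] λ _ _ → refl)
      evalᵛ-truncate {suc m} (a ∷ f) d = +-congˡ (*-congˡ (evalᵛ-truncate {m} f λ t m≤t → d (suc t) (ℕ.s≤s m≤t)))

      -- The difference quotient (f(x) - f(z)) / (x - z), being a polynomial in x, takes the value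
      -- f′(z) at x = z.
      deriv-quotient : ∀ {m} f → (∀ t → m ℕ.< t → coeff f t ≈ 0#) →
                       evalᵛ (quotient z (truncate (suc m) f)) z ≈ deriv f z
      deriv-quotient {zero}  []          d = refl
      -- A constant may be given by a longer list; the entries after `a` are zero, and so is the
      -- derivative.
      deriv-quotient {zero}  (a ∷ f)     d = sym (0+z*0 (eval-zero f d′) (deriv-zero f d′))
        where
        d′ : ∀ t → coeff f t ≈ 0#
        d′ t = d (suc t) (ℕ.s≤s ℕ.z≤n)
      deriv-quotient {suc m} []          d =
        0+z*0 (evalᵛ-truncate {suc m} [] λ _ _ → refl) (deriv-quotient {m} [] λ _ _ → refl)
      deriv-quotient {suc m} (a ∷ [])    d =
        trans (0+z*0 (evalᵛ-truncate {suc m} [] λ _ _ → refl) (deriv-quotient {m} [] λ _ _ → refl))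
              (sym (0+z*0 refl refl))
      deriv-quotient {suc m} (a ∷ b ∷ f) d =
        +-cong (evalᵛ-truncate {suc m} (b ∷ f) λ t m<t → d (suc t) (ℕ.s≤s m<t))
               (*-congˡ (deriv-quotient {m} (b ∷ f) λ t m<t → d (suc t) (ℕ.s≤s m<t)))

      -- The head of the quotient is the value at `z` of the tail of `f`. As it vanishes, f(z) = 0
      -- forces the constant coefficient to vanish; the tail then satisfies the same hypotheses.
      quotient-injective : ∀ {m} (f : Vec Carrier (suc m)) → evalᵛ f z ≈ 0# →
        (∀ i → lookup (quotient z f) i ≈ 0#) → ∀ i → lookup f i ≈ 0#
      quotient-injective (a ∷ [])    f≈0 q≈0 zero    = trans (solve 2 (λ a z → a := a :+ z :* :0) refl a z) f≈0
      quotient-injective (a ∷ b ∷ f) f≈0 q≈0 zero    =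
        trans (trans (solve 2 (λ a z → a := a :+ z :* :0) refl a z) (+-congˡ (*-congˡ (sym (q≈0 zero))))) f≈0
      quotient-injective (a ∷ b ∷ f) f≈0 q≈0 (suc i) = quotient-injective (b ∷ f) (q≈0 zero) (λ j → q≈0 (suc j)) i

    module _ (cancel : ∀ {a b} → a * b ≈ 0# → ¬ a ≈ 0# → b ≈ 0#) where

      -- Fewer coefficients than needed for m roots: dividing by x - ζ₀ leaves a quotient that
      -- vanishes at the remaining points, because ζᵢ - ζ₀ cancels. Distinctness is a mere negation,
      -- which is the form that `cancel` accepts.
      vanishing : ∀ {m} (f : Vec Carrier m) (ζ : Fin m → Carrier) → (∀ {i j} → ζ i ≈ ζ j → i ≡ j) →
                  (∀ i → evalᵛ f (ζ i) ≈ 0#) → ∀ i → lookup f i ≈ 0#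
      vanishing {suc m} f ζ injective f≈0 = quotient-injective (ζ zero) f (f≈0 zero)
        (vanishing (quotient (ζ zero) f) (λ i → ζ (suc i)) (λ e → suc-injective (injective e)) λ i →
          cancel (begin
            (ζ (suc i) + - ζ zero) * evalᵛ (quotient (ζ zero) f) (ζ (suc i))
              ≈⟨ +-identityˡ _ ⟨
            0# + (ζ (suc i) + - ζ zero) * evalᵛ (quotient (ζ zero) f) (ζ (suc i))
              ≈⟨ +-congʳ (f≈0 zero) ⟨
            evalᵛ f (ζ zero) + (ζ (suc i) + - ζ zero) * evalᵛ (quotient (ζ zero) f) (ζ (suc i))
              ≈⟨ quotient-eval f (ζ zero) (ζ (suc i)) ⟨
            evalᵛ f (ζ (suc i))  ≈⟨ f≈0 (suc i) ⟩
            0# ∎)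
            λ e → 0≢1+n (≡.sym (injective (x-y≈0⇒x≈y _ _ e))))
        where
        open import Data.Fin.Properties using (suc-injective; 0≢1+n)
        open import Algebra.Properties.Group +-group using () renaming (x∙y⁻¹≈ε⇒x≈y to x-y≈0⇒x≈y)

-- Bounds on the coefficient norms of Φ and Ψ.

module CoefficientNorms where
  open CyclotomicPolynomials
  open import Data.Nat.Base using (ℕ; zero; suc; _+_; _*_; _≤_)
  open import Data.Nat.Properties
  open import Data.Nat.Solver using (module +-*-Solver)
  open import Relation.Binary.PropositionalEquality
  open +-*-Solver using (solve; _:+_; _:*_; con; _:=_)

  norm-↑ : ∀ e k → norm e ≡ 1 → norm (e ↑ k) ≡ 1
  norm-↑ e zero    h = refl
  norm-↑ e (suc k) h = cong₂ _*_ h (norm-↑ e k h)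

  norm-geom : ∀ k e → norm e ≡ 1 → norm (geom k e) ≡ k
  norm-geom zero    e h = refl
  norm-geom (suc k) e h = cong suc (trans (cong₂ _*_ h (norm-geom k e h)) (*-identityˡ k))

  norm-Φ₂ : ∀ {p q} (z : Bézout p q) e → norm e ≡ 1 → norm (Φ₂ z e) ≤ 2 * (p * q)
  norm-Φ₂ {p} {q} z e h = begin
    norm (Φ₂ z e)
      ≡⟨ cong₂ _+_ (cong₂ _*_ (norm-geom a _ (norm-↑ e p h)) (norm-geom p _ (norm-↑ e q h)))
                                  (cong₂ _*_ h (cong₂ _*_ (norm-geom b _ (norm-↑ e q h)) (norm-geom q _ (norm-↑ e p h)))) ⟩
    a * p + 1 * (b * q)     ≤⟨ +-mono-≤ (*-monoˡ-≤ p a≤q) (*-monoʳ-≤ 1 (*-monoˡ-≤ q b≤p)) ⟩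
    q * p + 1 * (p * q)     ≡⟨ solve 2 (λ p q → q :* p :+ con 1 :* (p :* q) := con 2 :* (p :* q)) refl p q ⟩
    2 * (p * q)             ∎
    where
    open ≤-Reasoning
    open Bézout z

  module _ {p q r} (pq : Bézout p q) (pr : Bézout p r) (qr : Bézout q r) where
    open Cyclotomic pq pr qr
    open Bézout pq
    open ≤-Reasoning

    norm-Ψ₃ : norm Ψ₃ ≤ 2 * (p * q) * (2 * p)
    norm-Ψ₃ = *-mono-≤ (norm-Φ₂ pq 𝕏 refl) (≤-reflexive (cong₂ (λ u v → (1 + u) * v)
      (norm-↑ (𝕏 ↑ r) q (norm-↑ 𝕏 r refl)) (norm-geom p (𝕏 ↑ r) (norm-↑ 𝕏 r refl))))

    norm-Φ₃ : norm Φ₃ ≤ 2 * (p * q * r * (p + q))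
    norm-Φ₃ = begin
      norm Φ₃
        ≤⟨ +-mono-≤
             (*-mono-≤ (≤-trans (≤-reflexive (norm-geom a _ (norm-↑ _ p (norm-↑ 𝕏 r refl)))) a≤q)
               (*-mono-≤ (norm-Φ₂ pr (𝕏 ↑ q) (norm-↑ 𝕏 q refl)) (≤-reflexive (norm-geom p 𝕏 refl))))
             (*-mono-≤ (≤-reflexive (norm-↑ 𝕏 r refl))
               (*-mono-≤ (≤-trans (≤-reflexive (norm-geom b _ (norm-↑ _ q (norm-↑ 𝕏 r refl)))) b≤p)
                 (*-mono-≤ (norm-Φ₂ qr (𝕏 ↑ p) (norm-↑ 𝕏 p refl)) (≤-reflexive (norm-geom q 𝕏 refl))))) ⟩
      q * (2 * (p * r) * p) + 1 * (p * (2 * (q * r) * q))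
        ≡⟨ solve 3 (λ p q r → q :* (con 2 :* (p :* r) :* p) :+ con 1 :* (p :* (con 2 :* (q :* r) :* q)) :=
                              con 2 :* (p :* q :* r :* (p :+ q))) refl p q r ⟩
      2 * (p * q * r * (p + q)) ∎

    -- The leading 1 bounds ∣ζⱼ∣ in the product ζⱼ Ψ(ζⱼ). The factor pqr is kept apart because it
    -- cancels against the denominator n of the matrix entries.
    norm-Ψ₃*Φ₃ : ∀ M → 4 * (p * p * q * (p + q)) ≤ M → 1 * norm Ψ₃ * norm Φ₃ ≤ p * q * r * (2 * M)
    norm-Ψ₃*Φ₃ M h = begin
      1 * norm Ψ₃ * norm Φ₃                                    ≤⟨ *-mono-≤ (*-monoʳ-≤ 1 norm-Ψ₃) norm-Φ₃ ⟩
      1 * (2 * (p * q) * (2 * p)) * (2 * (p * q * r * (p + q)))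
        ≡⟨ solve 3 (λ p q r → con 1 :* (con 2 :* (p :* q) :* (con 2 :* p)) :* (con 2 :* (p :* q :* r :* (p :+ q))) :=
                              p :* q :* r :* (con 2 :* (con 4 :* (p :* p :* q :* (p :+ q))))) refl p q r ⟩
      p * q * r * (2 * (4 * (p * p * q * (p + q))))            ≤⟨ *-monoʳ-≤ (p * q * r) (*-monoʳ-≤ 2 h) ⟩
      p * q * r * (2 * M)                                      ∎

-- The bounded inverse of the Vandermonde matrix over a normed field.

module NormedFields where
  open CyclotomicPolynomials
  open FormalPolynomials
  open CoefficientNorms
  import Algebra.Properties.Semiring.Exp as Exp
  import Algebra.Definitions.RawMonoid as RawMonoid

  open import Data.Bool.Base using (if_then_else_)
  open import Data.Fin.Base using (Fin; zero; suc; toℕ)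
  import Data.Fin.Properties as Fin
  open import Data.List.Base using (List; []; _∷_; map)
  open import Data.Nat.Base as ℕ using (ℕ; zero; suc)
  import Data.Nat.Properties as ℕ
  open import Data.Product.Base using (_,_; proj₁; proj₂; ∃-syntax)
  open import Data.Vec.Base using (Vec; []; _∷_; lookup; tabulate)
  open import Data.Vec.Properties using (lookup∘tabulate)
  open import Level using (0ℓ)
  open import Relation.Binary.PropositionalEquality as ≡ using (_≡_)
  open import Relation.Nullary using (¬_; does; yes; no)

  module Sums {c ℓ} (R : CommutativeRing c ℓ) where
    open CommutativeRing R hiding (zero)
    open IntegerSolver R
    open DensePolynomials R using (evalᵛ)
    open import Algebra.Properties.Semiring.Exp semiring using (_^_)
    open import Algebra.Properties.Semiring.Sum semiring using (sum; *-distribˡ-sum; sum-cong-≋)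
    open import Relation.Binary.Reasoning.Setoid setoid

    δ : ∀ {m} → Fin m → Fin m → Carrier
    δ i j = if does (i Fin.≟ j) then 1# else 0#

    sum-zero : ∀ {m} (f : Fin m → Carrier) → (∀ i → f i ≈ 0#) → sum f ≈ 0#
    sum-zero {zero}  f h = refl
    sum-zero {suc m} f h = trans (+-cong (h zero) (sum-zero (λ i → f (suc i)) λ i → h (suc i))) (+-identityˡ 0#)

    sum-δˡ : ∀ {m} (f : Fin m → Carrier) t → sum (λ i → δ t i * f i) ≈ f t
    sum-δˡ f zero    = trans (+-cong (*-identityˡ _) (sum-zero (λ i → 0# * f (suc i)) λ i → zeroˡ _)) (+-identityʳ _)
    sum-δˡ f (suc t) = trans (+-cong (zeroˡ _) (sum-δˡ (λ i → f (suc i)) t)) (+-identityˡ _)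

    sum-δʳ : ∀ {m} (f : Fin m → Carrier) t → sum (λ i → f i * δ i t) ≈ f t
    sum-δʳ f zero    = trans (+-cong (*-identityʳ _) (sum-zero (λ i → f (suc i) * 0#) λ i → zeroʳ _)) (+-identityʳ _)
    sum-δʳ f (suc t) = trans (+-cong (zeroʳ _) (sum-δʳ (λ i → f (suc i)) t)) (+-identityˡ _)

    evalᵛ-sum : ∀ {m} (f : Vec Carrier m) z → evalᵛ f z ≈ sum (λ k → z ^ toℕ k * lookup f k)
    evalᵛ-sum []      z = refl
    evalᵛ-sum {suc m} (a ∷ f) z = +-cong (sym (*-identityˡ a)) (begin
      z * evalᵛ f z                                 ≈⟨ *-congˡ (evalᵛ-sum f z) ⟩
      z * sum (λ k → z ^ toℕ k * lookup f k)        ≈⟨ *-distribˡ-sum z (λ k → z ^ toℕ k * lookup f k) ⟩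
      sum (λ k → z * (z ^ toℕ k * lookup f k))
        ≈⟨ sum-cong-≋ {m} (λ k → sym (*-assoc z (z ^ toℕ k) (lookup f k))) ⟩
      sum (λ k → z ^ suc (toℕ k) * lookup f k)      ∎)

  -- The absolute value enters only through the relation of being bounded by a natural number, so
  -- every estimate up to the matrix entries is arithmetic in ℕ.
  record NormedField : Set₁ where
    infix 4 ∣_∣≤_
    field
      ring : CommutativeRing 0ℓ 0ℓ
    open CommutativeRing ring hiding (ring; zero)
    open Exp semiring using (_^_)
    open RawMonoid +-rawMonoid using () renaming (_×_ to _∙_)
    field
      ∣_∣≤_      : Carrier → ℕ → Set
      ≈0-cancel  : ∀ {x y} → x * y ≈ 0# → ¬ x ≈ 0# → y ≈ 0#
      reciprocal : ∀ n → ∃[ c ] suc n ∙ 1# * c ≈ 1#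
      ∣∣≤-resp   : ∀ {x y B} → x ≈ y → ∣ x ∣≤ B → ∣ y ∣≤ B
      ∣∣≤-mono   : ∀ {x B C} → B ℕ.≤ C → ∣ x ∣≤ B → ∣ x ∣≤ C
      ∣0∣≤       : ∀ {B} → ∣ 0# ∣≤ B
      ∣1∣≤1      : ∣ 1# ∣≤ 1
      ∣∣≤-neg    : ∀ {x B} → ∣ x ∣≤ B → ∣ - x ∣≤ B
      ∣∣≤-+      : ∀ {x y B C} → ∣ x ∣≤ B → ∣ y ∣≤ C → ∣ x + y ∣≤ B ℕ.+ C
      ∣∣≤-*      : ∀ {x y B C} → ∣ x ∣≤ B → ∣ y ∣≤ C → ∣ x * y ∣≤ B ℕ.* C
      ∣∣≤-cancel : ∀ n {x B} → ∣ suc n ∙ 1# * x ∣≤ suc n ℕ.* B → ∣ x ∣≤ B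
      ∣root∣≤1   : ∀ x n → x ^ suc n ≈ 1# → ∣ x ∣≤ 1

  module Inverse (F : NormedField) where
    open NormedField F renaming (ring to K)
    open CommutativeRing K hiding (zero)
    open IntegerSolver K
    open DensePolynomials K
    open PowerSeries K using (Degree≤-resp; degree-Φ₃)
    open Sums K
    open import Algebra.Properties.Semiring.Exp semiring using (_^_)
    open import Algebra.Properties.Group +-group using () renaming (x∙y⁻¹≈ε⇒x≈y to x-y≈0⇒x≈y)
    open import Algebra.Properties.Semiring.Mult semiring using (×-congʳ) renaming (_×_ to _∙_)
    open import Algebra.Properties.Semiring.Sum semiring
      using (sum; sum-cong-≋; *-distribˡ-sum; *-distribʳ-sum; ∑-comm; ∑-distrib-+)
    open import Relation.Binary.Reasoning.Setoid setoid

    record BoundedInverse {m} (ζ : Fin m → Carrier) (B : ℕ) : Set where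
      field
        inverse             : Fin m → Fin m → Carrier
        vandermonde*inverse : ∀ i j → sum (λ k → ζ i ^ toℕ k * inverse k j) ≈ δ i j
        inverse*vandermonde : ∀ k l → sum (λ i → inverse k i * ζ i ^ toℕ l) ≈ δ k l
        ∣vandermonde∣≤1     : ∀ i k → ∣ ζ i ^ k ∣≤ 1
        ∣inverse∣≤B         : ∀ k j → ∣ inverse k j ∣≤ B

    infix 4 _≤₁_

    -- The ℓ¹ norm of the coefficients is at most B.
    data _≤₁_ : List Carrier → ℕ → Set where
      []   : ∀ {B} → [] ≤₁ B
      cons : ∀ {a f b c B} → ∣ a ∣≤ b → f ≤₁ c → b ℕ.+ c ℕ.≤ B → a ∷ f ≤₁ B

    ≤₁-mono : ∀ {f B C} → B ℕ.≤ C → f ≤₁ B → f ≤₁ C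
    ≤₁-mono B≤C []             = []
    ≤₁-mono B≤C (cons ha hf h) = cons ha hf (ℕ.≤-trans h B≤C)

    add-≤₁ : ∀ {f g B C} → f ≤₁ B → g ≤₁ C → add f g ≤₁ B ℕ.+ C
    add-≤₁ {B = B} {C} []       hg = ≤₁-mono (ℕ.m≤n+m C B) hg
    add-≤₁ {B = B} {C} hf@(cons _ _ _) [] = ≤₁-mono (ℕ.m≤m+n B C) hf
    add-≤₁ (cons {b = a} {b} ha hf h) (cons {b = c} {d} hc hg k) = cons (∣∣≤-+ ha hc) (add-≤₁ hf hg)
      (ℕ.≤-trans (ℕ.≤-reflexive (ℕS.solve 4 (λ a b c d → a ℕS.:+ c ℕS.:+ (b ℕS.:+ d) ℕS.:= a ℕS.:+ b ℕS.:+ (c ℕS.:+ d)) ≡.refl a b c d))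
        (ℕ.+-mono-≤ h k))
      where open import Data.Nat.Solver using () renaming (module +-*-Solver to ℕS)

    scale-≤₁ : ∀ {a f A B} → ∣ a ∣≤ A → f ≤₁ B → map (a *_) f ≤₁ A ℕ.* B
    scale-≤₁ ha []             = []
    scale-≤₁ {A = A} ha (cons {b = b} {c} hb hf h) = cons (∣∣≤-* ha hb) (scale-≤₁ ha hf)
      (ℕ.≤-trans (ℕ.≤-reflexive (≡.sym (ℕ.*-distribˡ-+ A b c))) (ℕ.*-monoʳ-≤ A h))

    mul-≤₁ : ∀ {f g B C} → f ≤₁ B → g ≤₁ C → mul f g ≤₁ B ℕ.* C
    mul-≤₁ []                              hg = []
    mul-≤₁ {C = C} (cons {b = b} {c} ha hf h) hg = ≤₁-mono
      (ℕ.≤-trans (ℕ.≤-reflexive (≡.sym (ℕ.*-distribʳ-+ C b c))) (ℕ.*-monoˡ-≤ C h))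
      (add-≤₁ (scale-≤₁ ha hg) (cons (∣0∣≤ {0}) (mul-≤₁ hf hg) (ℕ.≤-refl {0 ℕ.+ c ℕ.* C})))

    neg-≤₁ : ∀ {f B} → f ≤₁ B → map -_ f ≤₁ B
    neg-≤₁ []             = []
    neg-≤₁ (cons ha hf h) = cons (∣∣≤-neg ha) (neg-≤₁ hf) h

    coefficients-≤₁ : ∀ e → coefficients e ≤₁ norm e
    coefficients-≤₁ 𝟘       = []
    coefficients-≤₁ 𝟙       = cons ∣1∣≤1 ([] {0}) (ℕ.≤-refl {1 ℕ.+ 0})
    coefficients-≤₁ 𝕏       = cons (∣0∣≤ {0}) (cons ∣1∣≤1 ([] {0}) (ℕ.≤-refl {1 ℕ.+ 0})) (ℕ.≤-refl {0 ℕ.+ 1})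
    coefficients-≤₁ (e ⊕ f) = add-≤₁ (coefficients-≤₁ e) (coefficients-≤₁ f)
    coefficients-≤₁ (e ⊗ f) = mul-≤₁ (coefficients-≤₁ e) (coefficients-≤₁ f)
    coefficients-≤₁ (⊖ e)   = neg-≤₁ (coefficients-≤₁ e)

    module _ {z} (∣z∣≤1 : ∣ z ∣≤ 1) where

      horner-≤ : ∀ {a w b c B} → ∣ a ∣≤ b → ∣ w ∣≤ c → b ℕ.+ c ℕ.≤ B → ∣ a + z * w ∣≤ B
      horner-≤ {b = b} {c} ha hw h = ∣∣≤-mono
        (ℕ.≤-trans (ℕ.≤-reflexive (≡.cong (b ℕ.+_) (ℕ.*-identityˡ c))) h) (∣∣≤-+ ha (∣∣≤-* ∣z∣≤1 hw))

      eval-≤ : ∀ {f B} → f ≤₁ B → ∣ eval f z ∣≤ B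
      eval-≤ []             = ∣0∣≤
      eval-≤ (cons ha hf h) = horner-≤ ha (eval-≤ hf) h

      truncate-≤ : ∀ m {f B} → f ≤₁ B → ∣ evalᵛ (truncate m f) z ∣≤ B
      truncate-≤ zero    hf             = ∣0∣≤
      truncate-≤ (suc m) []             = horner-≤ (∣0∣≤ {0}) (truncate-≤ m ([] {0})) ℕ.z≤n
      truncate-≤ (suc m) (cons ha hf h) = horner-≤ ha (truncate-≤ m hf) h

      tail-≤ : ∀ b c {B} → b ℕ.+ c ℕ.≤ B → c ℕ.≤ B
      tail-≤ b c h = ℕ.≤-trans (ℕ.m≤n+m c b) h

      -- Each coefficient of the quotient is the value at `z` of a tail of `f`; for ∣z∣ ≤ 1 it is
      -- bounded by the norm of that tail, hence by the norm of `f`.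
      quotient-≤ : ∀ m {f B} → f ≤₁ B → ∀ i → ∣ lookup (quotient z (truncate (suc m) f)) i ∣≤ B
      quotient-≤ (suc m) []                                 zero    = truncate-≤ (suc m) []
      quotient-≤ (suc m) []                                 (suc i) = quotient-≤ m [] i
      -- `quotient` computes only once two coefficients are visible, so the tail is split to let
      -- `truncate` reduce.
      quotient-≤ (suc m) (cons {f = []}    {b} {c} ha hf h) zero    = ∣∣≤-mono (tail-≤ b c h) (truncate-≤ (suc m) hf)
      quotient-≤ (suc m) (cons {f = []}    {b} {c} ha hf h) (suc i) = ∣∣≤-mono (tail-≤ b c h) (quotient-≤ m hf i)
      quotient-≤ (suc m) (cons {f = _ ∷ _} {b} {c} ha hf h) zero    = ∣∣≤-mono (tail-≤ b c h) (truncate-≤ (suc m) hf)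
      quotient-≤ (suc m) (cons {f = _ ∷ _} {b} {c} ha hf h) (suc i) = ∣∣≤-mono (tail-≤ b c h) (quotient-≤ m hf i)

    module ThreePrimes {p q r} (pq : Bézout p q) (pr : Bézout p r) (qr : Bézout q r) where
      open Cyclotomic pq pr qr

      module Root (z : Carrier)
        (z^pqr≈1 : z ^ (p ℕ.* q ℕ.* r) ≈ 1#)
        (z^qp≉1 : ¬ z ^ (q ℕ.* p) ≈ 1#) (z^rp≉1 : ¬ z ^ (r ℕ.* p) ≈ 1#) (z^rq≉1 : ¬ z ^ (r ℕ.* q) ≈ 1#) where
        open Evaluation (dualNumbers K) (z , 1#) using (⟦_⟧; Φ₃*Ψ₃; Ψ₃-möbius)

        Φ Φ′ Ψ : Carrier
        Φ  = proj₁ ⟦ Φ₃ ⟧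
        Φ′ = proj₂ ⟦ Φ₃ ⟧
        Ψ  = proj₁ ⟦ Ψ₃ ⟧

        1-z^_≉0 : ∀ k → ¬ z ^ k ≈ 1# → ¬ 1# + - proj₁ ⟦ 𝕏 ↑ k ⟧ ≈ 0#
        1-z^ k ≉0 h e = h (sym (trans (x-y≈0⇒x≈y _ _ e) (power₁ z k)))

        z≉1 : ¬ 1# + - z ≈ 0#
        z≉1 e = z^qp≉1 (one (q ℕ.* p))
          where
          one : ∀ k → z ^ k ≈ 1#
          one zero    = refl
          one (suc k) = trans (*-cong (sym (x-y≈0⇒x≈y _ _ e)) (one k)) (*-identityˡ 1#)

        -- If Ψ vanished, so would the right side of `Ψ₃-möbius`. Its factors are stripped off by
        -- cancellation, each being nonzero by an excluded exponent; 1 - z is nonzero because z = 1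
        -- would make z^(qp) equal to 1.
        Ψ≉0 : ¬ Ψ ≈ 0#
        Ψ≉0 Ψ≈0 = 1-z^ (r ℕ.* q) ≉0 z^rq≉1 (≈0-cancel product≈0
          (λ e → 1-z^ (r ℕ.* p) ≉0 z^rp≉1 (≈0-cancel e
            (λ e → 1-z^ (q ℕ.* p) ≉0 z^qp≉1 (≈0-cancel e z≉1)))))
          where
          product≈0 = trans (sym (proj₁ (Ψ₃-möbius pq pr qr)))
            (trans (*-congʳ (*-congʳ (*-congʳ Ψ≈0))) (solve 3 (λ a b c → :0 :* a :* b :* c := :0) refl _ _ _))

        -- Φ Ψ = 1 - zⁿ = 0, and Ψ cancels.
        Φ≈0 : Φ ≈ 0#
        Φ≈0 = ≈0-cancel (trans (*-comm Ψ Φ) (trans (proj₁ (Φ₃*Ψ₃ pq pr qr))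
          (trans (+-congˡ (-‿cong (trans (power₁ z (p ℕ.* q ℕ.* r)) z^pqr≈1))) (-‿inverseʳ 1#)))) Ψ≉0

        -- Differentiating Φ Ψ = 1 - xⁿ at a root of Φ gives Φ′ Ψ = - n zⁿ⁻¹.
        zΨΦ′ : z * Ψ * Φ′ ≈ - ((p ℕ.* q ℕ.* r) ∙ 1#)
        zΨΦ′ = begin
          z * Ψ * Φ′
            ≈⟨ solve 4 (λ z Ψ Φ′ Ψ′ → z :* Ψ :* Φ′ := z :* (:0 :* Ψ′ :+ Φ′ :* Ψ)) refl z Ψ Φ′ Ψ′ ⟩
          z * (0# * Ψ′ + Φ′ * Ψ)                            ≈⟨ *-congˡ (+-congʳ (*-congʳ (sym Φ≈0))) ⟩
          z * (Φ * Ψ′ + Φ′ * Ψ)                             ≈⟨ *-congˡ (proj₂ (Φ₃*Ψ₃ pq pr qr)) ⟩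
          z * (0# + - d)
            ≈⟨ solve 2 (λ z d → z :* (:0 :- d) := :- (z :* d)) refl z d ⟩
          - (z * d)                                         ≈⟨ -‿cong (power₂ z n) ⟩
          - (n ∙ z ^ n)                                     ≈⟨ -‿cong (×-congʳ n z^pqr≈1) ⟩
          - (n ∙ 1#)                                        ∎
          where
          n  = p ℕ.* q ℕ.* r
          d  = proj₂ ⟦ 𝕏 ↑ n ⟧
          Ψ′ = proj₂ ⟦ Ψ₃ ⟧

      module Lagrange {m}
        (degree : m ℕ.+ 1 ℕ.+ q ℕ.* p ℕ.+ r ℕ.* p ℕ.+ r ℕ.* q ≡ p ℕ.* q ℕ.* r ℕ.+ p ℕ.+ q ℕ.+ r)
        (p>0 : 0 ℕ.< p) (q>0 : 0 ℕ.< q) (r>0 : 0 ℕ.< r)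
        (ζ : Fin m → Carrier) (injective : ∀ {i j} → ζ i ≈ ζ j → i ≡ j)
        (ζ^pqr≈1 : ∀ i → ζ i ^ (p ℕ.* q ℕ.* r) ≈ 1#)
        (ζ^qp≉1 : ∀ i → ¬ ζ i ^ (q ℕ.* p) ≈ 1#)
        (ζ^rp≉1 : ∀ i → ¬ ζ i ^ (r ℕ.* p) ≈ 1#)
        (ζ^rq≉1 : ∀ i → ¬ ζ i ^ (r ℕ.* q) ≈ 1#) where

        private
          n = p ℕ.* q ℕ.* r
          module ζ i = Root (ζ i) (ζ^pqr≈1 i) (ζ^qp≉1 i) (ζ^rp≉1 i) (ζ^rq≉1 i)

          positive : ∃[ n′ ] n ≡ suc n′
          positive = ℕ.pred n , ≡.sym (ℕ.suc-pred n {{ℕ.>-nonZero (ℕ.*-mono-< (ℕ.*-mono-< p>0 q>0) r>0)}})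

          n′ = proj₁ positive
          1/n = proj₁ (reciprocal n′)

          n*1/n : n ∙ 1# * 1/n ≈ 1#
          n*1/n = trans (*-congʳ (reflexive (≡.cong (_∙ 1#) (proj₂ positive)))) (proj₂ (reciprocal n′))

          Φ-list Ψ-list : List Carrier
          Φ-list = coefficients Φ₃
          Ψ-list = coefficients Ψ₃

          Φ-degree : ∀ t → m ℕ.< t → coeff Φ-list t ≈ 0#
          Φ-degree = Degree≤-resp (λ t → sym (coeff-coefficients Φ₃ t))
            (degree-Φ₃ pq pr qr p>0 q>0 r>0 degree (Degree≤-resp (coeff-coefficients Φ₃) (coeff-degree Φ-list)))

          quotients : Fin m → Vec Carrier m
          quotients i = quotient (ζ i) (truncate (suc m) Φ-list)

          -- This is 1 / Φ′(ζᵢ), by `zΨΦ′`.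
          scale : Fin m → Carrier
          scale i = - (1/n * (ζ i * eval Ψ-list (ζ i)))

          Φᵛ≈0 : ∀ i → evalᵛ (truncate (suc m) Φ-list) (ζ i) ≈ 0#
          Φᵛ≈0 i = trans (evalᵛ-truncate (ζ i) {suc m} Φ-list Φ-degree)
            (trans (eval-coefficients (ζ i) Φ₃) (ζ.Φ≈0 i))

          -- On the diagonal the quotient takes the value Φ′(ζᵢ), which `scale` inverts. Off it, (ζᵢ
          -- - ζⱼ) times the quotient at ζᵢ is Φ(ζᵢ) - Φ(ζⱼ) = 0, and ζᵢ - ζⱼ cancels.
          scaled-quotients : ∀ i j → scale j * evalᵛ (quotients j) (ζ i) ≈ δ i j
          scaled-quotients i j with i Fin.≟ j
          ... | yes ≡.refl = begin
            - (1/n * (ζ i * eval Ψ-list (ζ i))) * evalᵛ (quotients i) (ζ i)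
              ≈⟨ *-cong (-‿cong (*-congˡ (*-congˡ (eval-coefficients (ζ i) Ψ₃))))
                   (trans (deriv-quotient (ζ i) Φ-list Φ-degree) (deriv-coefficients (ζ i) Φ₃)) ⟩
            - (1/n * (ζ i * ζ.Ψ i)) * ζ.Φ′ i
              ≈⟨ solve 4 (λ c z Ψ Φ′ → (:- (c :* (z :* Ψ))) :* Φ′ := :- (c :* (z :* Ψ :* Φ′))) refl 1/n (ζ i) _ _ ⟩
            - (1/n * (ζ i * ζ.Ψ i * ζ.Φ′ i))     ≈⟨ -‿cong (*-congˡ (ζ.zΨΦ′ i)) ⟩
            - (1/n * - (n ∙ 1#))
              ≈⟨ solve 2 (λ c n → :- (c :* (:- n)) := n :* c) refl 1/n (n ∙ 1#) ⟩
            n ∙ 1# * 1/n                         ≈⟨ n*1/n ⟩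
            1#                                   ∎
          ... | no i≢j = trans (*-congˡ (≈0-cancel (begin
            (ζ i + - ζ j) * evalᵛ (quotients j) (ζ i)
              ≈⟨ +-identityˡ _ ⟨
            0# + (ζ i + - ζ j) * evalᵛ (quotients j) (ζ i)
              ≈⟨ +-congʳ (Φᵛ≈0 j) ⟨
            evalᵛ (truncate (suc m) Φ-list) (ζ j) + (ζ i + - ζ j) * evalᵛ (quotients j) (ζ i)
              ≈⟨ quotient-eval (truncate (suc m) Φ-list) (ζ j) (ζ i) ⟨
            evalᵛ (truncate (suc m) Φ-list) (ζ i)
              ≈⟨ Φᵛ≈0 i ⟩
            0# ∎) λ e → i≢j (injective (x-y≈0⇒x≈y _ _ e)))) (zeroʳ _)

        inverseMatrix : Fin m → Fin m → Carrier
        inverseMatrix k j = scale j * lookup (quotients j) k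

        vandermonde*inverse : ∀ i j → sum (λ k → ζ i ^ toℕ k * inverseMatrix k j) ≈ δ i j
        vandermonde*inverse i j = begin
          sum (λ k → ζ i ^ toℕ k * (scale j * lookup (quotients j) k))
            ≈⟨ sum-cong-≋ {m} (λ k → solve 3 (λ z s c → z :* (s :* c) := s :* (z :* c)) refl (ζ i ^ toℕ k) (scale j) _) ⟩
          sum (λ k → scale j * (ζ i ^ toℕ k * lookup (quotients j) k))
            ≈⟨ *-distribˡ-sum (scale j) (λ k → ζ i ^ toℕ k * lookup (quotients j) k) ⟨
          scale j * sum (λ k → ζ i ^ toℕ k * lookup (quotients j) k)
            ≈⟨ *-congˡ (evalᵛ-sum (quotients j) (ζ i)) ⟨
          scale j * evalᵛ (quotients j) (ζ i)
            ≈⟨ scaled-quotients i j ⟩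
          δ i j ∎

        -- Each column of W V - 1 is the coefficient vector of a polynomial vanishing at all ζᵢ, because V W V = V.
        inverse*vandermonde : ∀ k l → sum (λ i → inverseMatrix k i * ζ i ^ toℕ l) ≈ δ k l
        inverse*vandermonde k l = x-y≈0⇒x≈y _ _ (trans (reflexive (≡.sym (lookup∘tabulate column k)))
          (vanishing ≈0-cancel (tabulate column) ζ injective column≈0 k))
          where
          WV : Fin m → Carrier
          WV k = sum (λ i → inverseMatrix k i * ζ i ^ toℕ l)
          column : Fin m → Carrier
          column k = WV k + - δ k l
          VWV : ∀ t → sum (λ k → ζ t ^ toℕ k * WV k) ≈ ζ t ^ toℕ l
          VWV t = begin
            sum (λ k → ζ t ^ toℕ k * WV k)
              ≈⟨ sum-cong-≋ {m} (λ k → trans (*-distribˡ-sum (ζ t ^ toℕ k) (λ i → inverseMatrix k i * ζ i ^ toℕ l))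
                   (sum-cong-≋ {m} λ i → sym (*-assoc (ζ t ^ toℕ k) (inverseMatrix k i) (ζ i ^ toℕ l)))) ⟩
            sum (λ k → sum (λ i → ζ t ^ toℕ k * inverseMatrix k i * ζ i ^ toℕ l))
              ≈⟨ ∑-comm (λ k i → ζ t ^ toℕ k * inverseMatrix k i * ζ i ^ toℕ l) ⟩
            sum (λ i → sum (λ k → ζ t ^ toℕ k * inverseMatrix k i * ζ i ^ toℕ l))
              ≈⟨ sum-cong-≋ {m} (λ i → trans (sym (*-distribʳ-sum (ζ i ^ toℕ l) (λ k → ζ t ^ toℕ k * inverseMatrix k i)))
                   (*-congʳ (vandermonde*inverse t i))) ⟩
            sum (λ i → δ t i * ζ i ^ toℕ l)
              ≈⟨ sum-δˡ (λ i → ζ i ^ toℕ l) t ⟩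
            ζ t ^ toℕ l ∎
          column≈0 : ∀ t → evalᵛ (tabulate column) (ζ t) ≈ 0#
          column≈0 t = begin
            evalᵛ (tabulate column) (ζ t)
              ≈⟨ evalᵛ-sum (tabulate column) (ζ t) ⟩
            sum (λ k → ζ t ^ toℕ k * lookup (tabulate column) k)
              ≈⟨ sum-cong-≋ {m} (λ k → trans (*-congˡ (reflexive (lookup∘tabulate column k)))
                   (solve 3 (λ z w d → z :* (w :- d) := z :* w :+ (:- z) :* d) refl (ζ t ^ toℕ k) (WV k) (δ k l))) ⟩
            sum (λ k → ζ t ^ toℕ k * WV k + - (ζ t ^ toℕ k) * δ k l)
              ≈⟨ ∑-distrib-+ (λ k → ζ t ^ toℕ k * WV k) (λ k → - (ζ t ^ toℕ k) * δ k l) ⟩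
            sum (λ k → ζ t ^ toℕ k * WV k) + sum (λ k → - (ζ t ^ toℕ k) * δ k l)
              ≈⟨ +-cong (VWV t) (sum-δʳ (λ k → - (ζ t ^ toℕ k)) l) ⟩
            ζ t ^ toℕ l + - (ζ t ^ toℕ l)
              ≈⟨ -‿inverseʳ _ ⟩
            0# ∎

        ∣ζ∣≤1 : ∀ i → ∣ ζ i ∣≤ 1
        ∣ζ∣≤1 i = ∣root∣≤1 (ζ i) n′ (trans (reflexive (≡.cong (ζ i ^_) (≡.sym (proj₂ positive)))) (ζ^pqr≈1 i))

        ∣ζ^∣≤1 : ∀ i k → ∣ ζ i ^ k ∣≤ 1
        ∣ζ^∣≤1 i zero    = ∣1∣≤1
        ∣ζ^∣≤1 i (suc k) = ∣∣≤-* {B = 1} {1} (∣ζ∣≤1 i) (∣ζ^∣≤1 i k)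

        -- Bounds are natural numbers, so ∣1/n∣ would be rounded up to 1. The estimate is therefore
        -- made for n times the entry, where 1/n has disappeared, and n is cancelled from both sides
        -- at the end.
        inverseMatrix-≤ : ∀ B → 4 ℕ.* (p ℕ.* p ℕ.* q ℕ.* (p ℕ.+ q)) ℕ.≤ B → ∀ k j → ∣ inverseMatrix k j ∣≤ 2 ℕ.* B
        inverseMatrix-≤ B h k j = ∣∣≤-cancel n′ (∣∣≤-resp (sym clear)
          (∣∣≤-mono (ℕ.≤-trans (norm-Ψ₃*Φ₃ pq pr qr B h) (ℕ.≤-reflexive (≡.cong (ℕ._* (2 ℕ.* B)) (proj₂ positive))))
            (∣∣≤-* (∣∣≤-neg (∣∣≤-* (∣ζ∣≤1 j) (eval-≤ (∣ζ∣≤1 j) (coefficients-≤₁ Ψ₃))))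
                   (quotient-≤ (∣ζ∣≤1 j) m (coefficients-≤₁ Φ₃) k))))
          where
          clear : suc n′ ∙ 1# * inverseMatrix k j ≈ - (ζ j * eval Ψ-list (ζ j)) * lookup (quotients j) k
          clear = begin
            suc n′ ∙ 1# * (- (1/n * (ζ j * eval Ψ-list (ζ j))) * lookup (quotients j) k)
              ≈⟨ solve 4 (λ n c u w → n :* ((:- (c :* u)) :* w) := n :* c :* ((:- u) :* w)) refl (suc n′ ∙ 1#) 1/n _ _ ⟩
            suc n′ ∙ 1# * 1/n * (- (ζ j * eval Ψ-list (ζ j)) * lookup (quotients j) k)
              ≈⟨ trans (*-congʳ (proj₂ (reciprocal n′))) (*-identityˡ _) ⟩
            - (ζ j * eval Ψ-list (ζ j)) * lookup (quotients j) k ∎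

        boundedInverse : ∀ B → 4 ℕ.* (p ℕ.* p ℕ.* q ℕ.* (p ℕ.+ q)) ℕ.≤ B → BoundedInverse ζ (2 ℕ.* B)
        boundedInverse B h = record
          { inverse             = inverseMatrix
          ; vandermonde*inverse = vandermonde*inverse
          ; inverse*vandermonde = inverse*vandermonde
          ; ∣vandermonde∣≤1     = ∣ζ^∣≤1
          ; ∣inverse∣≤B         = inverseMatrix-≤ B h
          }

-- Complex numbers and the Frobenius norm over an abstract real field.

module RealFields where
  open CyclotomicPolynomials
  open NormedFields
  open import Data.Nat.Base as ℕ using (ℕ; zero; suc)
  import Data.Nat.Properties as ℕ
  open import Data.Product.Base using (_×_; _,_; proj₁; proj₂; ∃-syntax)
  open import Data.Fin.Base using (Fin; zero; suc)
  open import Level using (0ℓ)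
  open import Relation.Binary.PropositionalEquality as ≡ using (_≡_)
  open import Relation.Nullary using (¬_)

  complexNumbers : ∀ {c ℓ} → CommutativeRing c ℓ → CommutativeRing c ℓ
  complexNumbers R = record
    { Carrier = Carrier × Carrier
    ; _≈_ = λ (a , a′) (b , b′) → a ≈ b × a′ ≈ b′
    ; _+_ = λ (a , a′) (b , b′) → a + b , a′ + b′
    ; _*_ = λ (a , a′) (b , b′) → a * b + - (a′ * b′) , a * b′ + a′ * b
    ; -_ = λ (a , a′) → - a , - a′
    ; 0# = 0# , 0#
    ; 1# = 1# , 0#
    ; isCommutativeRing = record
      { isRing = record
        { +-isAbelianGroup = AbelianGroup.isAbelianGroup (abelianGroup +-abelianGroup +-abelianGroup)
        ; *-cong = λ (e , f) (g , h) → +-cong (*-cong e g) (-‿cong (*-cong f h)) , +-cong (*-cong e h) (*-cong f g)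
        ; *-assoc = λ (a , a′) (b , b′) (c , c′) →
            R.solve 6 (λ a a′ b b′ c c′ →
              (a R.:* b R.:- a′ R.:* b′) R.:* c R.:- (a R.:* b′ R.:+ a′ R.:* b) R.:* c′ R.:=
              a R.:* (b R.:* c R.:- b′ R.:* c′) R.:- a′ R.:* (b R.:* c′ R.:+ b′ R.:* c)) refl a a′ b b′ c c′ ,
            R.solve 6 (λ a a′ b b′ c c′ →
              (a R.:* b R.:- a′ R.:* b′) R.:* c′ R.:+ (a R.:* b′ R.:+ a′ R.:* b) R.:* c R.:=
              a R.:* (b R.:* c′ R.:+ b′ R.:* c) R.:+ a′ R.:* (b R.:* c R.:- b′ R.:* c′)) refl a a′ b b′ c c′
        ; *-identity =
              (λ (a , a′) → R.solve 2 (λ a a′ → R.:1 R.:* a R.:- R.:0 R.:* a′ R.:= a) refl a a′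
                          , R.solve 2 (λ a a′ → R.:1 R.:* a′ R.:+ R.:0 R.:* a R.:= a′) refl a a′)
            , (λ (a , a′) → R.solve 2 (λ a a′ → a R.:* R.:1 R.:- a′ R.:* R.:0 R.:= a) refl a a′
                          , R.solve 2 (λ a a′ → a R.:* R.:0 R.:+ a′ R.:* R.:1 R.:= a′) refl a a′)
        ; distrib =
              (λ (a , a′) (b , b′) (c , c′) →
                R.solve 6 (λ a a′ b b′ c c′ → a R.:* (b R.:+ c) R.:- a′ R.:* (b′ R.:+ c′) R.:=
                  (a R.:* b R.:- a′ R.:* b′) R.:+ (a R.:* c R.:- a′ R.:* c′)) refl a a′ b b′ c c′ ,
                R.solve 6 (λ a a′ b b′ c c′ → a R.:* (b′ R.:+ c′) R.:+ a′ R.:* (b R.:+ c) R.:=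
                  (a R.:* b′ R.:+ a′ R.:* b) R.:+ (a R.:* c′ R.:+ a′ R.:* c)) refl a a′ b b′ c c′)
            , (λ (a , a′) (b , b′) (c , c′) →
                R.solve 6 (λ a a′ b b′ c c′ → (b R.:+ c) R.:* a R.:- (b′ R.:+ c′) R.:* a′ R.:=
                  (b R.:* a R.:- b′ R.:* a′) R.:+ (c R.:* a R.:- c′ R.:* a′)) refl a a′ b b′ c c′ ,
                R.solve 6 (λ a a′ b b′ c c′ → (b R.:+ c) R.:* a′ R.:+ (b′ R.:+ c′) R.:* a R.:=
                  (b R.:* a′ R.:+ b′ R.:* a) R.:+ (c R.:* a′ R.:+ c′ R.:* a)) refl a a′ b b′ c c′) }
      ; *-comm = λ (a , a′) (b , b′) →
          R.solve 4 (λ a a′ b b′ → a R.:* b R.:- a′ R.:* b′ R.:= b R.:* a R.:- b′ R.:* a′) refl a a′ b b′ ,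
          R.solve 4 (λ a a′ b b′ → a R.:* b′ R.:+ a′ R.:* b R.:= b R.:* a′ R.:+ b′ R.:* a) refl a a′ b b′ } }
    where
    open CommutativeRing R
    module R = IntegerSolver R
    open import Algebra.Construct.DirectProduct using (abelianGroup)
    open import Algebra.Bundles using (AbelianGroup)

  -- The order of constructive reals cannot be decided, so no totality is assumed. `square-cancel`
  -- takes over the work of case distinctions on signs and of monotone square roots.
  record RealField : Set₁ where
    infix 4 _≤_
    infix 9 √_
    field
      ring : CommutativeRing 0ℓ 0ℓ
    open CommutativeRing ring public hiding (zero; ring)
    field
      _≤_           : Carrier → Carrier → Set
      √_            : Carrier → Carrier
      fromℕ         : ℕ → Carrier
      ≤-reflexive   : ∀ {x y} → x ≈ y → x ≤ y
      ≤-trans       : ∀ {x y z} → x ≤ y → y ≤ z → x ≤ z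
      ≤-antisym     : ∀ {x y} → x ≤ y → y ≤ x → x ≈ y
      +-mono-≤      : ∀ {x x′ y y′} → x ≤ x′ → y ≤ y′ → x + y ≤ x′ + y′
      0≤-*          : ∀ {x y} → 0# ≤ x → 0# ≤ y → 0# ≤ x * y
      0≤x*x         : ∀ x → 0# ≤ x * x
      square-cancel : ∀ {x y} → 0# ≤ y → x * x ≤ y * y → x ≤ y
      1≰0           : ¬ 1# ≤ 0#
      ≈0-cancel     : ∀ {x y} → x * y ≈ 0# → ¬ x ≈ 0# → y ≈ 0#
      fromℕ-zero    : fromℕ 0 ≈ 0#
      fromℕ-suc     : ∀ n → fromℕ (suc n) ≈ 1# + fromℕ n
      reciprocal    : ∀ n → ∃[ c ] fromℕ (suc n) * c ≈ 1#
      √-nonNeg      : ∀ x → 0# ≤ √ x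
      √-square      : ∀ {x} → 0# ≤ x → √ x * √ x ≈ x

  module Ordered (F : RealField) where
    open RealField F
    open IntegerSolver ring
    open import Algebra.Definitions.RawMonoid +-rawMonoid using (sum)

    ≤-resp-≈ : ∀ {x x′ y y′} → x ≈ x′ → y ≈ y′ → x ≤ y → x′ ≤ y′
    ≤-resp-≈ e f h = ≤-trans (≤-reflexive (sym e)) (≤-trans h (≤-reflexive f))

    ≤-refl : ∀ {x} → x ≤ x
    ≤-refl = ≤-reflexive refl

    ≤⇒0≤- : ∀ {x y} → x ≤ y → 0# ≤ y + - x
    ≤⇒0≤- {x} {y} h = ≤-resp-≈ (-‿inverseʳ x) refl (+-mono-≤ h (≤-refl { - x}))

    0≤-⇒≤ : ∀ {x y} → 0# ≤ y + - x → x ≤ y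
    0≤-⇒≤ {x} {y} h = ≤-resp-≈ (+-identityˡ x) (solve 2 (λ x y → y :- x :+ x := y) refl x y) (+-mono-≤ h ≤-refl)

    0≤-+ : ∀ {x y} → 0# ≤ x → 0# ≤ y → 0# ≤ x + y
    0≤-+ h k = ≤-resp-≈ (+-identityˡ 0#) refl (+-mono-≤ h k)

    0≤1 : 0# ≤ 1#
    0≤1 = ≤-resp-≈ refl (*-identityˡ 1#) (0≤x*x 1#)

    x≤x+y : ∀ {x y} → 0# ≤ y → x ≤ x + y
    x≤x+y {x} h = ≤-resp-≈ (+-identityʳ x) refl (+-mono-≤ ≤-refl h)

    *-monoˡ-≤ : ∀ {x y z} → 0# ≤ z → x ≤ y → z * x ≤ z * y
    *-monoˡ-≤ {x} {y} {z} z≥0 h = 0≤-⇒≤ (≤-resp-≈ refl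
      (solve 3 (λ x y z → z :* (y :- x) := z :* y :- z :* x) refl x y z) (0≤-* z≥0 (≤⇒0≤- h)))

    *-mono-≤ : ∀ {x x′ y y′} → 0# ≤ x → 0# ≤ y′ → x ≤ x′ → y ≤ y′ → x * y ≤ x′ * y′
    *-mono-≤ {x} {x′} {y} {y′} x≥0 y′≥0 h k = ≤-trans (*-monoˡ-≤ x≥0 k)
      (≤-resp-≈ (*-comm y′ x) (*-comm y′ x′) (*-monoˡ-≤ y′≥0 h))

    -- x² ≤ x² + y² = 0², and `square-cancel` applies to x as well as to -x.
    square-zero : ∀ {x y} → x * x + y * y ≈ 0# → x ≈ 0#
    square-zero {x} {y} e = ≤-antisym x≤0 (≤-resp-≈ refl (solve 1 (λ x → :0 :- :- x := x) refl x) (≤⇒0≤- -x≤0))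
      where
      xx≤0 : x * x ≤ 0# * 0#
      xx≤0 = ≤-trans (x≤x+y (0≤x*x y)) (≤-reflexive (trans e (sym (zeroˡ 0#))))
      x≤0 : x ≤ 0#
      x≤0 = square-cancel ≤-refl xx≤0
      -x≤0 : - x ≤ 0#
      -x≤0 = square-cancel ≤-refl (≤-trans (≤-reflexive (solve 1 (λ x → :- x :* (:- x) := x :* x) refl x)) xx≤0)

    fromℕ-+ : ∀ m n → fromℕ (m ℕ.+ n) ≈ fromℕ m + fromℕ n
    fromℕ-+ zero    n = sym (trans (+-congʳ fromℕ-zero) (+-identityˡ _))
    fromℕ-+ (suc m) n = trans (fromℕ-suc (m ℕ.+ n)) (trans (+-congˡ (fromℕ-+ m n))
      (trans (sym (+-assoc 1# _ _)) (+-congʳ (sym (fromℕ-suc m)))))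

    fromℕ-* : ∀ m n → fromℕ (m ℕ.* n) ≈ fromℕ m * fromℕ n
    fromℕ-* zero    n = trans fromℕ-zero (sym (trans (*-congʳ fromℕ-zero) (zeroˡ _)))
    fromℕ-* (suc m) n = trans (fromℕ-+ n (m ℕ.* n)) (trans (+-congˡ (fromℕ-* m n))
      (trans (solve 2 (λ m n → n :+ m :* n := (:1 :+ m) :* n) refl (fromℕ m) (fromℕ n)) (*-congʳ (sym (fromℕ-suc m)))))

    fromℕ-1 : fromℕ 1 ≈ 1#
    fromℕ-1 = trans (fromℕ-suc 0) (trans (+-congˡ fromℕ-zero) (+-identityʳ 1#))

    fromℕ-nonNeg : ∀ n → 0# ≤ fromℕ n
    fromℕ-nonNeg zero    = ≤-reflexive (sym fromℕ-zero)
    fromℕ-nonNeg (suc n) = ≤-resp-≈ refl (sym (fromℕ-suc n)) (0≤-+ 0≤1 (fromℕ-nonNeg n))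

    fromℕ-mono : ∀ {m n} → m ℕ.≤ n → fromℕ m ≤ fromℕ n
    fromℕ-mono {m} {n} m≤n = ≤-resp-≈ refl
      (trans (sym (fromℕ-+ m (n ℕ.∸ m))) (reflexive (≡.cong fromℕ (ℕ.m+[n∸m]≡n m≤n)))) (x≤x+y (fromℕ-nonNeg (n ℕ.∸ m)))

    √-≤ : ∀ {x y} → 0# ≤ x → 0# ≤ y → x ≤ y * y → √ x ≤ y
    √-≤ x≥0 y≥0 h = square-cancel y≥0 (≤-trans (≤-reflexive (√-square x≥0)) h)

    sum-nonNeg : ∀ {m} (f : Fin m → Carrier) → (∀ i → 0# ≤ f i) → 0# ≤ sum f
    sum-nonNeg {zero}  f h = ≤-refl
    sum-nonNeg {suc m} f h = 0≤-+ (h zero) (sum-nonNeg (λ i → f (suc i)) λ i → h (suc i))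

    sum-≤ : ∀ {m} (f : Fin m → Carrier) B → (∀ i → f i ≤ fromℕ B) → sum f ≤ fromℕ (m ℕ.* B)
    sum-≤ {zero}  f B h = ≤-reflexive (sym fromℕ-zero)
    sum-≤ {suc m} f B h = ≤-resp-≈ refl (sym (fromℕ-+ B (m ℕ.* B)))
      (+-mono-≤ (h zero) (sum-≤ (λ i → f (suc i)) B λ i → h (suc i)))

    infix 9 ∣_∣²

    ℂ : CommutativeRing 0ℓ 0ℓ
    ℂ = complexNumbers ring
    module ℂ = CommutativeRing ℂ

    ∣_∣² : ℂ.Carrier → Carrier
    ∣ a , b ∣² = a * a + b * b

    ∣∣²-nonNeg : ∀ z → 0# ≤ ∣ z ∣²
    ∣∣²-nonNeg (a , b) = 0≤-+ (0≤x*x a) (0≤x*x b)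

    ∣∣²-cong : ∀ {z w} → z ℂ.≈ w → ∣ z ∣² ≈ ∣ w ∣²
    ∣∣²-cong (e , f) = +-cong (*-cong e e) (*-cong f f)

    ∣∣²-* : ∀ z w → ∣ z ℂ.* w ∣² ≈ ∣ z ∣² * ∣ w ∣²
    ∣∣²-* (a , b) (c , d) = solve 4 (λ a b c d →
      (a :* c :- b :* d) :* (a :* c :- b :* d) :+ (a :* d :+ b :* c) :* (a :* d :+ b :* c) :=
      (a :* a :+ b :* b) :* (c :* c :+ d :* d)) refl a b c d

    ∣0∣² : ∣ ℂ.0# ∣² ≈ 0#
    ∣0∣² = solve 0 (:0 :* :0 :+ :0 :* :0 := :0) refl

    ∣1∣² : ∣ ℂ.1# ∣² ≈ 1#
    ∣1∣² = solve 0 (:1 :* :1 :+ :0 :* :0 := :1) refl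

    -- Multiplicativity of ∣z∣² reduces this to cancellation of reals; `square-zero` passes between
    -- z ≈ 0 and ∣z∣² ≈ 0.
    ≈0-cancelᶜ : ∀ {z w} → z ℂ.* w ℂ.≈ ℂ.0# → ¬ z ℂ.≈ ℂ.0# → w ℂ.≈ ℂ.0#
    ≈0-cancelᶜ {z@(a , b)} {w@(c , d)} e z≉0 = square-zero ∣w∣²≈0 , square-zero (trans (+-comm _ _) ∣w∣²≈0)
      where
      ∣w∣²≈0 : ∣ w ∣² ≈ 0#
      ∣w∣²≈0 = ≈0-cancel (trans (sym (∣∣²-* z w)) (trans (∣∣²-cong e) ∣0∣²))
        λ e′ → z≉0 (square-zero e′ , square-zero (trans (+-comm _ _) e′))

    infix 4 ∣_∣≤_

    -- Squaring keeps square roots out of all estimates that precede the Frobenius norm.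
    record ∣_∣≤_ (z : ℂ.Carrier) (B : ℕ) : Set where
      constructor mk
      field ∣z∣²≤B² : ∣ z ∣² ≤ fromℕ B * fromℕ B
    open ∣_∣≤_ public

    ∣∣≤-resp : ∀ {z w B} → z ℂ.≈ w → ∣ z ∣≤ B → ∣ w ∣≤ B
    ∣∣≤-resp e (mk h) = mk (≤-resp-≈ (∣∣²-cong e) refl h)

    ∣∣≤-mono : ∀ {z B C} → B ℕ.≤ C → ∣ z ∣≤ B → ∣ z ∣≤ C
    ∣∣≤-mono {z} {B} {C} B≤C (mk h) =
      mk (≤-trans h (*-mono-≤ (fromℕ-nonNeg B) (fromℕ-nonNeg C) (fromℕ-mono B≤C) (fromℕ-mono B≤C)))

    ∣0∣≤ : ∀ {B} → ∣ ℂ.0# ∣≤ B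
    ∣0∣≤ {B} = mk (≤-resp-≈ (sym ∣0∣²) refl (0≤x*x (fromℕ B)))

    ∣∣²≈1⇒∣∣≤1 : ∀ {z} → ∣ z ∣² ≈ 1# → ∣ z ∣≤ 1
    ∣∣²≈1⇒∣∣≤1 e = mk (≤-reflexive (trans e (sym (trans (*-cong fromℕ-1 fromℕ-1) (*-identityˡ 1#)))))

    ∣∣≤-neg : ∀ {z B} → ∣ z ∣≤ B → ∣ ℂ.- z ∣≤ B
    ∣∣≤-neg {a , b} (mk h) =
      mk (≤-resp-≈ (solve 2 (λ a b → a :* a :+ b :* b := :- a :* (:- a) :+ :- b :* (:- b)) refl a b) refl h)

    ∣∣≤-* : ∀ {z w B C} → ∣ z ∣≤ B → ∣ w ∣≤ C → ∣ z ℂ.* w ∣≤ B ℕ.* C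
    ∣∣≤-* {z} {w} {B} {C} (mk h) (mk k) = mk (≤-resp-≈ (sym (∣∣²-* z w))
      (trans (solve 2 (λ b c → b :* b :* (c :* c) := b :* c :* (b :* c)) refl (fromℕ B) (fromℕ C))
             (sym (*-cong (fromℕ-* B C) (fromℕ-* B C))))
      (*-mono-≤ (∣∣²-nonNeg z) (0≤x*x (fromℕ C)) h k))

    -- Cauchy-Schwarz, (ac + bd)² ≤ (a² + b²)(c² + d²), bounds the cross term.
    ∣∣≤-+ : ∀ {z w B C} → ∣ z ∣≤ B → ∣ w ∣≤ C → ∣ z ℂ.+ w ∣≤ B ℕ.+ C
    ∣∣≤-+ {z@(a , b)} {w@(c , d)} {B} {C} (mk h) (mk k) = mk (≤-resp-≈
      (solve 4 (λ a b c d → (a :* a :+ b :* b) :+ (c :* c :+ d :* d) :+ ((a :* c :+ b :* d) :+ (a :* c :+ b :* d)) :=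
                            (a :+ c) :* (a :+ c) :+ (b :+ d) :* (b :+ d)) refl a b c d)
      (trans (solve 2 (λ b c → b :* b :+ c :* c :+ (b :* c :+ b :* c) := (b :+ c) :* (b :+ c)) refl (fromℕ B) (fromℕ C))
             (sym (*-cong (fromℕ-+ B C) (fromℕ-+ B C))))
      (+-mono-≤ (+-mono-≤ h k) (+-mono-≤ cross cross)))
      where
      cross : a * c + b * d ≤ fromℕ B * fromℕ C
      cross = square-cancel (0≤-* (fromℕ-nonNeg B) (fromℕ-nonNeg C))
        (≤-trans (≤-resp-≈ refl
          (solve 4 (λ a b c d → (a :* c :+ b :* d) :* (a :* c :+ b :* d) :+ (a :* d :- b :* c) :* (a :* d :- b :* c) :=
                                (a :* a :+ b :* b) :* (c :* c :+ d :* d)) refl a b c d)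
          (x≤x+y (0≤x*x (a * d + - (b * c)))))
        (≤-resp-≈ refl (solve 2 (λ b c → b :* b :* (c :* c) := b :* c :* (b :* c)) refl (fromℕ B) (fromℕ C))
          (*-mono-≤ (∣∣²-nonNeg z) (0≤x*x (fromℕ C)) h k)))

    fromℕᶜ : ℕ → ℂ.Carrier
    fromℕᶜ n = fromℕ n , 0#

    -- The squared inequality is multiplied by the square of 1 / (n + 1).
    ∣∣≤-cancel : ∀ n {z B} → ∣ fromℕᶜ (suc n) ℂ.* z ∣≤ suc n ℕ.* B → ∣ z ∣≤ B
    ∣∣≤-cancel n {z@(a , b)} {B} (mk h) with reciprocal n
    ... | c , nc≈1 = mk (≤-resp-≈
      (trans (solve 4 (λ a b c n → c :* c :* ((n :* a :- :0 :* b) :* (n :* a :- :0 :* b) :+ (n :* b :+ :0 :* a) :* (n :* b :+ :0 :* a)) :=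
                                   (n :* c) :* (n :* c) :* (a :* a :+ b :* b)) refl a b c (fromℕ (suc n))) unit)
      (trans (*-congˡ (*-cong (fromℕ-* (suc n) B) (fromℕ-* (suc n) B)))
        (trans (solve 3 (λ b c n → c :* c :* (n :* b :* (n :* b)) := (n :* c) :* (n :* c) :* (b :* b)) refl (fromℕ B) c (fromℕ (suc n)))
             unit))
      (*-monoˡ-≤ (0≤x*x c) h))
      where
      unit : ∀ {x} → (fromℕ (suc n) * c) * (fromℕ (suc n) * c) * x ≈ x
      unit = trans (*-congʳ (trans (*-cong nc≈1 nc≈1) (*-identityˡ 1#))) (*-identityˡ _)

    reciprocalᶜ : ∀ n → ∃[ c ] fromℕᶜ (suc n) ℂ.* c ℂ.≈ ℂ.1#
    reciprocalᶜ n with reciprocal n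
    ... | c , nc≈1 = (c , 0#) ,
      trans (solve 2 (λ n c → n :* c :- :0 :* :0 := n :* c) refl (fromℕ (suc n)) c) nc≈1 ,
      solve 2 (λ n c → n :* :0 :+ :0 :* c := :0) refl (fromℕ (suc n)) c

    open import Algebra.Properties.Semiring.Exp semiring using (_^_)
    open import Algebra.Properties.Semiring.Exp ℂ.semiring using () renaming (_^_ to _^ᶜ_)

    ∣∣²-^ : ∀ z n → ∣ z ^ᶜ n ∣² ≈ ∣ z ∣² ^ n
    ∣∣²-^ z zero    = ∣1∣²
    ∣∣²-^ z (suc n) = trans (∣∣²-* z (z ^ᶜ n)) (*-congˡ (∣∣²-^ z n))

    -- t = |z|² satisfies (1 + t + ⋯ + tⁿ⁻¹) (1 - t) = 1 - tⁿ = 0, and the first factor is at least 1.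
    rootOfUnity⇒∣∣²≈1 : ∀ z n → z ^ᶜ suc n ℂ.≈ ℂ.1# → ∣ z ∣² ≈ 1#
    rootOfUnity⇒∣∣²≈1 z n e = trans (solve 1 (λ t → t := :1 :- (:1 :- t)) refl t)
      (trans (+-congˡ (-‿cong 1-t≈0)) (solve 0 (:1 :- :0 := :1) refl))
      where
      t = ∣ z ∣²
      open Evaluation ring t
      t^n≈1 : ⟦ 𝕏 ↑ suc n ⟧ ≈ 1#
      t^n≈1 = trans (reflexive (⟦↑⟧ 𝕏 (suc n))) (trans (sym (∣∣²-^ z (suc n))) (trans (∣∣²-cong e) ∣1∣²))
      geom≥0 : ∀ k → 0# ≤ ⟦ geom k 𝕏 ⟧
      geom≥0 zero    = ≤-refl
      geom≥0 (suc k) = 0≤-+ 0≤1 (0≤-* (∣∣²-nonNeg z) (geom≥0 k))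
      1-t≈0 : 1# + - t ≈ 0#
      1-t≈0 = ≈0-cancel
        (trans (*-comm _ _) (trans (telescope (suc n) 𝕏) (trans (+-congˡ (-‿cong t^n≈1)) (-‿inverseʳ 1#))))
        λ geom≈0 → 1≰0 (≤-trans (x≤x+y (0≤-* (∣∣²-nonNeg z) (geom≥0 n))) (≤-reflexive geom≈0))

  module Complex (F : RealField) where
    open RealField F
    open Ordered F
    open import Algebra.Definitions.RawMonoid +-rawMonoid using (sum)
    open import Algebra.Definitions.RawMonoid ℂ.+-rawMonoid using () renaming (_×_ to _∙ᶜ_)

    fromℕᶜ-∙ : ∀ n → fromℕᶜ n ℂ.≈ n ∙ᶜ ℂ.1#
    fromℕᶜ-∙ zero    = fromℕ-zero , refl
    fromℕᶜ-∙ (suc n) = trans (fromℕ-suc n) (+-congˡ (proj₁ (fromℕᶜ-∙ n)))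
                     , trans (proj₂ (fromℕᶜ-∙ n)) (sym (+-identityˡ _))

    normedField : NormedField
    normedField = record
      { ring       = ℂ
      ; ∣_∣≤_      = ∣_∣≤_
      ; ≈0-cancel  = λ {x} {y} → ≈0-cancelᶜ {x} {y}
      ; reciprocal = λ n → let c , e = reciprocalᶜ n in
          c , ℂ.trans (ℂ.*-congʳ {c} (ℂ.sym (fromℕᶜ-∙ (suc n)))) e
      ; ∣∣≤-resp   = λ {x} {y} → ∣∣≤-resp {x} {y}
      ; ∣∣≤-mono   = λ {x} → ∣∣≤-mono {x}
      ; ∣0∣≤       = ∣0∣≤
      ; ∣1∣≤1      = ∣∣²≈1⇒∣∣≤1 {ℂ.1#} ∣1∣²
      ; ∣∣≤-neg    = λ {x} → ∣∣≤-neg {x}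
      ; ∣∣≤-+      = λ {x} {y} → ∣∣≤-+ {x} {y}
      ; ∣∣≤-*      = λ {x} {y} → ∣∣≤-* {x} {y}
      ; ∣∣≤-cancel = λ n {x} {B} h → ∣∣≤-cancel n {x}
          (∣∣≤-resp {suc n ∙ᶜ ℂ.1# ℂ.* x} {fromℕᶜ (suc n) ℂ.* x} (ℂ.*-congʳ {x} (ℂ.sym (fromℕᶜ-∙ (suc n)))) h)
      ; ∣root∣≤1   = λ x n e → ∣∣²≈1⇒∣∣≤1 {x} (rootOfUnity⇒∣∣²≈1 x n e)
      }

    frobenius : ∀ {m} → (Fin m → Fin m → ℂ.Carrier) → Carrier
    frobenius {m} a = √ sum {m} (λ i → sum {m} λ j → √ ∣ a i j ∣² * √ ∣ a i j ∣²)

    frobenius-≤ : ∀ {m} (a : Fin m → Fin m → ℂ.Carrier) B → (∀ i j → ∣ a i j ∣≤ B) → frobenius a ≤ fromℕ (m ℕ.* B)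
    frobenius-≤ {m} a B h = √-≤
      (sum-nonNeg {m} _ λ i → sum-nonNeg {m} _ λ j → 0≤x*x _)
      (fromℕ-nonNeg (m ℕ.* B))
      (≤-resp-≈ refl (trans (reflexive (≡.cong fromℕ (rearrange m B))) (fromℕ-* (m ℕ.* B) (m ℕ.* B)))
        (sum-≤ {m} _ (m ℕ.* (B ℕ.* B)) λ i → sum-≤ {m} _ (B ℕ.* B) λ j →
          ≤-resp-≈ (sym (√-square (∣∣²-nonNeg (a i j)))) (sym (fromℕ-* B B)) (∣z∣²≤B² (h i j))))
      where
      import Relation.Binary.PropositionalEquality as ≡
      open import Data.Nat.Solver using (module +-*-Solver)
      open +-*-Solver using (solve; _:*_; _:=_)
      rearrange : ∀ m B → m ℕ.* (m ℕ.* (B ℕ.* B)) ≡.≡ m ℕ.* B ℕ.* (m ℕ.* B)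
      rearrange = solve 2 (λ m B → m :* (m :* (B :* B)) := m :* B :* (m :* B)) ≡.refl

    frobenius-*-≤ : ∀ {m} (a b : Fin m → Fin m → ℂ.Carrier) B C → (∀ i j → ∣ a i j ∣≤ B) → (∀ i j → ∣ b i j ∣≤ C) →
                    frobenius a * frobenius b ≤ fromℕ (m ℕ.* B ℕ.* (m ℕ.* C))
    frobenius-*-≤ {m} a b B C ha hb = ≤-resp-≈ refl (sym (fromℕ-* (m ℕ.* B) (m ℕ.* C)))
      (*-mono-≤ (√-nonNeg _) (fromℕ-nonNeg (m ℕ.* C)) (frobenius-≤ a B ha) (frobenius-≤ b C hb))

-- Cauchy sequences satisfy the axioms of a real field.

module Reals where
  open import Defs
  open import Data.Nat.Base as ℕ using (ℕ; suc)
  import Data.Nat.Properties as ℕ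
  open import Data.Product.Base using (_,_; proj₁; proj₂; ∃-syntax)
  open import Data.Rational.Base as ℚ using (ℚ; 0ℚ; 1ℚ; ½; ∣_∣; nonNegative)
  import Data.Rational.Properties as ℚ
  open import Data.Rational.Solver using (module +-*-Solver)
  open import Data.Sum.Base using (inj₁; inj₂)
  open import Level using (0ℓ)
  open import Relation.Binary.PropositionalEquality as ≡ using (_≡_)
  open import Relation.Nullary using (Dec; ¬_; yes; no; contradiction)
  open +-*-Solver using (solve; _:+_; _:*_; _:-_; :-_; con; _:=_)

  pointwise-≈ : ∀ {x y} → (∀ n → seq x n ≡ seq y n) → x ≈ y
  pointwise-≈ {x} {y} e .close ε ε>0 = 0 , λ n _ →
    ≡.subst (ℚ._< ε) (≡.sym (≡.trans (≡.cong (λ q → ∣ seq x n ℚ.- q ∣) (≡.sym (e n)))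
                                     (≡.cong ∣_∣ (ℚ.+-inverseʳ (seq x n))))) ε>0

  ≈-refl : ∀ {x} → x ≈ x
  ≈-refl {x} = pointwise-≈ {x} {x} λ _ → ≡.refl

  ∣p-q∣≡∣q-p∣ : ∀ p q → ∣ p ℚ.- q ∣ ≡ ∣ q ℚ.- p ∣
  ∣p-q∣≡∣q-p∣ p q = ≡.trans (≡.sym (ℚ.∣-p∣≡∣p∣ (p ℚ.- q)))
    (≡.cong ∣_∣ (solve 2 (λ p q → :- (p :- q) := q :- p) ≡.refl p q))

  ≈-sym : ∀ {x y} → x ≈ y → y ≈ x
  ≈-sym {x} {y} e .close ε ε>0 = let N , h = close e ε ε>0 in
    N , λ n N≤n → ≡.subst (ℚ._< ε) (∣p-q∣≡∣q-p∣ (seq x n) (seq y n)) (h n N≤n)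

  ∣+∣<-halves : ∀ {a b c ε} → c ≡ a ℚ.+ b → ∣ a ∣ ℚ.< ε ℚ.* ½ → ∣ b ∣ ℚ.< ε ℚ.* ½ → ∣ c ∣ ℚ.< ε
  ∣+∣<-halves {a} {b} {c} {ε} ≡.refl a< b< = ℚ.≤-<-trans (ℚ.∣p+q∣≤∣p∣+∣q∣ a b)
    (≡.subst (∣ a ∣ ℚ.+ ∣ b ∣ ℚ.<_) (half+half ε) (ℚ.+-mono-< a< b<))

  ≈-trans : ∀ {x y z} → x ≈ y → y ≈ z → x ≈ z
  ≈-trans {x} {y} {z} e f .close ε ε>0 =
    let M , g = close e (ε ℚ.* ½) (half-pos ε>0)
        N , h = close f (ε ℚ.* ½) (half-pos ε>0)
    in M ℕ.⊔ N , λ n le → ∣+∣<-halves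
         (solve 3 (λ x y z → x :- z := (x :- y) :+ (y :- z)) ≡.refl (seq x n) (seq y n) (seq z n))
         (g n (ℕ.m⊔n≤o⇒m≤o M N le)) (h n (ℕ.m⊔n≤o⇒n≤o M N le))

  +-cong : ∀ {x x′ y y′} → x ≈ x′ → y ≈ y′ → x + y ≈ x′ + y′
  +-cong {x} {x′} {y} {y′} e f .close ε ε>0 =
    let M , g = close e (ε ℚ.* ½) (half-pos ε>0)
        N , h = close f (ε ℚ.* ½) (half-pos ε>0)
    in M ℕ.⊔ N , λ n le → ∣+∣<-halves
         (solve 4 (λ x x′ y y′ → (x :+ y) :- (x′ :+ y′) := (x :- x′) :+ (y :- y′)) ≡.refl
           (seq x n) (seq x′ n) (seq y n) (seq y′ n))
         (g n (ℕ.m⊔n≤o⇒m≤o M N le)) (h n (ℕ.m⊔n≤o⇒n≤o M N le))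

  -‿cong : ∀ {x y} → x ≈ y → - x ≈ - y
  -‿cong {x} {y} e .close ε ε>0 = let N , h = close e ε ε>0 in
    N , λ n N≤n → ≡.subst (ℚ._< ε) (≡.trans (∣p-q∣≡∣q-p∣ (seq x n) (seq y n))
      (≡.cong ∣_∣ (solve 2 (λ x y → y :- x := :- x :- (:- y)) ≡.refl (seq x n) (seq y n)))) (h n N≤n)

  *-cong : ∀ {x x′ y y′} → x ≈ x′ → y ≈ y′ → x * y ≈ x′ * y′
  *-cong {x} {x′} {y} {y′} e f .close ε ε>0 =
    let B , B>0 , K , bx  = bounded (cauchy x)
        C , C>0 , L , by′ = bounded (cauchy y′)
        δ , δ>0 , Bδ      = shrink B>0 (half-pos ε>0)
        γ , γ>0 , Cγ      = shrink C>0 (half-pos ε>0)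
        M , g             = close e γ γ>0
        N , h             = close f δ δ>0
    in (K ℕ.⊔ L) ℕ.⊔ (M ℕ.⊔ N) , λ n le →
       let KL = ℕ.m⊔n≤o⇒m≤o (K ℕ.⊔ L) (M ℕ.⊔ N) le
           MN = ℕ.m⊔n≤o⇒n≤o (K ℕ.⊔ L) (M ℕ.⊔ N) le
       in *-close (seq x n) (seq x′ n) (seq y n) (seq y′ n) B>0 C>0
            (bx n (ℕ.m⊔n≤o⇒m≤o K L KL)) (by′ n (ℕ.m⊔n≤o⇒n≤o K L KL))
            (h n (ℕ.m⊔n≤o⇒n≤o M N MN)) (g n (ℕ.m⊔n≤o⇒m≤o M N MN)) Bδ Cγ

  ℝ-ring : CommutativeRing 0ℓ 0ℓ
  ℝ-ring = record
    { Carrier = ℝ ; _≈_ = _≈_ ; _+_ = _+_ ; _*_ = _*_ ; -_ = -_ ; 0# = 0ℝ ; 1# = 1ℝ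
    ; isCommutativeRing = record
      { isRing = record
        { +-isAbelianGroup = record
          { isGroup = record
            { isMonoid = record
              { isSemigroup = record
                { isMagma = record
                  { isEquivalence = record { refl = ≈-refl ; sym = ≈-sym ; trans = ≈-trans }
                  ; ∙-cong = +-cong }
                ; assoc = λ x y z → pointwise-≈ λ n → ℚ.+-assoc (seq x n) (seq y n) (seq z n) }
              ; identity = (λ x → pointwise-≈ λ n → ℚ.+-identityˡ (seq x n))
                         , (λ x → pointwise-≈ λ n → ℚ.+-identityʳ (seq x n)) }
            ; inverse = (λ x → pointwise-≈ λ n → ℚ.+-inverseˡ (seq x n))
                      , (λ x → pointwise-≈ λ n → ℚ.+-inverseʳ (seq x n))
            ; ⁻¹-cong = -‿cong }
          ; comm = λ x y → pointwise-≈ λ n → ℚ.+-comm (seq x n) (seq y n) }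
        ; *-cong = *-cong
        ; *-assoc = λ x y z → pointwise-≈ λ n → ℚ.*-assoc (seq x n) (seq y n) (seq z n)
        ; *-identity = (λ x → pointwise-≈ λ n → ℚ.*-identityˡ (seq x n))
                     , (λ x → pointwise-≈ λ n → ℚ.*-identityʳ (seq x n))
        ; distrib = (λ x y z → pointwise-≈ λ n → ℚ.*-distribˡ-+ (seq x n) (seq y n) (seq z n))
                  , (λ x y z → pointwise-≈ λ n → ℚ.*-distribʳ-+ (seq x n) (seq y n) (seq z n)) }
      ; *-comm = λ x y → pointwise-≈ λ n → ℚ.*-comm (seq x n) (seq y n) } }

  pointwise-≤ : ∀ {x y} → (∀ n → seq x n ℚ.≤ seq y n) → x ≤ y
  pointwise-≤ {x} {y} h .below ε ε>0 = 0 , λ n _ →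
    ≡.subst (ℚ._≤ seq y n ℚ.+ ε) (ℚ.+-identityʳ (seq x n)) (ℚ.+-mono-≤ (h n) (ℚ.<⇒≤ ε>0))

  ≤-reflexive : ∀ {x y} → x ≈ y → x ≤ y
  ≤-reflexive {x} {y} e .below ε ε>0 = let N , h = close e ε ε>0 in
    N , λ n N≤n → ℚ.<⇒≤ (∣-∣<-elim {seq x n} (h n N≤n))

  +-mono-≤ : ∀ {x x′ y y′} → x ≤ x′ → y ≤ y′ → x + y ≤ x′ + y′
  +-mono-≤ {x} {x′} {y} {y′} e f .below ε ε>0 =
    let M , g = below e (ε ℚ.* ½) (half-pos ε>0)
        N , h = below f (ε ℚ.* ½) (half-pos ε>0)
    in M ℕ.⊔ N , λ n le → ≡.subst (seq x n ℚ.+ seq y n ℚ.≤_)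
         (≡.trans (solve 3 (λ x y e → x :+ e :+ (y :+ e) := x :+ y :+ (e :+ e)) ≡.refl (seq x′ n) (seq y′ n) (ε ℚ.* ½))
                  (≡.cong (seq x′ n ℚ.+ seq y′ n ℚ.+_) (half+half ε)))
         (ℚ.+-mono-≤ (g n (ℕ.m⊔n≤o⇒m≤o M N le)) (h n (ℕ.m⊔n≤o⇒n≤o M N le)))

  ≤-trans : ∀ {x y z} → x ≤ y → y ≤ z → x ≤ z
  ≤-trans {x} {y} {z} e f .below ε ε>0 =
    let M , g = below e (ε ℚ.* ½) (half-pos ε>0)
        N , h = below f (ε ℚ.* ½) (half-pos ε>0)
    in M ℕ.⊔ N , λ n le → ≡.subst (seq x n ℚ.≤_)
         (≡.trans (ℚ.+-assoc (seq z n) (ε ℚ.* ½) (ε ℚ.* ½)) (≡.cong (seq z n ℚ.+_) (half+half ε)))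
         (ℚ.≤-trans (g n (ℕ.m⊔n≤o⇒m≤o M N le)) (ℚ.+-monoˡ-≤ (ε ℚ.* ½) (h n (ℕ.m⊔n≤o⇒n≤o M N le))))

  0≤-* : ∀ {x y} → 0ℝ ≤ x → 0ℝ ≤ y → 0ℝ ≤ x * y
  0≤-* {x} {y} x≥0 y≥0 .below ε ε>0 =
    let B , B>0 , K , bx = bounded (cauchy x)
        C , C>0 , L , by = bounded (cauchy y)
        -- `W` bounds s + t + δ because δ ≤ 1. From 0 ≤ (s + δ)(t + δ) = st + (s + t + δ)δ the error
        -- is then at most W δ₀ = ε.
        W                = B ℚ.+ C ℚ.+ 1ℚ
        W>0              = ℚ.+-mono-< (ℚ.+-mono-< B>0 C>0) (ℚ.positive⁻¹ 1ℚ)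
        δ₀ , δ₀>0 , Wδ₀  = shrink {W} W>0 ε>0
        δ                = δ₀ ℚ.⊓ 1ℚ
        δ>0              = ⊓-pos {δ₀} {1ℚ} δ₀>0 (ℚ.positive⁻¹ 1ℚ)
        M , hx           = below x≥0 δ δ>0
        N , hy           = below y≥0 δ δ>0
    in (K ℕ.⊔ L) ℕ.⊔ (M ℕ.⊔ N) , λ n le →
       let KL  = ℕ.m⊔n≤o⇒m≤o (K ℕ.⊔ L) (M ℕ.⊔ N) le
           MN  = ℕ.m⊔n≤o⇒n≤o (K ℕ.⊔ L) (M ℕ.⊔ N) le
           s   = seq x n
           t   = seq y n
           s≤B = ℚ.≤-trans (p≤∣p∣ s) (bx n (ℕ.m⊔n≤o⇒m≤o K L KL))
           t≤C = ℚ.≤-trans (p≤∣p∣ t) (by n (ℕ.m⊔n≤o⇒n≤o K L KL))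
           open ℚ.≤-Reasoning
       in begin
            0ℚ
              ≤⟨ *-nonNeg (hx n (ℕ.m⊔n≤o⇒m≤o M N MN)) (hy n (ℕ.m⊔n≤o⇒n≤o M N MN)) ⟩
            (s ℚ.+ δ) ℚ.* (t ℚ.+ δ)
              ≡⟨ solve 3 (λ s t d → (s :+ d) :* (t :+ d) := s :* t :+ (s :+ t :+ d) :* d) ≡.refl s t δ ⟩
            s ℚ.* t ℚ.+ (s ℚ.+ t ℚ.+ δ) ℚ.* δ
              ≤⟨ ℚ.+-monoʳ-≤ (s ℚ.* t) (*-mono-≤ (ℚ.<⇒≤ W>0) (ℚ.<⇒≤ δ>0)
                   (ℚ.+-mono-≤ (ℚ.+-mono-≤ s≤B t≤C) (ℚ.p⊓q≤q δ₀ 1ℚ)) (ℚ.p⊓q≤p δ₀ 1ℚ)) ⟩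
            s ℚ.* t ℚ.+ W ℚ.* δ₀                        ≡⟨ ≡.cong (s ℚ.* t ℚ.+_) Wδ₀ ⟩
            s ℚ.* t ℚ.+ ε                               ∎

  0≤p*p : ∀ p → 0ℚ ℚ.≤ p ℚ.* p
  0≤p*p p with ℚ.≤-total 0ℚ p
  ... | inj₁ p≥0 = *-nonNeg p≥0 p≥0
  ... | inj₂ p≤0 = ≡.subst (0ℚ ℚ.≤_) (solve 1 (λ p → :- p :* (:- p) := p :* p) ≡.refl p)
                       (*-nonNeg (ℚ.neg-antimono-≤ p≤0) (ℚ.neg-antimono-≤ p≤0))

  0≤x*x : ∀ x → 0ℝ ≤ x * x
  0≤x*x x = pointwise-≤ λ n → 0≤p*p (seq x n)

  square-cancel : ∀ {x y} → 0ℝ ≤ y → x * x ≤ y * y → x ≤ y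
  square-cancel {x} {y} y≥0 h .below ε ε>0 =
    -- With u = t + d ≥ 0, the square of u + 2d exceeds t² + d² by 6ud + 2d² ≥ 0, so s ≤ u + 2d = t
    -- + 3d. A shift by u + d could fail, as its excess 4ud - d² may be negative. One more d rounds
    -- 3d up to 4d = ε.
    let d      = ε ℚ.* ½ ℚ.* ½
        d>0    = half-pos (half-pos ε>0)
        M , hy = below y≥0 d d>0
        N , hx = below h (d ℚ.* d) (*-pos d>0 d>0)
    in M ℕ.⊔ N , λ n le →
       let s   = seq x n
           t   = seq y n
           u   = t ℚ.+ d
           u≥0 = hy n (ℕ.m⊔n≤o⇒m≤o M N le)
           d≥0 = ℚ.<⇒≤ d>0
           ud≥0 = *-nonNeg u≥0 d≥0
           dd≥0 = *-nonNeg d≥0 d≥0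
           open ℚ.≤-Reasoning
       in begin
         s                       ≤⟨ square-cancel-≤ {s} {u ℚ.+ (d ℚ.+ d)} (ℚ.+-mono-≤ u≥0 (ℚ.+-mono-≤ d≥0 d≥0)) (begin
           s ℚ.* s                                   ≤⟨ hx n (ℕ.m⊔n≤o⇒n≤o M N le) ⟩
           t ℚ.* t ℚ.+ d ℚ.* d                       ≡⟨ ℚ.+-identityʳ _ ⟨
           t ℚ.* t ℚ.+ d ℚ.* d ℚ.+ 0ℚ
             ≤⟨ ℚ.+-monoʳ-≤ (t ℚ.* t ℚ.+ d ℚ.* d) (ℚ.+-mono-≤ (ℚ.+-mono-≤ (ℚ.+-mono-≤ (ℚ.+-mono-≤ ud≥0 ud≥0) (ℚ.+-mono-≤ ud≥0 ud≥0)) (ℚ.+-mono-≤ ud≥0 ud≥0)) (ℚ.+-mono-≤ dd≥0 dd≥0)) ⟩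
           t ℚ.* t ℚ.+ d ℚ.* d ℚ.+ (u ℚ.* d ℚ.+ u ℚ.* d ℚ.+ (u ℚ.* d ℚ.+ u ℚ.* d) ℚ.+ (u ℚ.* d ℚ.+ u ℚ.* d) ℚ.+ (d ℚ.* d ℚ.+ d ℚ.* d))
             ≡⟨ solve 2 (λ t d → let u = t :+ d in
                  t :* t :+ d :* d :+ (u :* d :+ u :* d :+ (u :* d :+ u :* d) :+ (u :* d :+ u :* d) :+ (d :* d :+ d :* d)) :=
                  (u :+ (d :+ d)) :* (u :+ (d :+ d))) ≡.refl t d ⟩
           (u ℚ.+ (d ℚ.+ d)) ℚ.* (u ℚ.+ (d ℚ.+ d))   ∎) ⟩
         u ℚ.+ (d ℚ.+ d)                          ≡⟨ ℚ.+-identityʳ _ ⟨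
         u ℚ.+ (d ℚ.+ d) ℚ.+ 0ℚ                   ≤⟨ ℚ.+-monoʳ-≤ (u ℚ.+ (d ℚ.+ d)) d≥0 ⟩
         u ℚ.+ (d ℚ.+ d) ℚ.+ d
           ≡⟨ solve 2 (λ t d → t :+ d :+ (d :+ d) :+ d := t :+ ((d :+ d) :+ (d :+ d))) ≡.refl t d ⟩
         t ℚ.+ ((d ℚ.+ d) ℚ.+ (d ℚ.+ d))
           ≡⟨ ≡.cong (t ℚ.+_) (≡.trans (≡.cong₂ ℚ._+_ (half+half (ε ℚ.* ½)) (half+half (ε ℚ.* ½))) (half+half ε)) ⟩
         t ℚ.+ ε                                  ∎

  ≤-antisym : ∀ {x y} → x ≤ y → y ≤ x → x ≈ y
  ≤-antisym {x} {y} h k .close ε ε>0 =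
    let d      = ε ℚ.* ½
        M , hx = below h d (half-pos ε>0)
        N , hy = below k d (half-pos ε>0)
        d<ε    = ≡.subst₂ ℚ._<_ (ℚ.+-identityʳ d) (half+half ε) (ℚ.+-monoʳ-< d (half-pos ε>0))
    in M ℕ.⊔ N , λ n le → ∣-∣<-intro
         (ℚ.≤-<-trans (hx n (ℕ.m⊔n≤o⇒m≤o M N le)) (ℚ.+-monoʳ-< (seq y n) d<ε))
         (ℚ.≤-<-trans (hy n (ℕ.m⊔n≤o⇒n≤o M N le)) (ℚ.+-monoʳ-< (seq x n) d<ε))

  1≰0 : ¬ 1ℝ ≤ 0ℝ
  1≰0 h with below h ½ (ℚ.positive⁻¹ ½)
  ... | N , k = <⇒≱ {0ℚ ℚ.+ ½} {1ℚ} (≡.subst (ℚ._< 1ℚ) (≡.sym (ℚ.+-identityˡ ½)) ½<1) (k N ℕ.≤-refl)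
    where
    ½<1 : ½ ℚ.< 1ℚ
    ½<1 = ≡.subst₂ ℚ._<_ (ℚ.+-identityʳ ½) (half+half 1ℚ) (ℚ.+-monoʳ-< ½ (ℚ.positive⁻¹ ½))

  -- Eventually ∣x∣ k ≤ ∣x y∣ < ε k, and the rational `k` cancels.
  bounded-away⇒≈0 : ∀ {x y k} → 0ℚ ℚ.< k → x * y ≈ 0ℝ → ∃[ N ] (∀ n → N ℕ.≤ n → k ℚ.≤ ∣ seq y n ∣) → x ≈ 0ℝ
  bounded-away⇒≈0 {x} {y} {k} k>0 xy≈0 (M , h) .close ε ε>0 =
    let N , g = close xy≈0 (ε ℚ.* k) (*-pos ε>0 k>0)
    in M ℕ.⊔ N , λ n le →
       let s = seq x n
           t = seq y n
           open ℚ.≤-Reasoning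
       in ≡.subst (λ q → ∣ q ∣ ℚ.< ε) (≡.sym (ℚ.+-identityʳ s))
            (ℚ.*-cancelʳ-<-nonNeg k {{nonNegative (ℚ.<⇒≤ k>0)}} (begin-strict
              ∣ s ∣ ℚ.* k         ≤⟨ ℚ.*-monoˡ-≤-nonNeg ∣ s ∣ {{ℚ.∣-∣-nonNeg s}} (h n (ℕ.m⊔n≤o⇒m≤o M N le)) ⟩
              ∣ s ∣ ℚ.* ∣ t ∣     ≡⟨ ℚ.∣p*q∣≡∣p∣*∣q∣ s t ⟨
              ∣ s ℚ.* t ∣         ≡⟨ ≡.cong ∣_∣ (ℚ.+-identityʳ (s ℚ.* t)) ⟨
              ∣ s ℚ.* t ℚ.- 0ℚ ∣  <⟨ g n (ℕ.m⊔n≤o⇒n≤o M N le) ⟩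
              ε ℚ.* k             ∎))

  -- Far out, either ∣ y ∣ < ε or y is bounded away from 0, which forces x ≈ 0; comparing one rational
  -- approximation of y with ε / 2 decides which.
  ≈0-cancel : ∀ {x y} → x * y ≈ 0ℝ → ¬ x ≈ 0ℝ → y ≈ 0ℝ
  ≈0-cancel {x} {y} xy≈0 x≉0 .close ε ε>0 = decide (∣ seq y N ∣ ℚ.<? d)
    where
    d   = ε ℚ.* ½
    d>0 = half-pos ε>0
    k   = d ℚ.* ½
    k>0 = half-pos d>0
    N   = proj₁ (converge (cauchy y) k k>0)
    near : ∀ n → N ℕ.≤ n → ∣ seq y N ℚ.- seq y n ∣ ℚ.< k
    near n = proj₂ (converge (cauchy y) k k>0) N n ℕ.≤-refl
    k<d : k ℚ.< d
    k<d = ≡.subst₂ ℚ._<_ (ℚ.+-identityʳ k) (half+half d) (ℚ.+-monoʳ-< k k>0)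
    decide : Dec (∣ seq y N ∣ ℚ.< d) → ∃[ M ] (∀ n → M ℕ.≤ n → ∣ seq y n ℚ.- 0ℚ ∣ ℚ.< ε)
    decide (yes small) = N , λ n N≤n → ∣+∣<-halves
      (solve 2 (λ s t → t :- con 0ℚ := s :+ (t :- s)) ≡.refl (seq y N) (seq y n)) small
      (≡.subst (ℚ._< d) (∣p-q∣≡∣q-p∣ (seq y N) (seq y n)) (ℚ.<-trans (near n N≤n) k<d))
    decide (no large) = contradiction (bounded-away⇒≈0 {x} {y} k>0 xy≈0 (N , λ n N≤n →
      let s = seq y N
          t = seq y n
          open ℚ.≤-Reasoning
      in ℚ.≮⇒≥ λ t<k → large (begin-strict
           ∣ s ∣                     ≡⟨ ≡.cong ∣_∣ (solve 2 (λ s t → s := (s :- t) :+ t) ≡.refl s t) ⟩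
           ∣ (s ℚ.- t) ℚ.+ t ∣       ≤⟨ ℚ.∣p+q∣≤∣p∣+∣q∣ (s ℚ.- t) t ⟩
           ∣ s ℚ.- t ∣ ℚ.+ ∣ t ∣     <⟨ ℚ.+-mono-< (near n N≤n) t<k ⟩
           k ℚ.+ k                   ≡⟨ half+half d ⟩
           d                         ∎))) x≉0

  fromℕ-suc : ∀ n → fromℕ (suc n) ≈ 1ℝ + fromℕ n
  fromℕ-suc n = pointwise-≈ λ _ → ≡.trans (ι-suc n) (ℚ.+-comm (ι n) 1ℚ)

  reciprocal : ∀ n → ∃[ c ] fromℕ (suc n) * c ≈ 1ℝ
  reciprocal n = fromℚ (η n) , pointwise-≈ λ _ → ≡.trans (ℚ.*-comm (ι (suc n)) (η n)) (frac 1 n)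

-- The totient of pqr, Bézout relations, and the size estimate.

module Arithmetic where
  open CyclotomicPolynomials using (Bézout)
  open import Defs using (φ)

  open import Data.Nat.Base
    using (ℕ; zero; suc; _+_; _*_; _∸_; _≤_; _<_; z≤n; s≤s; s≤s⁻¹; pred; >-nonZero; nonTrivial⇒n>1)
  open import Data.Nat.Properties
  open import Data.Nat.Divisibility
  open import Data.Nat.Coprimality as Coprime using (Coprime; coprime?)
  open import Data.Nat.GCD using (module Bézout)
  open import Data.Nat.Primality using (Prime; euclidsLemma; prime⇒irreducible; prime⇒nonTrivial)
  open import Data.Nat.Solver using (module +-*-Solver)
  open import Data.Bool.Base using (true; false; if_then_else_)
  open import Data.List.Base using (length; filter; map; applyUpTo)
  open import Data.Product.Base using (_,_)
  open import Data.Sum.Base using (_⊎_; inj₁; inj₂; [_,_]′)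
  open import Function.Base using (_∘_; id)
  open import Function.Bundles using (_⇔_; mk⇔)
  open import Relation.Nullary using (Dec; yes; no; does; ¬_; contradiction)
  open import Relation.Nullary.Decidable using (does-⇔; dec-true; dec-false)
  open import Relation.Binary.PropositionalEquality
  open +-*-Solver using (solve; _:+_; _:*_; con; _:=_)

  indicator : ∀ {P : Set} → Dec P → ℕ
  indicator P? = if does P? then 1 else 0

  indicator-cong : ∀ {P Q : Set} (P? : Dec P) (Q? : Dec Q) → P ⇔ Q → indicator P? ≡ indicator Q?
  indicator-cong P? Q? P⇔Q = cong (if_then 1 else 0) (does-⇔ P⇔Q P? Q?)

  -- The hypotheses make P equivalent to Q without R; Q is thus counted according to whether R
  -- holds.
  indicator-split : ∀ {P Q R : Set} (P? : Dec P) (Q? : Dec Q) (R? : Dec R) →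
    (P → Q) → (P → ¬ R) → (Q → ¬ R → P) → indicator P? + indicator Q? * indicator R? ≡ indicator Q?
  indicator-split (yes p) (yes _) (yes r) _   f _ = contradiction r (f p)
  indicator-split (yes _) (yes _) (no _)  _   _ _ = refl
  indicator-split (yes p) (no ¬q) _       p→q _ _ = contradiction (p→q p) ¬q
  indicator-split (no _)  (yes _) (yes _) _   _ _ = refl
  indicator-split (no ¬p) (yes q) (no ¬r) _   _ g = contradiction (g q ¬r) ¬p
  indicator-split (no _)  (no _)  _       _   _ _ = refl

  Σ< : ℕ → (ℕ → ℕ) → ℕ
  Σ< zero    f = 0
  Σ< (suc n) f = f 0 + Σ< n (f ∘ suc)

  Σ<-cong : ∀ n {f g} → (∀ k → f k ≡ g k) → Σ< n f ≡ Σ< n g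
  Σ<-cong zero    e = refl
  Σ<-cong (suc n) e = cong₂ _+_ (e 0) (Σ<-cong n (e ∘ suc))

  Σ<-distrib-+ : ∀ n f g → Σ< n (λ k → f k + g k) ≡ Σ< n f + Σ< n g
  Σ<-distrib-+ zero    f g = refl
  Σ<-distrib-+ (suc n) f g = trans (cong (f 0 + g 0 +_) (Σ<-distrib-+ n (f ∘ suc) (g ∘ suc)))
    (solve 4 (λ a b c d → a :+ b :+ (c :+ d) := a :+ c :+ (b :+ d)) refl (f 0) (g 0) _ _)

  Σ<-+ : ∀ m n f → Σ< (m + n) f ≡ Σ< m f + Σ< n (λ k → f (m + k))
  Σ<-+ zero    n f = refl
  Σ<-+ (suc m) n f = trans (cong (f 0 +_) (Σ<-+ m n (f ∘ suc))) (sym (+-assoc (f 0) _ _))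

  Σ<-periodic : ∀ j a f → (∀ k → f (a + k) ≡ f k) → Σ< (j * a) f ≡ j * Σ< a f
  Σ<-periodic zero    a f e = refl
  Σ<-periodic (suc j) a f e = trans (Σ<-+ a (j * a) f)
    (cong (Σ< a f +_) (trans (Σ<-cong (j * a) e) (Σ<-periodic j a f e)))

  Σ<-last : ∀ n f → (∀ k → k < n → f k ≡ 0) → Σ< (suc n) f ≡ f n
  Σ<-last zero    f h = +-identityʳ (f 0)
  Σ<-last (suc n) f h = cong₂ _+_ (h 0 (s≤s z≤n)) (Σ<-last n (f ∘ suc) λ k k<n → h (suc k) (s≤s k<n))

  module _ (r : ℕ) where
    multipleOf : ℕ → ℕ
    multipleOf k = indicator (suc r ∣? k)

    -- The range splits into `a` blocks of length `suc r`, and only the last number of a block is a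
    -- multiple of `suc r`.
    Σ<-multiples : ∀ a (g : ℕ → ℕ) →
      Σ< (a * suc r) (λ k → g (suc k) * multipleOf (suc k)) ≡ Σ< a (λ j → g (suc j * suc r))
    Σ<-multiples zero    g = refl
    Σ<-multiples (suc a) g = begin
      Σ< (suc r + a * suc r) h                                        ≡⟨ Σ<-+ (suc r) (a * suc r) h ⟩
      Σ< (suc r) h + Σ< (a * suc r) (λ k → h (suc r + k))             ≡⟨ cong₂ _+_ first rest ⟩
      g (1 * suc r) + Σ< a (λ j → g (suc (suc j) * suc r))            ∎
      where
      open ≡-Reasoning
      h : ℕ → ℕ
      h k = g (suc k) * multipleOf (suc k)
      first : Σ< (suc r) h ≡ g (1 * suc r)
      first = begin
        Σ< (suc r) h                   ≡⟨ Σ<-last r h (λ k k<r → trans (cong (g (suc k) *_)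
                                            (cong (if_then 1 else 0) (dec-false (suc r ∣? suc k) λ d →
                                              <⇒≱ (s≤s k<r) (∣⇒≤ d)))) (*-zeroʳ (g (suc k)))) ⟩
        g (suc r) * multipleOf (suc r)
          ≡⟨ cong (g (suc r) *_) (cong (if_then 1 else 0) (dec-true (suc r ∣? suc r) ∣-refl)) ⟩
        g (suc r) * 1                  ≡⟨ *-identityʳ _ ⟩
        g (suc r)                      ≡⟨ cong g (+-identityʳ (suc r)) ⟨
        g (1 * suc r)                  ∎
      rest : Σ< (a * suc r) (λ k → h (suc r + k)) ≡ Σ< a (λ j → g (suc (suc j) * suc r))
      rest = trans
        (Σ<-cong (a * suc r) λ k → cong₂ _*_ (cong g (sym (+-suc (suc r) k)))
          (trans (cong multipleOf (sym (+-suc (suc r) k)))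
            (indicator-cong (suc r ∣? (suc r + suc k)) (suc r ∣? suc k)
              (mk⇔ (λ d → ∣m+n∣m⇒∣n d ∣-refl) (∣m∣n⇒∣m+n ∣-refl)))))
        -- The remaining blocks are the original problem for `g` shifted by one block.
        (Σ<-multiples a (λ k → g (suc r + k)))

  φ≡Σ : ∀ n → φ n ≡ Σ< n (λ k → indicator (coprime? (suc k) n))
  φ≡Σ n = go n id
    where
    go : ∀ m f → length (filter (λ k → coprime? k n) (map suc (applyUpTo f m))) ≡
                 Σ< m (λ k → indicator (coprime? (suc (f k)) n))
    go zero    f = refl
    go (suc m) f with does (coprime? (suc (f 0)) n)
    ... | true  = cong suc (go m (f ∘ suc))
    ... | false = go m (f ∘ suc)

  module _ {r′ a : ℕ} (r-prime : Prime (suc r′)) (r∤a : suc r′ ∤ a) where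
    private
      r = suc r′

      r≢1 : r ≢ 1
      r≢1 refl with prime⇒nonTrivial r-prime
      ... | ()

      c : ℕ → ℕ
      c k = indicator (coprime? k a)

      coprime-r : ∀ {m} → r ∤ m → Coprime m r
      coprime-r r∤m (d∣m , d∣r) with prime⇒irreducible r-prime d∣r
      ... | inj₁ d≡1 = d≡1
      ... | inj₂ refl = contradiction d∣m r∤m

      periodic : ∀ k → c (a + k) ≡ c k
      periodic k = indicator-cong (coprime? (a + k) a) (coprime? k a) (mk⇔ {A = Coprime (a + k) a} {B = Coprime k a}
        (λ h {d} (d∣k , d∣a) → h (∣m∣n⇒∣m+n d∣a d∣k , d∣a))
        (λ h {d} (d∣a+k , d∣a) → h (∣m+n∣m⇒∣n d∣a+k d∣a , d∣a)))

      scale : ∀ j → c (j * r) ≡ c j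
      scale j = indicator-cong (coprime? (j * r) a) (coprime? j a) (mk⇔ {A = Coprime (j * r) a} {B = Coprime j a}
        (λ h {d} (d∣j , d∣a) → h (∣m⇒∣m*n r d∣j , d∣a))
        (λ h {d} (d∣jr , d∣a) → h (Coprime.coprime-divisor {d} {r} {j}
          (coprime-r (λ r∣d → r∤a (∣-trans r∣d d∣a))) (subst (d ∣_) (*-comm j r) d∣jr) , d∣a)))

      split : ∀ k → indicator (coprime? k (a * r)) + c k * multipleOf r′ k ≡ c k
      split k = indicator-split (coprime? k (a * r)) (coprime? k a) (r ∣? k)
        (λ h {d} (d∣k , d∣a) → h (d∣k , ∣m⇒∣m*n r d∣a))
        (λ h r∣k → r≢1 (h (r∣k , ∣n⇒∣m*n a ∣-refl)))
        (λ g r∤k {d} (d∣k , d∣ar) → coprime-r r∤k (d∣k , Coprime.coprime-divisor {d} {a} {r}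
          (λ (e∣d , e∣a) → g (∣-trans e∣d d∣k , e∣a)) d∣ar))

    -- Among the numbers from 1 to ar, those coprime to a number r φ(a) by periodicity. The ones
    -- divisible by r have the form jr with j ≤ a, and jr is coprime to a exactly when j is, so
    -- there are φ(a) of them; the others are those coprime to ar. Adding φ(a) to both sides avoids
    -- subtraction.
    φ-*-prime : φ (a * r) ≡ φ a * r′
    φ-*-prime = +-cancelʳ-≡ (φ a) _ _ (begin
      φ (a * r) + φ a
        ≡⟨ cong₂ _+_ (φ≡Σ (a * r)) (trans (φ≡Σ a) (sym (trans (Σ<-multiples r′ a c) (Σ<-cong a λ j → scale (suc j))))) ⟩
      Σ< (a * r) (λ k → indicator (coprime? (suc k) (a * r))) + Σ< (a * r) (λ k → c (suc k) * multipleOf r′ (suc k))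
        ≡⟨ Σ<-distrib-+ (a * r) _ _ ⟨
      Σ< (a * r) (λ k → indicator (coprime? (suc k) (a * r)) + c (suc k) * multipleOf r′ (suc k))
        ≡⟨ Σ<-cong (a * r) (split ∘ suc) ⟩
      Σ< (a * r) (c ∘ suc)          ≡⟨ cong (λ n → Σ< n (c ∘ suc)) (*-comm a r) ⟩
      Σ< (r * a) (c ∘ suc)
        ≡⟨ Σ<-periodic r a (c ∘ suc) (λ k → trans (cong c (sym (+-suc a k))) (periodic (suc k))) ⟩
      r * Σ< a (c ∘ suc)            ≡⟨ cong (r *_) (sym (φ≡Σ a)) ⟩
      r * φ a                       ≡⟨ solve 2 (λ f s → (con 1 :+ s) :* f := f :* s :+ f) refl (φ a) r′ ⟩
      φ a * r′ + φ a                ∎)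
      where open ≡-Reasoning

  -- A solution with x > q is replaced by (x - q , y - p).
  reduceBézout : ∀ fuel p q x y → 0 < p → 0 < q → x ≤ fuel → x * p ≡ suc (y * q) → Bézout p q
  reduceBézout fuel p q x y p>0 q>0 x≤fuel eq with x ≤? q
  ... | yes x≤q = record
    { a = x ; b = y ; a*p≡ = eq ; a≤q = x≤q
    ; b≤p = <⇒≤ (*-cancelʳ-< q y p (≤-trans (≤-reflexive (sym eq))
              (≤-trans (*-monoˡ-≤ p x≤q) (≤-reflexive (*-comm q p))))) }
  reduceBézout zero       p q x y p>0 q>0 x≤0    eq | no x≰q = contradiction (≤-trans x≤0 z≤n) x≰q
  reduceBézout (suc fuel) p q x y p>0 q>0 x≤fuel eq | no x≰q =
    reduceBézout fuel p q (x ∸ q) (y ∸ p) p>0 q>0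
      (≤-trans (∸-monoˡ-≤ q x≤fuel) (∸-monoʳ-≤ (suc fuel) q>0))
      (+-cancelˡ-≡ (q * p) _ _ (begin
        q * p + (x ∸ q) * p            ≡⟨ *-distribʳ-+ p q (x ∸ q) ⟨
        (q + (x ∸ q)) * p              ≡⟨ cong (_* p) (m+[n∸m]≡n (<⇒≤ q<x)) ⟩
        x * p                          ≡⟨ eq ⟩
        suc (y * q)                    ≡⟨ cong (λ n → suc (n * q)) (m+[n∸m]≡n p≤y) ⟨
        suc ((p + (y ∸ p)) * q)
          ≡⟨ solve 3 (λ p q z → con 1 :+ (p :+ z) :* q := q :* p :+ (con 1 :+ z :* q)) refl p q (y ∸ p) ⟩
        q * p + suc ((y ∸ p) * q)      ∎))
    where
    open ≡-Reasoning
    q<x = ≰⇒> x≰q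
    p≤y : p ≤ y
    p≤y = *-cancelʳ-≤ p y q {{>-nonZero q>0}} (s≤s⁻¹ (≤-trans (+-mono-≤ p>0 (≤-reflexive (*-comm p q)))
            (≤-trans (*-monoˡ-≤ p q<x) (≤-reflexive eq))))

  -- The extended Euclidean algorithm returns the relation with either sign. If 1 + xp = yq, then xp
  -- is -1 modulo q, and multiplying by q - 1 gives (q - 1)xp = 1 modulo q; `reduceBézout` then
  -- brings the coefficients into range.
  bézout : ∀ p q → 0 < p → 1 < q → Coprime p q → Bézout p q
  bézout p (suc zero) p>0 (s≤s ()) coprime
  bézout p q@(suc (suc q″)) p>0 q>1 coprime with Coprime.coprime-Bézout coprime
  ... | Bézout.+- x y eq       = reduceBézout x p q x y p>0 (<⇒≤ q>1) ≤-refl (sym eq)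
  ... | Bézout.-+ x zero    ()
  ... | Bézout.-+ x (suc y) eq =
    reduceBézout (q′ * x) p q (q′ * x) (y + q″ * suc y) p>0 (<⇒≤ q>1) ≤-refl (+-cancelʳ-≡ q′ _ _ (begin
      q′ * x * p + q′
        ≡⟨ solve 3 (λ q x p → q :* x :* p :+ q := q :* (con 1 :+ x :* p)) refl q′ x p ⟩
      q′ * suc (x * p)                  ≡⟨ cong (q′ *_) eq ⟩
      q′ * (suc y * q)
        ≡⟨ solve 2 (λ y q → (con 1 :+ q) :* ((con 1 :+ y) :* (con 2 :+ q)) :=
                            con 1 :+ (y :+ q :* (con 1 :+ y)) :* (con 2 :+ q) :+ (con 1 :+ q)) refl y q″ ⟩
      suc ((y + q″ * suc y) * q) + q′   ∎))
    where
    open ≡-Reasoning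
    q′ = suc q″

  2∣n⊎2∣1+n : ∀ n → 2 ∣ n ⊎ 2 ∣ suc n
  2∣n⊎2∣1+n zero    = inj₁ (2 ∣0)
  2∣n⊎2∣1+n (suc n) with 2∣n⊎2∣1+n n
  ... | inj₁ 2∣n   = inj₂ (∣m∣n⇒∣m+n ∣-refl 2∣n)
  ... | inj₂ 2∣1+n = inj₁ 2∣1+n

  odd-< : ∀ {m n} → 2 ∤ m → 2 ∤ n → m < n → 2 + m ≤ n
  odd-< {m} {n} 2∤m 2∤n m<n with 2∣n⊎2∣1+n m
  ... | inj₁ 2∣m   = contradiction 2∣m 2∤m
  ... | inj₂ 2∣1+m = ≤∧≢⇒< m<n λ { refl → 2∤n 2∣1+m }

  odd-prime : ∀ {p} → Prime p → 2 ∤ p → 3 ≤ p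
  odd-prime {p} p-prime 2∤p = ≤∧≢⇒< (nonTrivial⇒n>1 p {{prime⇒nonTrivial p-prime}}) λ { refl → 2∤p ∣-refl }

  φ-pqr : ∀ {p q r} → Prime p → Prime q → Prime r → 1 < p → p < q → q < r →
          φ (p * q * r) ≡ pred p * pred q * pred r
  φ-pqr {suc p′} {suc q′} {suc r′} p-prime q-prime r-prime p>1 p<q q<r = begin
    φ (p * q * r)        ≡⟨ φ-*-prime r-prime r∤pq ⟩
    φ (p * q) * r′       ≡⟨ cong (_* r′) (φ-*-prime q-prime (<-prime⇒∤ p<q)) ⟩
    -- Written as `1 * p`, the prime itself is a case of `φ-*-prime`, and `φ 1` evaluates to 1.
    φ p * q′ * r′        ≡⟨ cong (λ k → φ k * q′ * r′) (*-identityˡ p) ⟨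
    φ (1 * p) * q′ * r′  ≡⟨ cong (λ k → k * q′ * r′) (φ-*-prime {a = 1} p-prime (<-prime⇒∤ p>1)) ⟩
    1 * p′ * q′ * r′     ≡⟨ cong (λ k → k * q′ * r′) (*-identityˡ p′) ⟩
    p′ * q′ * r′         ∎
    where
    open ≡-Reasoning
    p = suc p′
    q = suc q′
    r = suc r′
    <-prime⇒∤ : ∀ {a b} → suc a < b → b ∤ suc a
    <-prime⇒∤ a<b b∣a = <⇒≱ a<b (∣⇒≤ b∣a)
    r∤pq : r ∤ p * q
    r∤pq r∣pq = [ <-prime⇒∤ (<-trans p<q q<r) , <-prime⇒∤ q<r ]′ (euclidsLemma p q r-prime r∣pq)

  degree-Φ-pqr : ∀ {p q r} → 0 < p → 0 < q → 0 < r →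
    pred p * pred q * pred r + 1 + q * p + r * p + r * q ≡ p * q * r + p + q + r
  degree-Φ-pqr {suc p′} {suc q′} {suc r′} _ _ _ = solve 3 (λ p′ q′ r′ →
    let p = con 1 :+ p′ ; q = con 1 :+ q′ ; r = con 1 :+ r′ in
    p′ :* q′ :* r′ :+ con 1 :+ q :* p :+ r :* p :+ r :* q := p :* q :* r :+ p :+ q :+ r) refl p′ q′ r′

  -- From p ≥ 3 follows 2p ≤ 3(p - 1), and p + q ≤ 2q, so the left side is at most 18 (p - 1)² q².
  -- The gap r ≥ q + 2 gives (q - 1)(r - 1) ≥ s with s = (q - 1)(q + 1) = q² - 1. As q ≥ 5, s is at
  -- least 24, whence 18q² = 18 + 18s ≤ 24s ≤ s².
  size-bound : ∀ {p q r} → 3 ≤ p → 2 + p ≤ q → 2 + q ≤ r →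
    4 * (p * p * q * (p + q)) ≤ (pred p * pred q * pred r) * (pred p * pred q * pred r)
  size-bound {suc p′} {suc q′} {suc r′} (s≤s p′≥2) (s≤s q′≥) (s≤s r′≥) = begin
    4 * (p * p * q * (p + q))
      ≡⟨ solve 2 (λ p q → con 4 :* (p :* p :* q :* (p :+ q)) := (con 2 :* p) :* (con 2 :* p) :* (q :* (p :+ q))) refl p q ⟩
    (2 * p) * (2 * p) * (q * (p + q))
      ≤⟨ *-mono-≤ (*-mono-≤ 2p≤3p′ 2p≤3p′) (*-monoʳ-≤ q (+-monoˡ-≤ q p≤q)) ⟩
    (3 * p′) * (3 * p′) * (q * (q + q))
      ≡⟨ solve 2 (λ p q → (con 3 :* p) :* (con 3 :* p) :* (q :* (q :+ q)) := p :* p :* (con 18 :* (q :* q))) refl p′ q ⟩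
    p′ * p′ * (18 * (q * q))              ≤⟨ *-monoʳ-≤ (p′ * p′) 18q²≤s² ⟩
    p′ * p′ * (s * s)                     ≤⟨ *-monoʳ-≤ (p′ * p′) (*-mono-≤ s≤q′r′ s≤q′r′) ⟩
    p′ * p′ * (q′ * r′ * (q′ * r′))
      ≡⟨ solve 3 (λ p q r → p :* p :* (q :* r :* (q :* r)) := (p :* q :* r) :* (p :* q :* r)) refl p′ q′ r′ ⟩
    (p′ * q′ * r′) * (p′ * q′ * r′)       ∎
    where
    open ≤-Reasoning
    p = suc p′
    q = suc q′
    s = q′ * (2 + q′)
    p≤q : p ≤ q
    p≤q = s≤s (≤-trans (m≤n+m p′ 2) q′≥)
    2p≤3p′ : 2 * p ≤ 3 * p′
    2p≤3p′ = begin
      2 * p          ≡⟨ solve 1 (λ p → con 2 :* (con 1 :+ p) := con 2 :+ con 2 :* p) refl p′ ⟩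
      2 + 2 * p′     ≤⟨ +-monoˡ-≤ (2 * p′) p′≥2 ⟩
      p′ + 2 * p′    ∎
    q′≥4 : 4 ≤ q′
    q′≥4 = ≤-trans (+-monoʳ-≤ 2 p′≥2) q′≥
    s≥24 : 24 ≤ s
    s≥24 = *-mono-≤ q′≥4 (+-monoʳ-≤ 2 q′≥4)
    s≤q′r′ : s ≤ q′ * r′
    s≤q′r′ = *-monoʳ-≤ q′ r′≥
    18q²≤s² : 18 * (q * q) ≤ s * s
    18q²≤s² = begin
      18 * (q * q)
        ≡⟨ solve 1 (λ q → con 18 :* ((con 1 :+ q) :* (con 1 :+ q)) := con 18 :+ con 18 :* (q :* (con 2 :+ q))) refl q′ ⟩
      18 + 18 * s        ≤⟨ +-monoˡ-≤ (18 * s) (≤-trans (m≤m+n 18 6) s≥24) ⟩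
      s + 18 * s         ≤⟨ m≤m+n _ (5 * s) ⟩
      s + 18 * s + 5 * s ≡⟨ solve 1 (λ s → s :+ con 18 :* s :+ con 5 :* s := con 24 :* s) refl s ⟩
      24 * s             ≤⟨ *-monoˡ-≤ s s≥24 ⟩
      s * s              ∎

-- Transfer to the concrete complex matrices.

open import Defs using (ℂ; φ; EnumeratesPrimitiveRoots; Invertible; vandermonde; Cond; _≤_; fromℕ)
open import Data.Nat.Base using (ℕ; _<_; _*_; _^_)
open import Data.Nat.Divisibility using (_∤_)
open import Data.Nat.Primality using (Prime)
open import Data.Fin.Base using (Fin)
open import Data.Product.Base using (Σ)

open import Algebra.Bundles.Raw using (RawMonoid; RawSemiring; RawRing)
import Algebra.Definitions.RawMonoid as RawMonoidDefinitions
open import Algebra.Structures using (IsCommutativeRing)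
open import Data.Bool.Base using (true; false)
open import Data.Fin.Base using (zero; suc; toℕ)
import Data.Fin.Properties as Fin
open import Data.Nat.Base as ℕ using (zero; suc)
open import Data.Nat.Coprimality as Coprimality using (prime⇒coprime)
import Data.Nat.Properties as ℕ
open import Data.Nat.Solver using (module +-*-Solver)
open import Data.Product.Base using (∃-syntax; _×_; _,_; proj₁; proj₂)
open import Defs
  using (ℝ; Matrix; PrimitiveRoot; ‖_‖; 1ᴹ; 1ᶜ; re; im; re≈; im≈; sumᶜ; sumℝ; inverse;
         _+i_; _,ᶜ_; _≈ᶜ_; _*ᶜ_; _^ᶜ_; _*ᴹ_; _≈ᴹ_)
open import Relation.Binary.PropositionalEquality using (_≡_; refl; cong; cong₂; subst; sym; trans)
open import Relation.Nullary using (does; ¬_)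
open NormedFields using (NormedField; module NormedField; module Inverse; module Sums)
open RealFields using (RealField; module RealField; module Complex)
open Arithmetic
open +-*-Solver using (solve; _:*_; con; _:=_)

-- The operations of ℝ unfold to sequences with their Cauchy proofs; opaque copies keep conversion checking cheap.
opaque
  infixl 6 _+ʳ_
  infixl 7 _*ʳ_
  infix  8 -ʳ_
  _+ʳ_ _*ʳ_ : ℝ → ℝ → ℝ
  _+ʳ_ = Defs._+_
  _*ʳ_ = Defs._*_

  infix 9 √ʳ_
  -ʳ_ √ʳ_ : ℝ → ℝ
  -ʳ_ = Defs.-_
  √ʳ_ = Defs.√_

opaque
  unfolding _+ʳ_

  -- Outside the block the opaque copies do not unfold, so terms of the definitions reach them only
  -- through these equations. Taking equations for the operands lets nested terms be converted from
  -- the inside out.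
  +≡+ʳ : ∀ x y x′ y′ → x ≡ x′ → y ≡ y′ → x Defs.+ y ≡ x′ +ʳ y′
  +≡+ʳ x y x y refl refl = refl

  *≡*ʳ : ∀ x y x′ y′ → x ≡ x′ → y ≡ y′ → x Defs.* y ≡ x′ *ʳ y′
  *≡*ʳ x y x y refl refl = refl

  -≡-ʳ : ∀ x x′ → x ≡ x′ → Defs.- x ≡ -ʳ x′
  -≡-ʳ x x refl = refl

  √≡√ʳ : ∀ x x′ → x ≡ x′ → Defs.√ x ≡ √ʳ x′
  √≡√ʳ x x refl = refl

  isCommutativeRing : IsCommutativeRing Defs._≈_ _+ʳ_ _*ʳ_ -ʳ_ Defs.0ℝ Defs.1ℝ
  isCommutativeRing = CommutativeRing.isCommutativeRing Reals.ℝ-ring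

  +ʳ-mono-≤ : ∀ {x x′ y y′} → x ≤ x′ → y ≤ y′ → x +ʳ y ≤ x′ +ʳ y′
  +ʳ-mono-≤ {x} {x′} {y} {y′} = Reals.+-mono-≤ {x} {x′} {y} {y′}

  0≤-*ʳ : ∀ {x y} → Defs.0ℝ ≤ x → Defs.0ℝ ≤ y → Defs.0ℝ ≤ x *ʳ y
  0≤-*ʳ {x} {y} = Reals.0≤-* {x} {y}

  0≤x*ʳx : ∀ x → Defs.0ℝ ≤ x *ʳ x
  0≤x*ʳx = Reals.0≤x*x

  squareʳ-cancel : ∀ {x y} → Defs.0ℝ ≤ y → x *ʳ x ≤ y *ʳ y → x ≤ y
  squareʳ-cancel {x} {y} = Reals.square-cancel {x} {y}

  ≈0-cancelʳ : ∀ {x y} → x *ʳ y Defs.≈ Defs.0ℝ → ¬ x Defs.≈ Defs.0ℝ → y Defs.≈ Defs.0ℝ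
  ≈0-cancelʳ {x} {y} = Reals.≈0-cancel {x} {y}

  fromℕ-sucʳ : ∀ n → fromℕ (suc n) Defs.≈ Defs.1ℝ +ʳ fromℕ n
  fromℕ-sucʳ = Reals.fromℕ-suc

  reciprocalʳ : ∀ n → ∃[ c ] fromℕ (suc n) *ʳ c Defs.≈ Defs.1ℝ
  reciprocalʳ = Reals.reciprocal

  √ʳ-nonNeg : ∀ x → Defs.0ℝ ≤ √ʳ x
  √ʳ-nonNeg = Defs.√-nonNeg

√ʳ-square : ∀ {x} → Defs.0ℝ ≤ x → √ʳ x *ʳ √ʳ x Defs.≈ x
√ʳ-square {x} x≥0 = subst (Defs._≈ x)
  (*≡*ʳ (Defs.√ x) (Defs.√ x) (√ʳ x) (√ʳ x) (√≡√ʳ x x refl) (√≡√ʳ x x refl)) (Defs.√-square {x} x≥0)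

realField : RealField
realField = record
  { ring          = record { isCommutativeRing = isCommutativeRing }
  ; _≤_           = _≤_
  ; √_            = √ʳ_
  ; fromℕ         = fromℕ
  ; ≤-reflexive   = λ {x} {y} → Reals.≤-reflexive {x} {y}
  ; ≤-trans       = λ {x} {y} {z} → Reals.≤-trans {x} {y} {z}
  ; ≤-antisym     = λ {x} {y} → Reals.≤-antisym {x} {y}
  ; +-mono-≤      = λ {x} {x′} {y} {y′} → +ʳ-mono-≤ {x} {x′} {y} {y′}
  ; 0≤-*          = λ {x} {y} → 0≤-*ʳ {x} {y}
  ; 0≤x*x         = 0≤x*ʳx
  ; square-cancel = λ {x} {y} → squareʳ-cancel {x} {y}
  ; 1≰0           = Reals.1≰0
  ; ≈0-cancel     = λ {x} {y} → ≈0-cancelʳ {x} {y}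
  ; fromℕ-zero    = Reals.≈-refl {Defs.0ℝ}
  ; fromℕ-suc     = fromℕ-sucʳ
  ; reciprocal    = reciprocalʳ
  ; √-nonNeg      = √ʳ-nonNeg
  ; √-square      = λ {x} → √ʳ-square {x}
  }

open Complex realField using (normedField; frobenius; frobenius-*-≤)
module K = CommutativeRing (NormedField.ring normedField)
open import Algebra.Properties.Semiring.Exp K.semiring using () renaming (_^_ to _^ᴷ_)
open import Algebra.Properties.Semiring.Sum K.semiring using () renaming (sum to sumᴷ)
open import Algebra.Definitions.RawMonoid (RealField.+-rawMonoid realField) using () renaming (sum to sumʳ)

⟪_⟫ : ℂ → K.Carrier
⟪ z ⟫ = re z , im z

⟪⟫-* : ∀ z w → ⟪ z *ᶜ w ⟫ ≡ ⟪ z ⟫ K.* ⟪ w ⟫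
⟪⟫-* z w = cong₂ _,_
  (+≡+ʳ (re z Defs.* re w) (Defs.- (im z Defs.* im w)) (re z *ʳ re w) (-ʳ (im z *ʳ im w))
    (product (re z) (re w)) (-≡-ʳ (im z Defs.* im w) (im z *ʳ im w) (product (im z) (im w))))
  (+≡+ʳ (re z Defs.* im w) (im z Defs.* re w) (re z *ʳ im w) (im z *ʳ re w)
    (product (re z) (im w)) (product (im z) (re w)))
  where
  product : ∀ x y → x Defs.* y ≡ x *ʳ y
  product x y = *≡*ʳ x y x y refl refl

⟪⟫-+ : ∀ z w → ⟪ z Defs.+ᶜ w ⟫ ≡ ⟪ z ⟫ K.+ ⟪ w ⟫
⟪⟫-+ z w = cong₂ _,_ (+≡+ʳ (re z) (re w) (re z) (re w) refl refl) (+≡+ʳ (im z) (im w) (im z) (im w) refl refl)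

-- The operations correspond by `≡` and not just up to `≈`, so sums and powers transfer without
-- monoid laws, and results move along `subst`. Powers are multiples in the multiplicative monoid.
module RawHomomorphism {a b ℓ₁ ℓ₂} (M : RawMonoid a ℓ₁) (N : RawMonoid b ℓ₂)
  (h : RawMonoid.Carrier M → RawMonoid.Carrier N) (h-ε : h (RawMonoid.ε M) ≡ RawMonoid.ε N)
  (h-∙ : ∀ x y → h (RawMonoid._∙_ M x y) ≡ RawMonoid._∙_ N (h x) (h y)) where
  private
    module Mᵈ = RawMonoidDefinitions M
    module Nᵈ = RawMonoidDefinitions N

  ×-homo : ∀ k x → h (k Mᵈ.× x) ≡ k Nᵈ.× h x
  ×-homo zero    x = h-ε
  ×-homo (suc k) x = trans (h-∙ x (k Mᵈ.× x)) (cong (RawMonoid._∙_ N (h x)) (×-homo k x))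

  sum-homo : ∀ {m} (f : Fin m → RawMonoid.Carrier M) (g : Fin m → RawMonoid.Carrier N) →
             (∀ i → h (f i) ≡ g i) → h (Mᵈ.sum f) ≡ Nᵈ.sum g
  sum-homo {zero}  f g e = h-ε
  sum-homo {suc m} f g e = trans (h-∙ (f zero) (Mᵈ.sum λ i → f (suc i)))
    (cong₂ (RawMonoid._∙_ N) (e zero) (sum-homo (λ i → f (suc i)) (λ i → g (suc i)) λ i → e (suc i)))

⟪⟫-^ : ∀ z k → ⟪ z ^ᶜ k ⟫ ≡ ⟪ z ⟫ ^ᴷ k
⟪⟫-^ z k = RawHomomorphism.×-homo (RawSemiring.*-rawMonoid (RawRing.rawSemiring Defs.ℂ-rawRing)) K.*-rawMonoid
  ⟪_⟫ refl ⟪⟫-* k z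

⟪⟫-sum : ∀ {m} (f : Fin m → ℂ) (g : Fin m → K.Carrier) → (∀ i → ⟪ f i ⟫ ≡ g i) → ⟪ sumᶜ f ⟫ ≡ sumᴷ g
⟪⟫-sum = RawHomomorphism.sum-homo (RawSemiring.+-rawMonoid (RawRing.rawSemiring Defs.ℂ-rawRing)) K.+-rawMonoid
  ⟪_⟫ refl ⟪⟫-+

sumℝ≡sumʳ : ∀ {m} (f g : Fin m → ℝ) → (∀ i → f i ≡ g i) → sumℝ f ≡ sumʳ g
sumℝ≡sumʳ = RawHomomorphism.sum-homo (RawSemiring.+-rawMonoid (RawRing.rawSemiring Defs.ℝ-rawRing))
  (RealField.+-rawMonoid realField) (λ x → x) refl (λ x y → +≡+ʳ x y x y refl refl)

∣∣²ʳ : ℂ → ℝ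
∣∣²ʳ z = re z *ʳ re z +ʳ im z *ʳ im z

∣∣ᶜ≡√ʳ : ∀ z → Defs.∣ z ∣ᶜ ≡ √ʳ ∣∣²ʳ z
∣∣ᶜ≡√ʳ z = √≡√ʳ (re z Defs.* re z Defs.+ im z Defs.* im z) (∣∣²ʳ z)
  (+≡+ʳ (re z Defs.* re z) (im z Defs.* im z) (re z *ʳ re z) (im z *ʳ im z)
    (*≡*ʳ (re z) (re z) (re z) (re z) refl refl) (*≡*ʳ (im z) (im z) (im z) (im z) refl refl))

∣∣ᶜ²≡ : ∀ z → Defs.∣ z ∣ᶜ Defs.* Defs.∣ z ∣ᶜ ≡ √ʳ ∣∣²ʳ z *ʳ √ʳ ∣∣²ʳ z
∣∣ᶜ²≡ z = *≡*ʳ Defs.∣ z ∣ᶜ Defs.∣ z ∣ᶜ (√ʳ ∣∣²ʳ z) (√ʳ ∣∣²ʳ z) (∣∣ᶜ≡√ʳ z) (∣∣ᶜ≡√ʳ z)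

‖‖≡frobenius : ∀ {m} (A : Matrix m) → ‖ A ‖ ≡ frobenius λ i j → ⟪ A i j ⟫
‖‖≡frobenius {m} A = √≡√ʳ
  (sumℝ λ i → sumℝ λ j → Defs.∣ A i j ∣ᶜ Defs.* Defs.∣ A i j ∣ᶜ)
  (sumʳ λ i → sumʳ λ j → √ʳ ∣∣²ʳ (A i j) *ʳ √ʳ ∣∣²ʳ (A i j))
  (sumℝ≡sumʳ (λ i → sumℝ λ j → Defs.∣ A i j ∣ᶜ Defs.* Defs.∣ A i j ∣ᶜ)
             (λ i → sumʳ λ j → √ʳ ∣∣²ʳ (A i j) *ʳ √ʳ ∣∣²ʳ (A i j)) λ i →
    sumℝ≡sumʳ (λ j → Defs.∣ A i j ∣ᶜ Defs.* Defs.∣ A i j ∣ᶜ) (λ j → √ʳ ∣∣²ʳ (A i j) *ʳ √ʳ ∣∣²ʳ (A i j)) λ j →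
      ∣∣ᶜ²≡ (A i j))

Cond≡frobenius : ∀ {m} (A : Matrix m) (A⁻¹ : Invertible A) →
  Cond A A⁻¹ ≡ (frobenius λ i j → ⟪ A i j ⟫) *ʳ (frobenius λ i j → ⟪ inverse A⁻¹ i j ⟫)
Cond≡frobenius A A⁻¹ = *≡*ʳ ‖ A ‖ ‖ inverse A⁻¹ ‖ (frobenius λ i j → ⟪ A i j ⟫) (frobenius λ i j → ⟪ inverse A⁻¹ i j ⟫)
  (‖‖≡frobenius A) (‖‖≡frobenius (inverse A⁻¹))

open Sums (NormedField.ring normedField) using (δ)
open NormedField normedField using (∣_∣≤_)
open Inverse normedField using (BoundedInverse; module BoundedInverse; module ThreePrimes)

fold : ∀ {z w : ℂ} → ⟪ z ⟫ K.≈ ⟪ w ⟫ → z ≈ᶜ w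
fold (e , f) = e ,ᶜ f

δ≡1ᴹ : ∀ {m} (i j : Fin m) → ⟪ 1ᴹ i j ⟫ ≡ δ i j
δ≡1ᴹ i j with does (i Fin.≟ j)
... | true  = refl
... | false = refl

*ᴹ≈1ᴹ : ∀ {m} (A B : Matrix m) (f : Fin m → Fin m → Fin m → K.Carrier) →
  (∀ i k j → ⟪ A i j *ᶜ B j k ⟫ ≡ f i k j) → (∀ i k → sumᴷ (f i k) K.≈ δ i k) → A *ᴹ B ≈ᴹ 1ᴹ
*ᴹ≈1ᴹ A B f h e i k = fold {(A *ᴹ B) i k} {1ᴹ i k}
  (subst (⟪ (A *ᴹ B) i k ⟫ K.≈_) (sym (δ≡1ᴹ i k))
    (subst (K._≈ δ i k) (sym (⟪⟫-sum (λ j → A i j *ᶜ B j k) (f i k) (h i k))) (e i k)))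

module _ {m} (ζ : Fin m → ℂ) (X : BoundedInverse (λ i → ⟪ ζ i ⟫) (2 * (m * m))) where
  open BoundedInverse X renaming (inverse to X⁻¹)

  private
    W : Matrix m
    W i j = proj₁ (X⁻¹ i j) +i proj₂ (X⁻¹ i j)

  vandermonde⁻¹ : Invertible (vandermonde ζ)
  vandermonde⁻¹ = record
    { inverse  = W
    ; inverseˡ = *ᴹ≈1ᴹ W (vandermonde ζ) (λ i k j → X⁻¹ i j K.* ⟪ ζ j ⟫ ^ᴷ toℕ k)
        (λ i k j → trans (⟪⟫-* (W i j) (vandermonde ζ j k)) (cong (X⁻¹ i j K.*_) (⟪⟫-^ (ζ j) (toℕ k)))) inverse*vandermonde
    ; inverseʳ = *ᴹ≈1ᴹ (vandermonde ζ) W (λ i k j → ⟪ ζ i ⟫ ^ᴷ toℕ j K.* X⁻¹ j k)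
        (λ i k j → trans (⟪⟫-* (vandermonde ζ i j) (W j k)) (cong (K._* X⁻¹ j k) (⟪⟫-^ (ζ i) (toℕ j)))) vandermonde*inverse
    }

  Cond-vandermonde : Cond (vandermonde ζ) vandermonde⁻¹ ≤ fromℕ (2 * m ^ 4)
  Cond-vandermonde = subst (_≤ fromℕ (2 * m ^ 4)) (sym (Cond≡frobenius (vandermonde ζ) vandermonde⁻¹))
    (subst (λ B → frobenius (λ i j → ⟪ vandermonde ζ i j ⟫) *ʳ frobenius X⁻¹ ≤ fromℕ B)
      -- The right side is `2 * m ^ 4` unfolded; on the left stand the bounds m · 1 for V and m ·
      -- 2m² for its inverse.
      (solve 1 (λ m → m :* con 1 :* (m :* (con 2 :* (m :* m))) :=
                      con 2 :* (m :* (m :* (m :* (m :* con 1))))) refl m)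
      (frobenius-*-≤ (λ i j → ⟪ vandermonde ζ i j ⟫) X⁻¹ 1 (2 * (m * m))
        (λ i j → subst (∣_∣≤ 1) (sym (⟪⟫-^ (ζ i) (toℕ j))) (∣vandermonde∣≤1 i (toℕ j))) ∣inverse∣≤B))

  conditionBound : Σ (Invertible (vandermonde ζ)) (λ inv → Cond (vandermonde ζ) inv ≤ fromℕ (2 * m ^ 4))
  conditionBound = vandermonde⁻¹ , Cond-vandermonde

-- The Vandermonde matrix of the primitive pqr-th roots of unity.

-- `m` is a variable tied to (p - 1)(q - 1)(r - 1) by an equation, so the totient formula can be
-- used without changing the type of `ζ`.
module _ {p q r m} (p-prime : Prime p) (q-prime : Prime q) (r-prime : Prime r)
  (p≥3 : 3 ℕ.≤ p) (q≥2+p : 2 ℕ.+ p ℕ.≤ q) (r≥2+q : 2 ℕ.+ q ℕ.≤ r) (m≡ : m ≡ ℕ.pred p * ℕ.pred q * ℕ.pred r)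
  (ζ : Fin m → ℂ) (isPrimitive : ∀ i → PrimitiveRoot (p * q * r) (ζ i)) (injective : ∀ {i j} → ζ i ≈ᶜ ζ j → i ≡ j) where

  private
    n = p * q * r
    p<q = ℕ.<⇒≤ q≥2+p
    q<r = ℕ.<⇒≤ r≥2+q
    p<r = ℕ.<-trans p<q q<r
    p>1 = ℕ.<⇒≤ p≥3
    q>1 = ℕ.<-trans p>1 p<q
    r>1 = ℕ.<-trans q>1 q<r
    p>0 = ℕ.<⇒≤ p>1
    q>0 = ℕ.<⇒≤ q>1
    r>0 = ℕ.<⇒≤ r>1

    instance
      p≢0 = ℕ.>-nonZero p>0
      q≢0 = ℕ.>-nonZero q>0
      r≢0 = ℕ.>-nonZero r>0
      pq≢0 = ℕ.m*n≢0 p q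
      rp≢0 = ℕ.m*n≢0 r p
      rq≢0 = ℕ.m*n≢0 r q

    pq = bézout p q p>0 q>1 (Coprimality.sym (prime⇒coprime q-prime p<q))
    pr = bézout p r p>0 r>1 (Coprimality.sym (prime⇒coprime r-prime p<r))
    qr = bézout q r q>0 r>1 (Coprimality.sym (prime⇒coprime r-prime q<r))

    degree : m ℕ.+ 1 ℕ.+ q * p ℕ.+ r * p ℕ.+ r * q ≡ n ℕ.+ p ℕ.+ q ℕ.+ r
    degree = trans (cong (λ k → k ℕ.+ 1 ℕ.+ q * p ℕ.+ r * p ℕ.+ r * q) m≡) (degree-Φ-pqr p>0 q>0 r>0)

    bound : 4 * (p * p * q * (p ℕ.+ q)) ℕ.≤ m * m
    bound = subst (λ k → 4 * (p * p * q * (p ℕ.+ q)) ℕ.≤ k * k) (sym m≡) (size-bound p≥3 q≥2+p r≥2+q)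

    qp<n : q * p < n
    qp<n = subst (_< n) (ℕ.*-comm p q) (ℕ.m<m*n (p * q) r r>1)
    rp<n : r * p < n
    rp<n = subst (r * p <_) (solve 3 (λ p q r → r :* p :* q := p :* q :* r) refl p q r) (ℕ.m<m*n (r * p) q q>1)
    rq<n : r * q < n
    rq<n = subst (r * q <_) (solve 3 (λ p q r → r :* q :* p := p :* q :* r) refl p q r) (ℕ.m<m*n (r * q) p p>1)

    ζᴷ : Fin m → K.Carrier
    ζᴷ i = ⟪ ζ i ⟫

    root : ∀ i → ζᴷ i ^ᴷ n K.≈ K.1#
    root i = subst (K._≈ K.1#) (⟪⟫-^ (ζ i) n) (re≈ h , im≈ h)
      where h = PrimitiveRoot.isRoot (isPrimitive i)

    not-root : ∀ k → 0 < k → k < n → ∀ i → ¬ ζᴷ i ^ᴷ k K.≈ K.1#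
    not-root k k>0 k<n i e = PrimitiveRoot.minimal (isPrimitive i) k k>0 k<n
      (fold {ζ i ^ᶜ k} {1ᶜ} (subst (K._≈ K.1#) (sym (⟪⟫-^ (ζ i) k)) e))

  open ThreePrimes pq pr qr using (module Lagrange)
  open Lagrange degree p>0 q>0 r>0 ζᴷ (λ {i} {j} e → injective (fold {ζ i} {ζ j} e)) root
    (not-root (q * p) (ℕ.*-mono-< q>0 p>0) qp<n) (not-root (r * p) (ℕ.*-mono-< r>0 p>0) rp<n)
    (not-root (r * q) (ℕ.*-mono-< r>0 q>0) rq<n)
    using (boundedInverse)

  vandermonde-boundedInverse : BoundedInverse ζᴷ (2 * (m * m))
  vandermonde-boundedInverse = boundedInverse (m * m) bound

proposition4p5 :
    ∀ (p q r : ℕ) → Prime p → Prime q → Prime r → 2 ∤ p → 2 ∤ q → 2 ∤ r →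
    p < q → q < r →
    let n = p * q * r
        m = φ n in
    (ζ : Fin m → ℂ) → EnumeratesPrimitiveRoots n ζ →
    Σ (Invertible (vandermonde ζ)) (λ inv → Cond (vandermonde ζ) inv ≤ fromℕ (2 * m ^ 4))
proposition4p5 p q r p-prime q-prime r-prime 2∤p 2∤q 2∤r p<q q<r ζ enumerates =
  conditionBound ζ X
  where
  open EnumeratesPrimitiveRoots enumerates
  p≥3   = odd-prime p-prime 2∤p
  q≥2+p = odd-< 2∤p 2∤q p<q
  r≥2+q = odd-< 2∤q 2∤r q<r
  X = vandermonde-boundedInverse {p} {q} {r} p-prime q-prime r-prime p≥3 q≥2+p r≥2+q
    (φ-pqr p-prime q-prime r-prime (ℕ.<⇒≤ p≥3) p<q q<r) ζ isPrimitive injective
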